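{- Fix a real number $q$ with $0<q<\frac12$. For each integer $n\ge 1$ let $$R_n(q)=1-(1-q)^n\sum_{m=0}^{n-1}\binom{n+m-1}{m}q^m+q^n\sum_{m=0}^{n-1}\binom{n+m-1}{m}(1-q)^m .$$ Then, as $n\to\infty$, $$R_n(q)=\frac{(4q(1-q))^n}{\sqrt{\pi}\,(1-2q)}\cdot\frac{1}{\sqrt n}\left(1+\frac{c_1(q)}{n}+\frac{c_2(q)}{n^2}+\frac{c_3(q)}{n^3}+\frac{c_4(q)}{n^4}+O\!\left(\frac1{n^5}\right)\right),$$ where $$c_1(q)=\frac{12q^2-12q-1}{8(2q-1)^2},\qquad c_2(q)=\frac{1}{128}\cdot\frac{400q^4-800q^3+120q^2+280q+1}{(2q-1)^4},$$ $$c_3(q)=\frac{5}{1024}\cdot\frac{1344q^6-4032q^5+112q^4+6496q^3-3444q^2-476q+1}{(2q-1)^6},$$ $$c_4(q)=\frac{21}{32768}\cdot\frac{20224q^8-80896q^7-88832q^6+549632q^5-514400q^4+18368q^3+92368q^2+3536q-1}{(2q-1)^8}.$$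
   Context: The implied constant in $O(\cdot)$ may depend on the fixed $q$. -}

module Defs where

open import Data.Nat as ℕ using (ℕ; zero; suc; _∸_; z≤n; s≤s)
import Data.Nat.Properties as ℕₚ
open import Data.Nat.Combinatorics using (_C_)
open import Data.Integer as ℤ using (+_; -[1+_])
import Data.Integer.Properties as ℤₚ
open import Data.Rational as ℚ using (ℚ; 0ℚ; 1ℚ; ½)
import Data.Rational.Properties as ℚₚ
import Data.Rational.Unnormalised as ℚᵘ
import Data.Rational.Unnormalised.Properties as ℚᵘₚ
open import Data.Rational.Solver using (module +-*-Solver)
open import Data.Fin using (Fin; toℕ)
open import Data.Product using (∃; ∃-syntax; _×_; _,_; proj₁; proj₂)
open import Data.Sum using (_⊎_; inj₁; inj₂) renaming ([_,_]′ to either)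
open import Data.Bool using (if_then_else_)
open import Relation.Nullary using (¬_; Dec; does; yes; no; contradiction)
open import Relation.Binary.PropositionalEquality
open import Algebra.Bundles.Raw using (RawSemiring)
import Algebra.Definitions.RawSemiring as RawSemiringDefs
open import Level using (0ℓ)

module Rational where

  open import Data.Rational
  open import Data.Rational.Properties
  open +-*-Solver using (solve; _:+_; _:*_; :-_; _:-_; _:=_)

  0<½ : 0ℚ < ½
  0<½ = positive⁻¹ ½

  *-pos : ∀ {p r} → 0ℚ < p → 0ℚ < r → 0ℚ < p * r
  *-pos {p} {r} 0<p 0<r =
    positive⁻¹ (p * r) {{pos*pos⇒pos p {{positive 0<p}} r {{positive 0<r}}}}

  +-pos : ∀ {p r} → 0ℚ < p → 0ℚ < r → 0ℚ < p + r
  +-pos 0<p 0<r = +-mono-< 0<p 0<r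

  halves : ∀ p → p * ½ + p * ½ ≡ p
  halves p = trans (sym (*-distribˡ-+ p ½ ½)) (*-identityʳ p)

  divide : ∀ {p c} → 0ℚ < p → 0ℚ < c → ∃[ δ ] 0ℚ < δ × c * δ ≡ p
  divide {p} {c} 0<p 0<c = 1/ c * p , *-pos 0<1/c 0<p , eq
    where
    instance
      c-pos : Positive c
      c-pos = positive 0<c
      c-nz : NonZero c
      c-nz = pos⇒nonZero c
    0<1/c : 0ℚ < 1/ c
    0<1/c = positive⁻¹ (1/ c) {{1/pos⇒pos c}}
    eq : c * (1/ c * p) ≡ p
    eq = trans (sym (*-assoc c (1/ c) p))
               (trans (cong (_* p) (*-inverseʳ c)) (*-identityˡ p))

  0≤r-p : ∀ {p r} → p ≤ r → 0ℚ ≤ r - p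
  0≤r-p {p} {r} p≤r =
    subst (_≤ r - p) (+-inverseʳ p) (+-monoˡ-≤ (- p) p≤r)

  p-r<p : ∀ {p r} → 0ℚ ≤ r → p - r ≤ p
  p-r<p {p} {r} 0≤r =
    subst (p - r ≤_) (+-identityʳ p) (+-monoʳ-≤ p (neg-antimono-≤ 0≤r))

  p≤∣p∣ : ∀ p → p ≤ ∣ p ∣
  p≤∣p∣ p with ≤-total 0ℚ p
  ... | inj₁ 0≤p = ≤-reflexive (sym (0≤p⇒∣p∣≡p 0≤p))
  ... | inj₂ p≤0 = ≤-trans p≤0 (0≤∣p∣ p)

  -p≤∣p∣ : ∀ p → - p ≤ ∣ p ∣
  -p≤∣p∣ p = subst (- p ≤_) (∣-p∣≡∣p∣ p) (p≤∣p∣ (- p))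

  ∣∣-elim : ∀ (P : ℚ → Set) p → P p → P (- p) → P ∣ p ∣
  ∣∣-elim P p Pp P-p with ∣p∣≡p∨∣p∣≡-p p
  ... | inj₁ eq = subst P (sym eq) Pp
  ... | inj₂ eq = subst P (sym eq) P-p

  ∣-∣-comm : ∀ p r → ∣ p - r ∣ ≡ ∣ r - p ∣
  ∣-∣-comm p r = trans (sym (∣-p∣≡∣p∣ (p - r)))
    (cong ∣_∣ (solve 2 (λ p r → :- (p :- r) := r :- p) refl p r))

  p≤r+∣p-r∣ : ∀ p r → p ≤ r + ∣ p - r ∣
  p≤r+∣p-r∣ p r = begin
    p            ≡⟨ solve 2 (λ p r → p := r :+ (p :- r)) refl p r ⟩
    r + (p - r)  ≤⟨ +-monoʳ-≤ r (p≤∣p∣ (p - r)) ⟩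
    r + ∣ p - r ∣ ∎
    where open ≤-Reasoning

  p<r+c : ∀ p r {c} → ∣ p - r ∣ < c → p < r + c
  p<r+c p r lt = ≤-<-trans (p≤r+∣p-r∣ p r) (+-monoʳ-< r lt)

  p-r<c : ∀ p r {c} → p < r + c → p - r < c
  p-r<c p r {c} lt = subst (p - r <_)
    (solve 2 (λ r c → (r :+ c) :- r := c) refl r c) (+-monoˡ-< (- r) lt)

  ∣p-r∣<c : ∀ p r {c} → p < r + c → r < p + c → ∣ p - r ∣ < c
  ∣p-r∣<c p r {c} lt gt = ∣∣-elim (_< c) (p - r) (p-r<c p r lt)
    (subst (_< c) (solve 2 (λ p r → r :- p := :- (p :- r)) refl p r) (p-r<c r p gt))

  ∣∣p∣-∣r∣∣≤ : ∀ p r → ∣ ∣ p ∣ - ∣ r ∣ ∣ ≤ ∣ p - r ∣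
  ∣∣p∣-∣r∣∣≤ p r = ∣∣-elim (_≤ ∣ p - r ∣) (∣ p ∣ - ∣ r ∣) (half p r)
    (subst₂ _≤_ (solve 2 (λ a b → b :- a := :- (a :- b)) refl ∣ p ∣ ∣ r ∣)
                (∣-∣-comm r p) (half r p))
    where
    half : ∀ p r → ∣ p ∣ - ∣ r ∣ ≤ ∣ p - r ∣
    half p r = begin
      ∣ p ∣ - ∣ r ∣
        ≡⟨ cong (λ t → ∣ t ∣ - ∣ r ∣) (solve 2 (λ p r → p := (p :- r) :+ r) refl p r) ⟩
      ∣ (p - r) + r ∣ - ∣ r ∣
        ≤⟨ +-monoˡ-≤ (- ∣ r ∣) (∣p+q∣≤∣p∣+∣q∣ (p - r) r) ⟩
      (∣ p - r ∣ + ∣ r ∣) - ∣ r ∣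
        ≡⟨ solve 2 (λ a b → (a :+ b) :- b := a) refl ∣ p - r ∣ ∣ r ∣ ⟩
      ∣ p - r ∣ ∎
      where open ≤-Reasoning

  *-mono-≤₀ : ∀ {p p′ r r′} → 0ℚ ≤ p′ → 0ℚ ≤ r → p ≤ p′ → r ≤ r′ → p * r ≤ p′ * r′
  *-mono-≤₀ {p} {p′} {r} {r′} 0≤p′ 0≤r p≤p′ r≤r′ = ≤-trans
    (*-monoʳ-≤-nonNeg r {{nonNegative 0≤r}} p≤p′)
    (*-monoˡ-≤-nonNeg p′ {{nonNegative 0≤p′}} r≤r′)

  frac-≤ : ∀ {i j d e} → i ℤ.* + suc e ℤ.≤ j ℤ.* + suc d → i / suc d ≤ j / suc e
  frac-≤ {i} {j} {d} {e} h = toℚᵘ-cancel-≤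
    (ℚᵘₚ.≤-respˡ-≃ (ℚᵘₚ.≃-sym (toℚᵘ-fromℚᵘ (ℚᵘ.mkℚᵘ i d)))
      (ℚᵘₚ.≤-respʳ-≃ (ℚᵘₚ.≃-sym (toℚᵘ-fromℚᵘ (ℚᵘ.mkℚᵘ j e))) (ℚᵘ.*≤* h)))

  frac-< : ∀ {i j d e} → i ℤ.* + suc e ℤ.< j ℤ.* + suc d → i / suc d < j / suc e
  frac-< {i} {j} {d} {e} h = toℚᵘ-cancel-<
    (ℚᵘₚ.<-respˡ-≃ (ℚᵘₚ.≃-sym (toℚᵘ-fromℚᵘ (ℚᵘ.mkℚᵘ i d)))
      (ℚᵘₚ.<-respʳ-≃ (ℚᵘₚ.≃-sym (toℚᵘ-fromℚᵘ (ℚᵘ.mkℚᵘ j e))) (ℚᵘ.*<* h)))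

  frac-+1 : ∀ j k → + suc j / suc k ≡ + j / suc k + + 1 / suc k
  frac-+1 j k = toℚᵘ-injective (begin
    toℚᵘ (+ suc j / suc k)                      ≈⟨ toℚᵘ-fromℚᵘ (ℚᵘ.mkℚᵘ (+ suc j) k) ⟩
    ℚᵘ.mkℚᵘ (+ suc j) k                         ≈⟨ ℚᵘ.*≡* lemma ⟩
    ℚᵘ.mkℚᵘ (+ j) k ℚᵘ.+ ℚᵘ.mkℚᵘ (+ 1) k         ≈⟨ ℚᵘₚ.+-cong (ℚᵘₚ.≃-sym (toℚᵘ-fromℚᵘ (ℚᵘ.mkℚᵘ (+ j) k)))
                                                              (ℚᵘₚ.≃-sym (toℚᵘ-fromℚᵘ (ℚᵘ.mkℚᵘ (+ 1) k))) ⟩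
    toℚᵘ (+ j / suc k) ℚᵘ.+ toℚᵘ (+ 1 / suc k)   ≈⟨ ℚᵘₚ.≃-sym (toℚᵘ-homo-+ (+ j / suc k) (+ 1 / suc k)) ⟩
    toℚᵘ (+ j / suc k + + 1 / suc k)            ∎)
    where
    open import Relation.Binary.Reasoning.Setoid ℚᵘₚ.≃-setoid
    K = + suc k
    lemma : + suc j ℤ.* (K ℤ.* K) ≡ (+ j ℤ.* K ℤ.+ + 1 ℤ.* K) ℤ.* K
    lemma = trans (sym (ℤₚ.*-assoc (+ suc j) K K)) (cong (ℤ._* K)
      (trans (cong (ℤ._* K) (ℤₚ.+-comm (+ 1) (+ j))) (ℤₚ.*-distribʳ-+ K (+ j) (+ 1))))

  0≤frac : ∀ j k → 0ℚ ≤ + j / suc k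
  0≤frac j k = frac-≤ {+ 0} {+ j} {0} {k}
    (subst (+ 0 ℤ.≤_) (sym (ℤₚ.*-identityʳ (+ j))) (ℤ.+≤+ z≤n))

  0<frac : ∀ j k → 0ℚ < + suc j / suc k
  0<frac j k = frac-< {+ 0} {+ suc j} {0} {k}
    (subst (+ 0 ℤ.<_) (sym (ℤₚ.*-identityʳ (+ suc j))) (ℤ.+<+ (s≤s z≤n)))

  unit-anti : ∀ {m n} → m ℕ.≤ n → + 1 / suc n ≤ + 1 / suc m
  unit-anti {m} {n} m≤n = frac-≤ {+ 1} {+ 1} {n} {m}
    (subst₂ ℤ._≤_ (sym (ℤₚ.*-identityˡ (+ suc m))) (sym (ℤₚ.*-identityˡ (+ suc n)))
      (ℤ.+≤+ (s≤s m≤n)))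

  archimedean : ∀ {ε} → 0ℚ < ε → ∃[ N ] ∀ n → N ℕ.≤ n → + 1 / suc n < ε
  archimedean {mkℚ (+ 0) d c} 0<ε =
    contradiction 0<ε (λ { (*<* (ℤ.+<+ ())) })
  archimedean {mkℚ -[1+ k ] d c} (*<* ())
  archimedean {ε@(mkℚ (+ suc k) d c)} 0<ε = suc d , λ n d<n →
    ≤-<-trans (unit-anti d<n) (subst (+ 1 / suc (suc d) <_) (↥p/↧p≡p ε)
      (frac-< {+ 1} {+ suc k} {suc d} {d}
        (ℤ.+<+ (subst₂ ℕ._<_ (sym (ℕₚ.*-identityˡ (suc d))) refl
          (ℕₚ.≤-trans (ℕₚ.n<1+n (suc d)) (ℕₚ.m≤m+n (suc (suc d)) (k ℕ.* suc (suc d))))))))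

open Rational

Eventually : (ℕ → Set) → Set
Eventually P = ∃[ N ] ∀ n → N ℕ.≤ n → P n

IsCauchy : (ℕ → ℚ) → Set
IsCauchy x = ∀ ε → 0ℚ ℚ.< ε →
  ∃[ N ] ∀ m n → N ℕ.≤ m → N ℕ.≤ n → ℚ.∣ x m ℚ.- x n ∣ ℚ.< ε

module CauchyOperations where

  open import Data.Rational
  open import Data.Rational.Properties
  open +-*-Solver using (solve; _:+_; _:*_; :-_; _:-_; _:=_)

  +-cauchy : ∀ {x y} → IsCauchy x → IsCauchy y → IsCauchy (λ n → x n + y n)
  +-cauchy {x} {y} cx cy ε 0<ε
    with cx (ε * ½) (*-pos 0<ε 0<½) | cy (ε * ½) (*-pos 0<ε 0<½)
  ... | M , p | N , q = M ℕ.⊔ N , λ m n hm hn → begin-strict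
    ∣ (x m + y m) - (x n + y n) ∣
      ≡⟨ cong ∣_∣ (solve 4 (λ a b c d → (a :+ b) :- (c :+ d) := (a :- c) :+ (b :- d))
                     refl (x m) (y m) (x n) (y n)) ⟩
    ∣ (x m - x n) + (y m - y n) ∣
      ≤⟨ ∣p+q∣≤∣p∣+∣q∣ (x m - x n) (y m - y n) ⟩
    ∣ x m - x n ∣ + ∣ y m - y n ∣
      <⟨ +-mono-< (p m n (ℕₚ.m⊔n≤o⇒m≤o M N hm) (ℕₚ.m⊔n≤o⇒m≤o M N hn))
                  (q m n (ℕₚ.m⊔n≤o⇒n≤o M N hm) (ℕₚ.m⊔n≤o⇒n≤o M N hn)) ⟩
    ε * ½ + ε * ½ ≡⟨ halves ε ⟩
    ε ∎
    where open ≤-Reasoning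

  neg-cauchy : ∀ {x} → IsCauchy x → IsCauchy (λ n → - x n)
  neg-cauchy {x} cx ε 0<ε with cx ε 0<ε
  ... | N , p = N , λ m n hm hn → subst (_< ε)
    (trans (∣-∣-comm (x m) (x n))
      (cong ∣_∣ (solve 2 (λ a b → b :- a := (:- a) :- (:- b)) refl (x m) (x n))))
    (p m n hm hn)

  abs-cauchy : ∀ {x} → IsCauchy x → IsCauchy (λ n → ∣ x n ∣)
  abs-cauchy {x} cx ε 0<ε with cx ε 0<ε
  ... | N , p = N , λ m n hm hn → ≤-<-trans (∣∣p∣-∣r∣∣≤ (x m) (x n)) (p m n hm hn)

  bounded : ∀ {x} → IsCauchy x → ∃[ B ] 0ℚ < B × Eventually λ n → ∣ x n ∣ ≤ B
  bounded {x} cx with cx 1ℚ (positive⁻¹ 1ℚ)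
  ... | N , p = ∣ x N ∣ + 1ℚ , +-mono-≤-< (0≤∣p∣ (x N)) (positive⁻¹ 1ℚ) ,
    N , λ n h → <⇒≤ (p<r+c ∣ x n ∣ ∣ x N ∣
      (≤-<-trans (∣∣p∣-∣r∣∣≤ (x n) (x N)) (p n N h ℕₚ.≤-refl)))

  *-close : ∀ a b c d {A B δ} → 0ℚ < A → 0ℚ < B → ∣ a ∣ ≤ A → ∣ d ∣ ≤ B →
            ∣ a - c ∣ < δ → ∣ b - d ∣ < δ → ∣ a * b - c * d ∣ < (A + B) * δ
  *-close a b c d {A} {B} {δ} 0<A 0<B a≤A d≤B ac bd = begin-strict
    ∣ a * b - c * d ∣
      ≡⟨ cong ∣_∣ (solve 4 (λ a b c d → a :* b :- c :* d := a :* (b :- d) :+ d :* (a :- c))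
                     refl a b c d) ⟩
    ∣ a * (b - d) + d * (a - c) ∣
      ≤⟨ ∣p+q∣≤∣p∣+∣q∣ (a * (b - d)) (d * (a - c)) ⟩
    ∣ a * (b - d) ∣ + ∣ d * (a - c) ∣
      ≡⟨ cong₂ _+_ (∣p*q∣≡∣p∣*∣q∣ a (b - d)) (∣p*q∣≡∣p∣*∣q∣ d (a - c)) ⟩
    ∣ a ∣ * ∣ b - d ∣ + ∣ d ∣ * ∣ a - c ∣
      ≤⟨ +-mono-≤ (*-mono-≤₀ (<⇒≤ 0<A) (0≤∣p∣ (b - d)) a≤A ≤-refl)
                  (*-mono-≤₀ (<⇒≤ 0<B) (0≤∣p∣ (a - c)) d≤B ≤-refl) ⟩
    A * ∣ b - d ∣ + B * ∣ a - c ∣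
      <⟨ +-mono-< (*-monoʳ-<-pos A {{positive 0<A}} bd) (*-monoʳ-<-pos B {{positive 0<B}} ac) ⟩
    A * δ + B * δ ≡⟨ sym (*-distribʳ-+ δ A B) ⟩
    (A + B) * δ   ∎
    where open ≤-Reasoning

  *-cauchy-from : ∀ {x y : ℕ → ℚ} {ε A B δ} → 0ℚ < A → 0ℚ < B → (A + B) * δ ≡ ε →
    Eventually (λ n → ∣ x n ∣ ≤ A) → Eventually (λ n → ∣ y n ∣ ≤ B) →
    (∃[ N ] ∀ m n → N ℕ.≤ m → N ℕ.≤ n → ∣ x m - x n ∣ < δ) →
    (∃[ N ] ∀ m n → N ℕ.≤ m → N ℕ.≤ n → ∣ y m - y n ∣ < δ) →
    ∃[ N ] ∀ m n → N ℕ.≤ m → N ℕ.≤ n → ∣ x m * y m - x n * y n ∣ < ε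
  *-cauchy-from {x} {y} {ε} 0<A 0<B eq (M₁ , ba) (M₂ , bb) (N₁ , p) (N₂ , q) =
      (M₁ ℕ.⊔ M₂) ℕ.⊔ (N₁ ℕ.⊔ N₂) , λ m n hm hn →
      subst (∣ x m * y m - x n * y n ∣ <_) eq
        (*-close (x m) (y m) (x n) (y n) 0<A 0<B (ba m (ll m hm)) (bb n (lr n hn))
          (p m n (rl m hm) (rl n hn)) (q m n (rr m hm) (rr n hn)))
      where
      T = (M₁ ℕ.⊔ M₂) ℕ.⊔ (N₁ ℕ.⊔ N₂)
      l : ∀ k → T ℕ.≤ k → M₁ ℕ.⊔ M₂ ℕ.≤ k
      l k = ℕₚ.m⊔n≤o⇒m≤o (M₁ ℕ.⊔ M₂) (N₁ ℕ.⊔ N₂)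
      r : ∀ k → T ℕ.≤ k → N₁ ℕ.⊔ N₂ ℕ.≤ k
      r k = ℕₚ.m⊔n≤o⇒n≤o (M₁ ℕ.⊔ M₂) (N₁ ℕ.⊔ N₂)
      ll : ∀ k → T ℕ.≤ k → M₁ ℕ.≤ k
      ll k h = ℕₚ.m⊔n≤o⇒m≤o M₁ M₂ (l k h)
      lr : ∀ k → T ℕ.≤ k → M₂ ℕ.≤ k
      lr k h = ℕₚ.m⊔n≤o⇒n≤o M₁ M₂ (l k h)
      rl : ∀ k → T ℕ.≤ k → N₁ ℕ.≤ k
      rl k h = ℕₚ.m⊔n≤o⇒m≤o N₁ N₂ (r k h)
      rr : ∀ k → T ℕ.≤ k → N₂ ℕ.≤ k
      rr k h = ℕₚ.m⊔n≤o⇒n≤o N₁ N₂ (r k h)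

  *-cauchy : ∀ {x y} → IsCauchy x → IsCauchy y → IsCauchy (λ n → x n * y n)
  *-cauchy {x} {y} cx cy ε 0<ε =
    let (A , 0<A , ba)  = bounded {x} cx
        (B , 0<B , bb)  = bounded {y} cy
        (δ , 0<δ , eq)  = divide 0<ε (+-pos 0<A 0<B)
    in *-cauchy-from {x} {y} {ε} {A} {B} {δ} 0<A 0<B eq ba bb (cx δ 0<δ) (cy δ 0<δ)

  -- Total, with 1/0 = 0, so that it applies termwise: a sequence whose limit
  -- is apart from 0 may still have finitely many zero terms.
  recip : ℚ → ℚ
  recip p with p ≟ 0ℚ
  ... | yes _   = 0ℚ
  ... | no  p≢0 = (1/ p) {{≢-nonZero p≢0}}

  *-recip : ∀ {p} → p ≢ 0ℚ → p * recip p ≡ 1ℚ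
  *-recip {p} p≢0 with p ≟ 0ℚ
  ... | yes p≡0  = contradiction p≡0 p≢0
  ... | no  p≢0′ = *-inverseʳ p {{≢-nonZero p≢0′}}

  recip-close : ∀ p r {a ε} → 0ℚ < a → a ≤ ∣ p ∣ → a ≤ ∣ r ∣ →
                ∣ r - p ∣ < a * a * ε → ∣ recip p - recip r ∣ < ε
  recip-close p r {a} {ε} 0<a a≤p a≤r near =
    *-cancelˡ-<-nonNeg (a * a) {{nonNegative (<⇒≤ (*-pos 0<a 0<a))}} (begin-strict
    a * a * ∣ u - v ∣
      ≤⟨ *-mono-≤₀ (subst (0ℚ ≤_) (∣p*q∣≡∣p∣*∣q∣ p r) (0≤∣p∣ (p * r)))
                   (0≤∣p∣ (u - v))
                   (*-mono-≤₀ (0≤∣p∣ p) (<⇒≤ 0<a) a≤p a≤r) ≤-refl ⟩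
    ∣ p ∣ * ∣ r ∣ * ∣ u - v ∣
      ≡⟨ cong (_* ∣ u - v ∣) (sym (∣p*q∣≡∣p∣*∣q∣ p r)) ⟩
    ∣ p * r ∣ * ∣ u - v ∣
      ≡⟨ sym (∣p*q∣≡∣p∣*∣q∣ (p * r) (u - v)) ⟩
    ∣ p * r * (u - v) ∣
      ≡⟨ cong ∣_∣ (solve 4 (λ a b u v → a :* b :* (u :- v) := b :* (a :* u) :- a :* (b :* v))
                     refl p r u v) ⟩
    ∣ r * (p * u) - p * (r * v) ∣
      ≡⟨ cong₂ (λ s t → ∣ r * s - p * t ∣) (*-recip (nz a≤p)) (*-recip (nz a≤r)) ⟩
    ∣ r * 1ℚ - p * 1ℚ ∣
      ≡⟨ cong₂ (λ s t → ∣ s - t ∣) (*-identityʳ r) (*-identityʳ p) ⟩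
    ∣ r - p ∣
      <⟨ near ⟩
    a * a * ε ∎)
    where
    open ≤-Reasoning
    u = recip p
    v = recip r
    nz : ∀ {p} → a ≤ ∣ p ∣ → p ≢ 0ℚ
    nz a≤∣p∣ refl = <-irrefl refl (<-≤-trans 0<a a≤∣p∣)

  recip-cauchy : ∀ {x} → IsCauchy x →
                 (∃[ a ] 0ℚ < a × Eventually λ n → a ≤ ∣ x n ∣) →
                 IsCauchy (λ n → recip (x n))
  recip-cauchy {x} cx (a , 0<a , M , b) ε 0<ε =
    let (N , p) = cx (a * a * ε) (*-pos (*-pos 0<a 0<a) 0<ε)
    in M ℕ.⊔ N , λ m n hm hn →
    recip-close (x m) (x n) {a} {ε} 0<a
      (b m (ℕₚ.m⊔n≤o⇒m≤o M N hm)) (b n (ℕₚ.m⊔n≤o⇒m≤o M N hn))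
      (p n m (ℕₚ.m⊔n≤o⇒n≤o M N hn) (ℕₚ.m⊔n≤o⇒n≤o M N hm))

  grid : ℕ → ℕ → ℚ
  grid k j = + j / suc k

  -- The largest multiple u of 1/(k+1) with u² ≤ p, and 0 when p is negative.
  -- The search may start at (∣↥p∣ + 1)(k + 1) because (∣↥p∣ + 1)² > p.
  searchDown : ℕ → ℚ → ℕ → ℕ
  searchDown k p zero    = 0
  searchDown k p (suc j) =
    if does (grid k (suc j) * grid k (suc j) ≤? p) then suc j else searchDown k p j

  searchBound : ℕ → ℚ → ℕ
  searchBound k p = suc ℤ.∣ ↥ p ∣ ℕ.* suc k

  sqrtℚ : ℕ → ℚ → ℚ
  sqrtℚ k p = grid k (searchDown k p (searchBound k p))

  Lower Upper : ℕ → ℚ → ℕ → Set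
  Lower k p j = grid k j ≡ 0ℚ ⊎ grid k j * grid k j ≤ p
  Upper k p j = p < grid k (suc j) * grid k (suc j)

  searchDown-lower : ∀ k p j → Lower k p (searchDown k p j)
  searchDown-lower k p zero    = inj₁ (0/n≡0 (suc k))
  searchDown-lower k p (suc j) = go (grid k (suc j) * grid k (suc j) ≤? p)
    where
    go : (d : Dec (grid k (suc j) * grid k (suc j) ≤ p)) →
         Lower k p (if does d then suc j else searchDown k p j)
    go (yes h) = inj₂ h
    go (no  _) = searchDown-lower k p j

  searchDown-upper : ∀ k p j → Upper k p j → Upper k p (searchDown k p j)
  searchDown-upper k p zero    h = h
  searchDown-upper k p (suc j) h = go (grid k (suc j) * grid k (suc j) ≤? p)
    where
    go : (d : Dec (grid k (suc j) * grid k (suc j) ≤ p)) →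
         Upper k p (if does d then suc j else searchDown k p j)
    go (yes _) = h
    go (no ¬h) = searchDown-upper k p j (≰⇒> ¬h)

  *-square : ∀ {p v w} → p < w → 1ℚ ≤ w → w ≤ v → p < v * v
  *-square {p} {v} {w} p<w 1≤w w≤v = begin-strict
    p      <⟨ p<w ⟩
    w      ≡⟨ sym (*-identityʳ w) ⟩
    w * 1ℚ ≤⟨ *-mono-≤₀ 0≤v (nonNegative⁻¹ 1ℚ) w≤v (≤-trans 1≤w w≤v) ⟩
    v * v  ∎
    where
    open ≤-Reasoning
    0≤v : 0ℚ ≤ v
    0≤v = ≤-trans (nonNegative⁻¹ 1ℚ) (≤-trans 1≤w w≤v)

  p<1+∣↥p∣ : ∀ p → p < grid 0 (suc ℤ.∣ ↥ p ∣)
  p<1+∣↥p∣ p@(mkℚ i d _) = subst (_< grid 0 (suc ℤ.∣ i ∣)) (↥p/↧p≡p p)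
    (frac-< {i} {+ suc ℤ.∣ i ∣} {d} {0}
      (subst (ℤ._< + suc ℤ.∣ i ∣ ℤ.* + suc d) (sym (ℤₚ.*-identityʳ i))
        (ℤₚ.≤-<-trans (i≤∣i∣ i) (ℤ.+<+ (ℕₚ.m≤m*n (suc ℤ.∣ i ∣) (suc d))))))
    where
    i≤∣i∣ : ∀ i → i ℤ.≤ + ℤ.∣ i ∣
    i≤∣i∣ (+ n)    = ℤₚ.≤-refl
    i≤∣i∣ -[1+ n ] = ℤ.-≤+

  searchBound-big : ∀ k p → Upper k p (searchBound k p)
  searchBound-big k p = *-square {p} {grid k (suc b)} {grid 0 a} (p<1+∣↥p∣ p)
    (frac-≤ {+ 1} {+ a} {0} {0} (ℤ.+≤+ (s≤s z≤n)))
    (frac-≤ {+ a} {+ suc b} {0} {k}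
      (ℤ.+≤+ (ℕₚ.≤-trans (ℕₚ.n≤1+n b) (ℕₚ.≤-reflexive (sym (ℕₚ.*-identityʳ (suc b)))))))
    where
    a = suc ℤ.∣ ↥ p ∣
    b = searchBound k p

  0≤sqrtℚ : ∀ k p → 0ℚ ≤ sqrtℚ k p
  0≤sqrtℚ k p = 0≤frac (searchDown k p (searchBound k p)) k

  sqrtℚ-lower : ∀ k p → sqrtℚ k p ≡ 0ℚ ⊎ sqrtℚ k p * sqrtℚ k p ≤ p
  sqrtℚ-lower k p = searchDown-lower k p (searchBound k p)

  sqrtℚ-upper : ∀ k p → let v = sqrtℚ k p + grid k 1 in p < v * v
  sqrtℚ-upper k p = subst (λ v → p < v * v)
    (frac-+1 (searchDown k p (searchBound k p)) k)
    (searchDown-upper k p (searchBound k p) (searchBound-big k p))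

  sqrt-close : ∀ {p r u w h ε} → 0ℚ ≤ u → 0ℚ ≤ w → 0ℚ ≤ h → 0ℚ < ε →
    u ≡ 0ℚ ⊎ u * u ≤ p → r < (w + h) * (w + h) →
    ∣ p - r ∣ < ε * ½ * (ε * ½) → h < ε * ½ → u < w + ε
  sqrt-close {p} {r} {u} {w} {h} {ε} 0≤u 0≤w 0≤h 0<ε lower upper near small =
    ≰⇒> λ far → contra far lower
    where
    open ≤-Reasoning
    v η : ℚ
    v = w + h
    η = ε * ½
    0<η : 0ℚ < η
    0<η = *-pos 0<ε 0<½
    0≤v : 0ℚ ≤ v
    0≤v = +-mono-≤ 0≤w 0≤h
    0≤vη : 0ℚ ≤ v * η
    0≤vη = nonNegative⁻¹ (v * η)
      {{nonNeg*nonNeg⇒nonNeg v {{nonNegative 0≤v}} η {{nonNegative (<⇒≤ 0<η)}}}}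
    contra : w + ε ≤ u → ¬ (u ≡ 0ℚ ⊎ u * u ≤ p)
    contra far (inj₁ u≡0) = <-irrefl refl (begin-strict
      0ℚ     <⟨ +-mono-≤-< 0≤w 0<ε ⟩
      w + ε  ≤⟨ far ⟩
      u      ≡⟨ u≡0 ⟩
      0ℚ     ∎)
    contra far (inj₂ u²≤p) = <-irrefl refl (begin-strict
      u * u          ≤⟨ u²≤p ⟩
      p              <⟨ p<r+c p r near ⟩
      r + η * η      <⟨ +-monoˡ-< (η * η) upper ⟩
      v * v + η * η  ≡⟨ sym (+-identityʳ (v * v + η * η)) ⟩
      v * v + η * η + 0ℚ
        ≤⟨ +-monoʳ-≤ (v * v + η * η) (+-mono-≤ 0≤vη 0≤vη) ⟩
      v * v + η * η + (v * η + v * η)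
        ≡⟨ solve 2 (λ v η → v :* v :+ η :* η :+ (v :* η :+ v :* η)
                            := (v :+ η) :* (v :+ η)) refl v η ⟩
      (v + η) * (v + η)
        ≤⟨ *-mono-≤₀ 0≤u (+-mono-≤ 0≤v (<⇒≤ 0<η)) v+η≤u v+η≤u ⟩
      u * u          ∎)
      where
      v+η≤u : v + η ≤ u
      v+η≤u = begin
        w + h + η    ≤⟨ +-monoˡ-≤ η (+-monoʳ-≤ w (<⇒≤ small)) ⟩
        w + η + η    ≡⟨ +-assoc w η η ⟩
        w + (η + η)  ≡⟨ cong (λ t → w + t) (halves ε) ⟩
        w + ε        ≤⟨ far ⟩
        u            ∎

  sqrt-cauchy : ∀ {x} → IsCauchy x → IsCauchy (λ n → sqrtℚ n (x n))
  sqrt-cauchy {x} cx ε 0<ε =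
    let 0<η     = *-pos {ε} {½} 0<ε 0<½
        (M , p) = cx (ε * ½ * (ε * ½)) (*-pos 0<η 0<η)
        (N , q) = archimedean 0<η
    in M ℕ.⊔ N , λ m n hm hn →
      let Mm = ℕₚ.m⊔n≤o⇒m≤o M N hm
          Mn = ℕₚ.m⊔n≤o⇒m≤o M N hn
          Nm = ℕₚ.m⊔n≤o⇒n≤o M N hm
          Nn = ℕₚ.m⊔n≤o⇒n≤o M N hn
      in ∣p-r∣<c (sqrtℚ m (x m)) (sqrtℚ n (x n))
           (close m n (p m n Mm Mn) (q n Nn)) (close n m (p n m Mn Mm) (q m Nm))
    where
    close : ∀ m n → ∣ x m - x n ∣ < ε * ½ * (ε * ½) → grid n 1 < ε * ½ →
            sqrtℚ m (x m) < sqrtℚ n (x n) + ε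
    close m n = sqrt-close {x m} {x n} {sqrtℚ m (x m)} {sqrtℚ n (x n)} {grid n 1} {ε}
      (0≤sqrtℚ m (x m)) (0≤sqrtℚ n (x n)) (0≤frac 1 n) 0<ε
      (sqrtℚ-lower m (x m)) (sqrtℚ-upper n (x n))

  odd⁻¹ : ℕ → ℚ
  odd⁻¹ k = + 1 / suc (2 ℕ.* k)

  sign : ℕ → ℚ
  sign zero    = 1ℚ
  sign (suc k) = - sign k

  leibniz : ℕ → ℚ
  leibniz zero    = 0ℚ
  leibniz (suc n) = leibniz n + sign n * odd⁻¹ n

  tail : ℕ → ℕ → ℚ
  tail n zero    = 0ℚ
  tail n (suc j) = odd⁻¹ n - tail (suc n) j

  leibniz-tail : ∀ n j → leibniz (j ℕ.+ n) ≡ leibniz n + sign n * tail n j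
  leibniz-tail n zero    = sym (trans
    (cong (λ t → leibniz n + t) (*-zeroʳ (sign n))) (+-identityʳ (leibniz n)))
  leibniz-tail n (suc j) = begin
    leibniz (suc j ℕ.+ n)
      ≡⟨ cong leibniz (sym (ℕₚ.+-suc j n)) ⟩
    leibniz (j ℕ.+ suc n)
      ≡⟨ leibniz-tail (suc n) j ⟩
    leibniz n + sign n * odd⁻¹ n + - sign n * tail (suc n) j
      ≡⟨ solve 4 (λ l s a t → l :+ s :* a :+ (:- s) :* t := l :+ s :* (a :- t))
           refl (leibniz n) (sign n) (odd⁻¹ n) (tail (suc n) j) ⟩
    leibniz n + sign n * (odd⁻¹ n - tail (suc n) j) ∎
    where open ≡-Reasoning

  odd⁻¹-anti : ∀ {m n} → m ℕ.≤ n → odd⁻¹ n ≤ odd⁻¹ m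
  odd⁻¹-anti m≤n = unit-anti (ℕₚ.*-monoʳ-≤ 2 m≤n)

  tail-bounds : ∀ n j → 0ℚ ≤ tail n j × tail n j ≤ odd⁻¹ n
  tail-bounds n zero    = ≤-refl , 0≤frac 1 (2 ℕ.* n)
  tail-bounds n (suc j) =
    let (lo , hi) = tail-bounds (suc n) j
    in 0≤r-p {tail (suc n) j} {odd⁻¹ n} (≤-trans hi (odd⁻¹-anti (ℕₚ.n≤1+n n)))
     , p-r<p {odd⁻¹ n} {tail (suc n) j} lo

  ∣sign∣ : ∀ n → ∣ sign n ∣ ≡ 1ℚ
  ∣sign∣ zero    = refl
  ∣sign∣ (suc n) = trans (∣-p∣≡∣p∣ (sign n)) (∣sign∣ n)

  leibniz-near : ∀ m n → n ℕ.≤ m → ∣ leibniz m - leibniz n ∣ ≤ odd⁻¹ n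
  leibniz-near m n n≤m = begin
    ∣ leibniz m - leibniz n ∣
      ≡⟨ cong (λ k → ∣ leibniz k - leibniz n ∣) (sym (ℕₚ.m∸n+n≡m n≤m)) ⟩
    ∣ leibniz (j ℕ.+ n) - leibniz n ∣
      ≡⟨ cong (λ t → ∣ t - leibniz n ∣) (leibniz-tail n j) ⟩
    ∣ leibniz n + sign n * tail n j - leibniz n ∣
      ≡⟨ cong ∣_∣ (solve 2 (λ l t → l :+ t :- l := t) refl (leibniz n) (sign n * tail n j)) ⟩
    ∣ sign n * tail n j ∣
      ≡⟨ ∣p*q∣≡∣p∣*∣q∣ (sign n) (tail n j) ⟩
    ∣ sign n ∣ * ∣ tail n j ∣
      ≡⟨ cong₂ _*_ (∣sign∣ n) (0≤p⇒∣p∣≡p (proj₁ (tail-bounds n j))) ⟩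
    1ℚ * tail n j
      ≡⟨ *-identityˡ (tail n j) ⟩
    tail n j
      ≤⟨ proj₂ (tail-bounds n j) ⟩
    odd⁻¹ n ∎
    where
    open ≤-Reasoning
    j : ℕ
    j = m ∸ n

  leibniz-cauchy : IsCauchy leibniz
  leibniz-cauchy ε 0<ε =
    let (N , p) = archimedean 0<ε
        near : ∀ m n → N ℕ.≤ n → n ℕ.≤ m → ∣ leibniz m - leibniz n ∣ < ε
        near m n hn n≤m = ≤-<-trans (leibniz-near m n n≤m)
          (p (2 ℕ.* n) (ℕₚ.≤-trans hn (ℕₚ.m≤m+n n (n ℕ.+ 0))))
    in N , λ m n hm hn → either (near m n hn)
      (λ m≤n → subst (_< ε) (∣-∣-comm (leibniz n) (leibniz m)) (near n m hm m≤n))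
      (ℕₚ.≤-total n m)

open CauchyOperations

-- Cauchy sequences of rationals. Equality of reals is _≈_, not _≡_.
record ℝ : Set where
  constructor mkℝ
  field
    seq      : ℕ → ℚ
    isCauchy : IsCauchy seq

open ℝ public

infix 4 _≈_ _<_ _≤_

_≈_ : ℝ → ℝ → Set
x ≈ y = ∀ ε → 0ℚ ℚ.< ε → Eventually λ n → ℚ.∣ seq x n ℚ.- seq y n ∣ ℚ.< ε

_<_ : ℝ → ℝ → Set
x < y = ∃[ ε ] 0ℚ ℚ.< ε × Eventually λ n → seq x n ℚ.+ ε ℚ.< seq y n

_≤_ : ℝ → ℝ → Set
x ≤ y = ∀ ε → 0ℚ ℚ.< ε → Eventually λ n → seq x n ℚ.< seq y n ℚ.+ ε

-- Apartness from 0, the constructive condition for 1/x to exist.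
NonZero : ℝ → Set
NonZero x = ∃[ a ] 0ℚ ℚ.< a × Eventually λ n → a ℚ.≤ ℚ.∣ seq x n ∣

fromℚ : ℚ → ℝ
fromℚ p = mkℝ (λ _ → p) λ ε 0<ε → 0 , λ _ _ _ _ →
  subst (ℚ._< ε) (cong ℚ.∣_∣ (sym (ℚₚ.+-inverseʳ p))) 0<ε

ι : ℕ → ℝ
ι n = fromℚ (+ n ℚ./ 1)

infixl 6 _+_ _-_
infixl 7 _*_ _/_[_]
infix  8 -_

_+_ : ℝ → ℝ → ℝ
x + y = mkℝ (λ n → seq x n ℚ.+ seq y n) (+-cauchy {seq x} {seq y} (isCauchy x) (isCauchy y))

_*_ : ℝ → ℝ → ℝ
x * y = mkℝ (λ n → seq x n ℚ.* seq y n) (*-cauchy {seq x} {seq y} (isCauchy x) (isCauchy y))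

-_ : ℝ → ℝ
- x = mkℝ (λ n → ℚ.- seq x n) (neg-cauchy {seq x} (isCauchy x))

_-_ : ℝ → ℝ → ℝ
x - y = x + (- y)

∣_∣ : ℝ → ℝ
∣ x ∣ = mkℝ (λ n → ℚ.∣ seq x n ∣) (abs-cauchy {seq x} (isCauchy x))

_/_[_] : (x y : ℝ) → NonZero y → ℝ
x / y [ y≠0 ] = x * mkℝ (λ n → recip (seq y n)) (recip-cauchy {seq y} (isCauchy y) y≠0)

-- sqrt x is 0 for negative x.
sqrt : ℝ → ℝ
sqrt x = mkℝ (λ n → sqrtℚ n (seq x n)) (sqrt-cauchy {seq x} (isCauchy x))

-- π = 4 (1 - 1/3 + 1/5 - 1/7 + …)
π : ℝ
π = ι 4 * mkℝ leibniz leibniz-cauchy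

ℝ-rawSemiring : RawSemiring 0ℓ 0ℓ
ℝ-rawSemiring = record
  { Carrier = ℝ ; _≈_ = _≈_ ; _+_ = _+_ ; _*_ = _*_ ; 0# = ι 0 ; 1# = ι 1 }

open RawSemiringDefs ℝ-rawSemiring public using (_^_; sum)

sumBelow : ℕ → (ℕ → ℝ) → ℝ
sumBelow n f = sum {n} λ i → f (toℕ i)

infixl 6.5 sumBelow
syntax sumBelow n (λ m → e) = ∑[ m < n ] e

module Apartness where

  open import Data.Rational using (_⊓_; *<*)
  open +-*-Solver using (solve; _:+_; _:*_; :-_; _:-_; _:=_)
  open ℚₚ.≤-Reasoning

  >0⇒nonZero : ∀ {x} → ι 0 < x → NonZero x
  >0⇒nonZero {x} (a , 0<a , N , p) = a , 0<a , N , λ n h →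
    ℚₚ.≤-trans (subst (ℚ._≤ seq x n) (ℚₚ.+-identityˡ a) (ℚₚ.<⇒≤ (p n h))) (p≤∣p∣ (seq x n))

  <0⇒nonZero : ∀ {x} → x < ι 0 → NonZero x
  <0⇒nonZero {x} (a , 0<a , N , p) = a , 0<a , N , λ n h →
    ℚₚ.≤-trans (lemma (seq x n) (ℚₚ.<⇒≤ (p n h))) (-p≤∣p∣ (seq x n))
    where
    lemma : ∀ t → t ℚ.+ a ℚ.≤ 0ℚ → a ℚ.≤ ℚ.- t
    lemma t le = subst₂ ℚ._≤_
      (solve 2 (λ t a → (:- t) :+ (t :+ a) := a) refl t a)
      (ℚₚ.+-identityʳ (ℚ.- t)) (ℚₚ.+-monoʳ-≤ (ℚ.- t) le)

  *-nonZero : ∀ {x y} → NonZero x → NonZero y → NonZero (x * y)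
  *-nonZero {x} {y} (a , 0<a , M , p) (b , 0<b , N , q) =
    a ℚ.* b , *-pos 0<a 0<b , M ℕ.⊔ N , λ n h →
      subst (a ℚ.* b ℚ.≤_) (sym (ℚₚ.∣p*q∣≡∣p∣*∣q∣ (seq x n) (seq y n)))
        (*-mono-≤₀ (ℚₚ.0≤∣p∣ (seq x n)) (ℚₚ.<⇒≤ 0<b)
          (p n (ℕₚ.m⊔n≤o⇒m≤o M N h)) (q n (ℕₚ.m⊔n≤o⇒n≤o M N h)))

  0<ι : ∀ n .{{_ : ℕ.NonZero n}} → ι 0 < ι n
  0<ι (suc n) = ½ , 0<½ , 0 , λ _ _ → ℚₚ.<-≤-trans ½<1 (frac-≤ {+ 1} {+ suc n} {0} {0} (ℤ.+≤+ (s≤s z≤n)))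
    where
    ½<1 : 0ℚ ℚ.+ ½ ℚ.< 1ℚ
    ½<1 = *<* (ℤ.+<+ (s≤s (s≤s z≤n)))

  ι-nonZero : ∀ n .{{_ : ℕ.NonZero n}} → NonZero (ι n)
  ι-nonZero n = >0⇒nonZero {ι n} (0<ι n)

  ^-nonZero : ∀ {x} k → NonZero x → NonZero (x ^ k)
  ^-nonZero         zero    x≠0 = ι-nonZero 1
  ^-nonZero {x = x} (suc k) x≠0 = *-nonZero {x} {x ^ k} x≠0 (^-nonZero {x} k x≠0)

  sqrt-nonZero : ∀ {x} → ι 0 < x → NonZero (sqrt x)
  sqrt-nonZero {x} (ε , 0<ε , M , p) = η ℚ.* ½ , 0<η½ , M ℕ.⊔ proj₁ small , λ n h →
    ℚₚ.≤-trans (ℚₚ.≮⇒≥ (bound n (p n (ℕₚ.m⊔n≤o⇒m≤o M (proj₁ small) h))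
                              (proj₂ small n (ℕₚ.m⊔n≤o⇒n≤o M (proj₁ small) h))))
               (p≤∣p∣ (sqrtℚ n (seq x n)))
    where
    η = ε ⊓ 1ℚ
    0<η : 0ℚ ℚ.< η
    0<η with ℚₚ.⊓-sel ε 1ℚ
    ... | inj₁ eq = subst (0ℚ ℚ.<_) (sym eq) 0<ε
    ... | inj₂ eq = subst (0ℚ ℚ.<_) (sym eq) (ℚₚ.positive⁻¹ 1ℚ)
    0<η½ : 0ℚ ℚ.< η ℚ.* ½
    0<η½ = *-pos 0<η 0<½
    small = archimedean 0<η½
    bound : ∀ n → 0ℚ ℚ.+ ε ℚ.< seq x n → + 1 ℚ./ suc n ℚ.< η ℚ.* ½ →
            ¬ (sqrtℚ n (seq x n) ℚ.< η ℚ.* ½)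
    bound n ε<x 1/n<η½ u<η½ = ℚₚ.<-irrefl refl (begin-strict
      0ℚ ℚ.+ ε   <⟨ ε<x ⟩
      seq x n    <⟨ sqrtℚ-upper n (seq x n) ⟩
      v ℚ.* v    ≤⟨ *-mono-≤₀ (ℚₚ.<⇒≤ 0<η) 0≤v v≤η v≤η ⟩
      η ℚ.* η    ≤⟨ *-mono-≤₀ (ℚₚ.<⇒≤ 0<ε) (ℚₚ.<⇒≤ 0<η) (ℚₚ.p⊓q≤p ε 1ℚ) (ℚₚ.p⊓q≤q ε 1ℚ) ⟩
      ε ℚ.* 1ℚ   ≡⟨ ℚₚ.*-identityʳ ε ⟩
      ε          ≡⟨ sym (ℚₚ.+-identityˡ ε) ⟩
      0ℚ ℚ.+ ε   ∎)
      where
      v = sqrtℚ n (seq x n) ℚ.+ + 1 ℚ./ suc n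
      0≤v : 0ℚ ℚ.≤ v
      0≤v = ℚₚ.+-mono-≤ (0≤sqrtℚ n (seq x n)) (0≤frac 1 n)
      v≤η : v ℚ.≤ η
      v≤η = ℚₚ.≤-trans (ℚₚ.<⇒≤ (ℚₚ.+-mono-< u<η½ 1/n<η½)) (ℚₚ.≤-reflexive (halves η))

  0<π : ι 0 < π
  0<π = 1ℚ , ℚₚ.positive⁻¹ 1ℚ , 1 , λ { (suc j) _ → begin-strict
    0ℚ ℚ.+ 1ℚ                            <⟨ *<* (ℤ.+<+ (ℕₚ.m≤m+n 4 4)) ⟩
    four ℚ.* ⅔                           ≤⟨ ℚₚ.*-monoˡ-≤-nonNeg four (lower j) ⟩
    four ℚ.* leibniz (suc j)             ∎ }
    where
    four = + 4 ℚ./ 1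
    ⅔ = 1ℚ ℚ.- + 1 ℚ./ 3
    lower : ∀ j → ⅔ ℚ.≤ leibniz (suc j)
    lower j = begin
      ⅔                                      ≤⟨ ℚₚ.+-monoʳ-≤ 1ℚ (ℚₚ.neg-antimono-≤ (proj₂ (tail-bounds 1 j))) ⟩
      tail 0 (suc j)                         ≡⟨ sym (ℚₚ.*-identityˡ _) ⟩
      1ℚ ℚ.* tail 0 (suc j)                  ≡⟨ sym (ℚₚ.+-identityˡ _) ⟩
      leibniz 0 ℚ.+ sign 0 ℚ.* tail 0 (suc j) ≡⟨ sym (leibniz-tail 0 (suc j)) ⟩
      leibniz (suc j ℕ.+ 0)                  ≡⟨ cong leibniz (ℕₚ.+-identityʳ (suc j)) ⟩
      leibniz (suc j)                        ∎

  double : ∀ p ε → p ℚ.+ ε ℚ.< ½ → + 2 ℚ./ 1 ℚ.* p ℚ.+ + 2 ℚ./ 1 ℚ.* ε ℚ.< 1ℚ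
  double p ε h = subst (ℚ._< 1ℚ) (ℚₚ.*-distribˡ-+ (+ 2 ℚ./ 1) p ε)
    (ℚₚ.*-monoʳ-<-pos (+ 2 ℚ./ 1) h)

  below : ∀ a b → a ℚ.+ b ℚ.< 1ℚ → a ℚ.- 1ℚ ℚ.+ b ℚ.< 0ℚ
  below a b h = subst (ℚ._< 0ℚ) (solve 3 (λ a b c → a :+ b :- c := a :- c :+ b) refl a b 1ℚ)
    (subst (a ℚ.+ b ℚ.- 1ℚ ℚ.<_) (ℚₚ.+-inverseʳ 1ℚ) (ℚₚ.+-monoˡ-< (ℚ.- 1ℚ) h))

  above : ∀ a b → a ℚ.+ b ℚ.< 1ℚ → 0ℚ ℚ.+ b ℚ.< 1ℚ ℚ.- a
  above a b h = subst (ℚ._< 1ℚ ℚ.- a)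
    (trans (solve 2 (λ a b → a :+ b :- a := b) refl a b) (sym (ℚₚ.+-identityˡ b)))
    (ℚₚ.+-monoˡ-< (ℚ.- a) h)

  0<2ε : ∀ {ε} → 0ℚ ℚ.< ε → 0ℚ ℚ.< + 2 ℚ./ 1 ℚ.* ε
  0<2ε {ε} = *-pos {+ 2 ℚ./ 1} {ε} (0<frac 1 0)

  2q-1-nonZero : ∀ {q} → q < fromℚ ½ → NonZero (ι 2 * q - ι 1)
  2q-1-nonZero {q} (ε , 0<ε , N , p) = <0⇒nonZero {ι 2 * q - ι 1}
    (+ 2 ℚ./ 1 ℚ.* ε , 0<2ε 0<ε , N , λ n h →
      below (+ 2 ℚ./ 1 ℚ.* seq q n) (+ 2 ℚ./ 1 ℚ.* ε) (double (seq q n) ε (p n h)))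

  1-2q-nonZero : ∀ {q} → q < fromℚ ½ → NonZero (ι 1 - ι 2 * q)
  1-2q-nonZero {q} (ε , 0<ε , N , p) = >0⇒nonZero {ι 1 - ι 2 * q}
    (+ 2 ℚ./ 1 ℚ.* ε , 0<2ε 0<ε , N , λ n h →
      above (+ 2 ℚ./ 1 ℚ.* seq q n) (+ 2 ℚ./ 1 ℚ.* ε) (double (seq q n) ε (p n h)))

open Apartness public

-- n + m ∸ 1 agrees with n + m - 1 because n is at least 1 whenever m < n.
R : ℝ → ℕ → ℝ
R q n = ι 1
  - (ι 1 - q) ^ n * (∑[ m < n ] ι ((n ℕ.+ m ∸ 1) C m) * q ^ m)
  + q ^ n * (∑[ m < n ] ι ((n ℕ.+ m ∸ 1) C m) * (ι 1 - q) ^ m)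

module Coefficients (q : ℝ) (q<½ : q < fromℚ ½) where

  d : ℝ
  d = ι 2 * q - ι 1

  d^_≠0 : ∀ k → NonZero (d ^ k)
  d^ k ≠0 = ^-nonZero {d} k (2q-1-nonZero {q} q<½)

  c₁ c₂ c₃ c₄ : ℝ
  c₁ = (ι 12 * q ^ 2 - ι 12 * q - ι 1)
       / (ι 8 * d ^ 2) [ *-nonZero {ι 8} {d ^ 2} (ι-nonZero 8) (d^ 2 ≠0) ]
  c₂ = fromℚ (+ 1 ℚ./ 128) *
       ((ι 400 * q ^ 4 - ι 800 * q ^ 3 + ι 120 * q ^ 2 + ι 280 * q + ι 1) / (d ^ 4) [ d^ 4 ≠0 ])
  c₃ = fromℚ (+ 5 ℚ./ 1024) *
       ((ι 1344 * q ^ 6 - ι 4032 * q ^ 5 + ι 112 * q ^ 4 + ι 6496 * q ^ 3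
         - ι 3444 * q ^ 2 - ι 476 * q + ι 1) / (d ^ 6) [ d^ 6 ≠0 ])
  c₄ = fromℚ (+ 21 ℚ./ 32768) *
       ((ι 20224 * q ^ 8 - ι 80896 * q ^ 7 - ι 88832 * q ^ 6 + ι 549632 * q ^ 5
         - ι 514400 * q ^ 4 + ι 18368 * q ^ 3 + ι 92368 * q ^ 2 + ι 3536 * q - ι 1)
        / (d ^ 8) [ d^ 8 ≠0 ])

  √π[1-2q]≠0 : NonZero (sqrt π * (ι 1 - ι 2 * q))
  √π[1-2q]≠0 = *-nonZero {sqrt π} {ι 1 - ι 2 * q} (sqrt-nonZero {π} 0<π) (1-2q-nonZero {q} q<½)

√n≠0 : ∀ n .{{_ : ℕ.NonZero n}} → NonZero (sqrt (ι n))
√n≠0 n = sqrt-nonZero {ι n} (0<ι n)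

infixl 7 _/[_^_]
_/[_^_] : ℝ → (n k : ℕ) .{{_ : ℕ.NonZero n}} → ℝ
c /[ n ^ k ] = c / (ι n ^ k) [ ^-nonZero {ι n} k (ι-nonZero n) ]

Sequence : Set
Sequence = (n : ℕ) .{{_ : ℕ.NonZero n}} → ℝ

infix 4 _=O_
_=O_ : Sequence → Sequence → Set
f =O g = ∃[ K ] ∃[ N ] ∀ n .{{_ : ℕ.NonZero n}} → N ℕ.≤ n → ∣ f n ∣ ≤ K * ∣ g n ∣

module Submission where

-- With p = 1 - q and a n = C(2n,n)/4ⁿ one has R n - R (n+1) = (p - q) a n (4pq)ⁿ and R n → 0, so R n
-- is the tail of a series. An approximant (p - q) a n (4pq)ⁿ y G(1/n), y = 1/(1-2q)², whose
-- differences agree with these terms up to O(n⁻⁵) relatively is therefore within O(n⁻⁵) of R n.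
-- For √(πn) a n the same comparison is applied to n a n², whose limit 1/π is found from the identity
-- Σ (-1)ᵏ w n k / (2k+1) = (n+1) / ((2n+1)² (a n)²): its left side is a damped Leibniz series.
-- A real number is a Cauchy sequence and all operations act termwise, so every estimate is made on
-- rational terms, with constants that are uniform along the sequence of q.

-- The factor y comes from 4pq + (p - q)² = 1: it equals 1/(1 - 4pq), the sum of the geometric
-- series that the tail would be if a n were constant, and G corrects for the slow decay of a n.
-- With t = 1/(16n), consecutive terms have ratio 4pq(1+8t)/(1+16t), and 4pq y = y - 1 removes 4pq,
-- so the matching condition on G is polynomial in t and y and determines G order by order. What is
-- left over is a polynomial identity for the ring solver, with a remainder bounded by the absolute
-- values of its coefficients.
--
-- The obstacle on the other side is that π is a Leibniz series, so it must be tied to central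
-- binomials without integrals. The identity used for this is the integral of cos^(2n+1) over
-- [0, π/2], computed once from the Fourier expansion and once by Wallis's recurrence; here it is
-- proved by telescoping finite sums.
--
-- Two indices must be kept apart: n, and the index k of the rational approximations to q, π and the
-- square roots. All bounds have the shape C/n⁵ + C(n)/(k+1). Only C must be independent of both;
-- the second summand vanishes for fixed n because `_≤_` on reals allows any ε for large k.

import Defs

module Estimates where

  open import Algebra.Solver.Ring.AlmostCommutativeRing using (fromCommutativeRing; _-Raw-AlmostCommutative⟶_)
  import Algebra.Solver.Ring as RingSolver
  open import Data.Fin using (Fin; zero; suc)
  open import Data.Integer as ℤ using (ℤ; +_; -[1+_])
  import Data.Integer.Properties as ℤₚ
  open import Data.List as List using (List; []; _∷_)
  open import Data.Maybe as Maybe using (Maybe)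
  open import Data.Nat as ℕ using (ℕ; zero; suc)
  open import Data.Nat.Combinatorics using (nCk≡nC[n∸k]; nCk+nC[k+1]≡[n+1]C[k+1]; nCn≡1)
    renaming (_C_ to _choose_)
  import Data.Nat.Properties as ℕₚ
  open import Data.Product using (∃-syntax; _×_; _,_; proj₁; proj₂)
  open import Data.Rational
  open import Data.Rational.Properties
  import Data.Rational.Unnormalised as ℚᵘ
  import Data.Rational.Unnormalised.Properties as ℚᵘₚ
  open import Data.Sum using (_⊎_; inj₁; inj₂)
  open import Data.Vec using (Vec; []; _∷_; lookup)
  open import Function using (id)
  open import Relation.Binary.PropositionalEquality hiding (J)
  open import Relation.Nullary using (yes; no)
  open import Relation.Nullary.Decidable using (dec⇒maybe)
  open import Algebra.Definitions.RawSemiring +-*-rawSemiring using (_^_)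
  open Defs.Rational
  open Defs.CauchyOperations using
    (odd⁻¹; odd⁻¹-anti; sign; ∣sign∣; leibniz; leibniz-tail; tail-bounds; tail;
     sqrtℚ; 0≤sqrtℚ; sqrtℚ-lower; sqrtℚ-upper; recip; *-recip)

  -- Integers in ℚ and a ring solver over them.

  fromℤ : ℤ → ℚ
  fromℤ i = i / 1

  fromℤ-+ : ∀ i j → fromℤ (i ℤ.+ j) ≡ fromℤ i + fromℤ j
  fromℤ-+ i j = toℚᵘ-injective (begin
    toℚᵘ (fromℤ (i ℤ.+ j))                       ≈⟨ toℚᵘ-fromℚᵘ (ℚᵘ.mkℚᵘ (i ℤ.+ j) 0) ⟩
    ℚᵘ.mkℚᵘ (i ℤ.+ j) 0                          ≈⟨ ℚᵘ.*≡* (cong (ℤ._* + 1) (sym (cong₂ ℤ._+_ (ℤₚ.*-identityʳ i) (ℤₚ.*-identityʳ j)))) ⟩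
    ℚᵘ.mkℚᵘ i 0 ℚᵘ.+ ℚᵘ.mkℚᵘ j 0                 ≈⟨ ℚᵘₚ.+-cong (ℚᵘₚ.≃-sym (toℚᵘ-fromℚᵘ (ℚᵘ.mkℚᵘ i 0))) (ℚᵘₚ.≃-sym (toℚᵘ-fromℚᵘ (ℚᵘ.mkℚᵘ j 0))) ⟩
    toℚᵘ (fromℤ i) ℚᵘ.+ toℚᵘ (fromℤ j)           ≈⟨ ℚᵘₚ.≃-sym (toℚᵘ-homo-+ (fromℤ i) (fromℤ j)) ⟩
    toℚᵘ (fromℤ i + fromℤ j)                     ∎)
    where open import Relation.Binary.Reasoning.Setoid ℚᵘₚ.≃-setoid

  fromℤ-* : ∀ i j → fromℤ (i ℤ.* j) ≡ fromℤ i * fromℤ j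
  fromℤ-* i j = toℚᵘ-injective (begin
    toℚᵘ (fromℤ (i ℤ.* j))                       ≈⟨ toℚᵘ-fromℚᵘ (ℚᵘ.mkℚᵘ (i ℤ.* j) 0) ⟩
    ℚᵘ.mkℚᵘ i 0 ℚᵘ.* ℚᵘ.mkℚᵘ j 0                 ≈⟨ ℚᵘₚ.*-cong (ℚᵘₚ.≃-sym (toℚᵘ-fromℚᵘ (ℚᵘ.mkℚᵘ i 0))) (ℚᵘₚ.≃-sym (toℚᵘ-fromℚᵘ (ℚᵘ.mkℚᵘ j 0))) ⟩
    toℚᵘ (fromℤ i) ℚᵘ.* toℚᵘ (fromℤ j)           ≈⟨ ℚᵘₚ.≃-sym (toℚᵘ-homo-* (fromℤ i) (fromℤ j)) ⟩
    toℚᵘ (fromℤ i * fromℤ j)                     ∎)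
    where open import Relation.Binary.Reasoning.Setoid ℚᵘₚ.≃-setoid

  fromℤ-neg : ∀ i → fromℤ (ℤ.- i) ≡ - fromℤ i
  fromℤ-neg i = toℚᵘ-injective (begin
    toℚᵘ (fromℤ (ℤ.- i))        ≈⟨ toℚᵘ-fromℚᵘ (ℚᵘ.mkℚᵘ (ℤ.- i) 0) ⟩
    ℚᵘ.- ℚᵘ.mkℚᵘ i 0            ≈⟨ ℚᵘₚ.-‿cong (ℚᵘₚ.≃-sym (toℚᵘ-fromℚᵘ (ℚᵘ.mkℚᵘ i 0))) ⟩
    ℚᵘ.- toℚᵘ (fromℤ i)         ≈⟨ ℚᵘₚ.≃-sym (toℚᵘ-homo‿- (fromℤ i)) ⟩
    toℚᵘ (- fromℤ i)            ∎)
    where open import Relation.Binary.Reasoning.Setoid ℚᵘₚ.≃-setoid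

  fromℤ-morphism : ℤ.+-*-rawRing -Raw-AlmostCommutative⟶ fromCommutativeRing +-*-commutativeRing
  fromℤ-morphism = record
    { ⟦_⟧ = fromℤ ; +-homo = fromℤ-+ ; *-homo = fromℤ-* ; -‿homo = fromℤ-neg
    ; 0-homo = refl ; 1-homo = refl }

  private
    decideCoefficients : ∀ i j → Maybe (fromℤ i ≡ fromℤ j)
    decideCoefficients i j = Maybe.map (cong fromℤ) (dec⇒maybe (i ℤ.≟ j))

  -- Integer coefficients spare the normalisation of the large identities any reduction of
  -- fractions. A rational constant such as ½ is therefore entered as a variable, and an equation
  -- such as `½*2` is passed to `using₁` or `using₂`.
  module Solver = RingSolver ℤ.+-*-rawRing (fromCommutativeRing +-*-commutativeRing)
    fromℤ-morphism decideCoefficients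

  open Solver using (Polynomial; ⟦_⟧; op; con; var; _:+_; _:*_; _:-_; :-_; _:^_; solve; _:=_)

  infix 30 #_
  #_ : ∀ {n} → ℕ → Polynomial n
  # k = con (+ k)

  fromℕ : ℕ → ℚ
  fromℕ n = fromℤ (+ n)

  fromℕ-suc : ∀ n → fromℕ (suc n) ≡ 1ℚ + fromℕ n
  fromℕ-suc n = fromℤ-+ (+ 1) (+ n)

  fromℕ-+ : ∀ m n → fromℕ (m ℕ.+ n) ≡ fromℕ m + fromℕ n
  fromℕ-+ m n = fromℤ-+ (+ m) (+ n)

  fromℕ-* : ∀ m n → fromℕ (m ℕ.* n) ≡ fromℕ m * fromℕ n
  fromℕ-* m n = trans (cong fromℤ (ℤₚ.pos-* m n)) (fromℤ-* (+ m) (+ n))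

  fromℕ-mono : ∀ {m n} → m ℕ.≤ n → fromℕ m ≤ fromℕ n
  fromℕ-mono {m} {n} m≤n = frac-≤ {+ m} {+ n} {0} {0}
    (subst₂ ℤ._≤_ (sym (ℤₚ.*-identityʳ (+ m))) (sym (ℤₚ.*-identityʳ (+ n))) (ℤ.+≤+ m≤n))

  0≤fromℕ : ∀ n → 0ℚ ≤ fromℕ n
  0≤fromℕ n = 0≤frac n 0

  inv : ℕ → ℚ
  inv n = + 1 / suc n

  0≤inv : ∀ n → 0ℚ ≤ inv n
  0≤inv n = 0≤frac 1 n

  fromℕ*inv : ∀ n → fromℕ (suc n) * inv n ≡ 1ℚ
  fromℕ*inv n = toℚᵘ-injective (begin
    toℚᵘ (fromℕ (suc n) * inv n)
      ≈⟨ toℚᵘ-homo-* (fromℕ (suc n)) (inv n) ⟩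
    toℚᵘ (fromℕ (suc n)) ℚᵘ.* toℚᵘ (inv n)
      ≈⟨ ℚᵘₚ.*-cong (toℚᵘ-fromℚᵘ (ℚᵘ.mkℚᵘ (+ suc n) 0)) (toℚᵘ-fromℚᵘ (ℚᵘ.mkℚᵘ (+ 1) n)) ⟩
    ℚᵘ.mkℚᵘ (+ suc n) 0 ℚᵘ.* ℚᵘ.mkℚᵘ (+ 1) n
      ≈⟨ ℚᵘ.*≡* (trans (ℤₚ.*-identityʳ _) (trans (ℤₚ.*-identityʳ (+ suc n))
           (sym (trans (ℤₚ.*-identityˡ _) (cong (λ k → + suc k) (ℕₚ.+-identityʳ n)))))) ⟩
    toℚᵘ 1ℚ ∎)
    where open import Relation.Binary.Reasoning.Setoid ℚᵘₚ.≃-setoid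

  -- Linear combinations of hypotheses: the ring solver supplies the last argument.
  using₁ : ∀ {l r a b} k → a ≡ b → l ≡ r + k * (a - b) → l ≡ r
  using₁ {l} {r} {a} k refl eq = trans eq
    (solve 3 (λ r k a → r :+ k :* (a :- a) := r) refl r k a)

  using₂ : ∀ {l r a b c d} k → a ≡ b → ∀ j → c ≡ d →
           l ≡ r + k * (a - b) + j * (c - d) → l ≡ r
  using₂ k h j h′ eq = using₁ k h (using₁ j h′ eq)

  -- Order and absolute value in ℚ.

  0≤1 : 0ℚ ≤ 1ℚ
  0≤1 = nonNegative⁻¹ 1ℚ

  *-nonNeg : ∀ {p r} → 0ℚ ≤ p → 0ℚ ≤ r → 0ℚ ≤ p * r
  *-nonNeg {p} {r} 0≤p 0≤r =
    nonNegative⁻¹ (p * r) {{nonNeg*nonNeg⇒nonNeg p {{nonNegative 0≤p}} r {{nonNegative 0≤r}}}}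

  +-nonNeg : ∀ {p r} → 0ℚ ≤ p → 0ℚ ≤ r → 0ℚ ≤ p + r
  +-nonNeg = +-mono-≤

  0≤square : ∀ x → 0ℚ ≤ x * x
  0≤square x = ∣∣-elim (λ t → 0ℚ ≤ t * t → 0ℚ ≤ x * x) x id
    (subst (0ℚ ≤_) (solve 1 (λ x → :- x :* :- x := x :* x) refl x)) (*-nonNeg (0≤∣p∣ x) (0≤∣p∣ x))

  ^-nonNeg : ∀ {p} n → 0ℚ ≤ p → 0ℚ ≤ p ^ n
  ^-nonNeg zero    0≤p = 0≤1
  ^-nonNeg (suc n) 0≤p = *-nonNeg 0≤p (^-nonNeg n 0≤p)

  ^-pos : ∀ {p} n → 0ℚ < p → 0ℚ < p ^ n
  ^-pos zero    0<p = positive⁻¹ 1ℚ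
  ^-pos (suc n) 0<p = *-pos 0<p (^-pos n 0<p)

  ^-mono : ∀ {p r} n → 0ℚ ≤ p → p ≤ r → p ^ n ≤ r ^ n
  ^-mono zero    0≤p p≤r = ≤-refl
  ^-mono (suc n) 0≤p p≤r = *-mono-≤₀ (≤-trans 0≤p p≤r) (^-nonNeg n 0≤p) p≤r (^-mono n 0≤p p≤r)

  1^ : ∀ n → 1ℚ ^ n ≡ 1ℚ
  1^ zero    = refl
  1^ (suc n) = trans (*-identityˡ _) (1^ n)

  ^≤1 : ∀ {p} n → 0ℚ ≤ p → p ≤ 1ℚ → p ^ n ≤ 1ℚ
  ^≤1 n 0≤p p≤1 = ≤-trans (^-mono n 0≤p p≤1) (≤-reflexive (1^ n))

  ^-distrib : ∀ p r n → (p * r) ^ n ≡ p ^ n * r ^ n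
  ^-distrib p r zero    = refl
  ^-distrib p r (suc n) = trans (cong (p * r *_) (^-distrib p r n))
    (solve 4 (λ p r a b → p :* r :* (a :* b) := p :* a :* (r :* b)) refl p r (p ^ n) (r ^ n))

  ≤-offset : ∀ {p r} e → 0ℚ ≤ e → r ≡ p + e → p ≤ r
  ≤-offset {p} e 0≤e refl = subst (_≤ p + e) (+-identityʳ p) (+-monoʳ-≤ p 0≤e)

  *-monoˡ : ∀ {p r s} → 0ℚ ≤ s → p ≤ r → s * p ≤ s * r
  *-monoˡ {s = s} 0≤s = *-monoˡ-≤-nonNeg s {{nonNegative 0≤s}}

  *-monoʳ : ∀ {p r s} → 0ℚ ≤ s → p ≤ r → p * s ≤ r * s
  *-monoʳ {s = s} 0≤s = *-monoʳ-≤-nonNeg s {{nonNegative 0≤s}}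

  *-cancelˡ-≤ : ∀ {p r s} → 0ℚ < s → s * p ≤ s * r → p ≤ r
  *-cancelˡ-≤ {s = s} 0<s = *-cancelˡ-≤-pos s {{positive 0<s}}

  *-cancelˡ : ∀ {p r s} → 0ℚ < s → s * p ≡ s * r → p ≡ r
  *-cancelˡ 0<s eq = ≤-antisym (*-cancelˡ-≤ 0<s (≤-reflexive eq)) (*-cancelˡ-≤ 0<s (≤-reflexive (sym eq)))

  ∣∣≤ : ∀ {p b} → p ≤ b → - p ≤ b → ∣ p ∣ ≤ b
  ∣∣≤ {p} {b} = ∣∣-elim (_≤ b) p

  ∣*∣ : ∀ {p s} → 0ℚ ≤ s → ∣ s * p ∣ ≡ s * ∣ p ∣
  ∣*∣ {p} {s} 0≤s = trans (∣p*q∣≡∣p∣*∣q∣ s p) (cong (_* ∣ p ∣) (0≤p⇒∣p∣≡p 0≤s))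

  ∣-∣-triangle : ∀ p r s → ∣ p - s ∣ ≤ ∣ p - r ∣ + ∣ r - s ∣
  ∣-∣-triangle p r s = subst (λ x → ∣ x ∣ ≤ ∣ p - r ∣ + ∣ r - s ∣)
    (solve 3 (λ p r s → p :- r :+ (r :- s) := p :- s) refl p r s) (∣p+q∣≤∣p∣+∣q∣ (p - r) (r - s))

  -- Polynomials as syntax, and their bounds.

  horner : ∀ {n} → Polynomial n → List (Polynomial n) → Polynomial n
  horner x []       = # 0
  horner x (c ∷ cs) = c :+ x :* horner x cs

  -- For d + 1 coefficients this is `x` to the power d times the polynomial at y/x. It clears
  -- denominators when the parameter t is replaced by its successor t/(1+16t).
  homogeneous : ∀ {n} → Polynomial n → Polynomial n → List (Polynomial n) → Polynomial n
  homogeneous x y []       = # 0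
  homogeneous x y (c ∷ cs) = c :* x :^ List.length cs :+ y :* homogeneous x y cs

  coefficients : ∀ {n} → List ℤ → List (Polynomial n)
  coefficients = List.map con

  majorant : ∀ {n} → Polynomial n → Polynomial n
  majorant (op o p r) = op o (majorant p) (majorant r)
  majorant (con c)    = con (+ ℤ.∣ c ∣)
  majorant (var x)    = var x
  majorant (p :^ k)   = majorant p :^ k
  majorant (:- p)     = majorant p

  ∣fromℤ∣ : ∀ i → ∣ fromℤ i ∣ ≤ fromℕ ℤ.∣ i ∣
  ∣fromℤ∣ (+ n)    = ≤-reflexive (0≤p⇒∣p∣≡p (0≤fromℕ n))
  ∣fromℤ∣ -[1+ n ] = ≤-reflexive (trans (∣-p∣≡∣p∣ (fromℕ (suc n))) (0≤p⇒∣p∣≡p (0≤fromℕ (suc n))))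

  ∣^∣ : ∀ p k → ∣ p ^ k ∣ ≡ ∣ p ∣ ^ k
  ∣^∣ p zero    = refl
  ∣^∣ p (suc k) = trans (∣p*q∣≡∣p∣*∣q∣ p (p ^ k)) (cong (∣ p ∣ *_) (∣^∣ p k))

  -- The triangle inequality, by induction on the syntax. It turns every explicit remainder
  -- polynomial below into a constant that is uniform in the parameters, with no numeral to be
  -- estimated by hand.
  majorant-bound : ∀ {n} (p : Polynomial n) (ρ β : Vec ℚ n) →
                   (∀ i → ∣ lookup ρ i ∣ ≤ lookup β i) → ∣ ⟦ p ⟧ ρ ∣ ≤ ⟦ majorant p ⟧ β
  majorant-bound (op Solver.[+] p r) ρ β h = ≤-trans (∣p+q∣≤∣p∣+∣q∣ (⟦ p ⟧ ρ) (⟦ r ⟧ ρ))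
    (+-mono-≤ (majorant-bound p ρ β h) (majorant-bound r ρ β h))
  majorant-bound (op Solver.[*] p r) ρ β h = subst (_≤ ⟦ majorant p ⟧ β * ⟦ majorant r ⟧ β)
    (sym (∣p*q∣≡∣p∣*∣q∣ (⟦ p ⟧ ρ) (⟦ r ⟧ ρ)))
    (*-mono-≤₀ (≤-trans (0≤∣p∣ (⟦ p ⟧ ρ)) (majorant-bound p ρ β h)) (0≤∣p∣ (⟦ r ⟧ ρ))
      (majorant-bound p ρ β h) (majorant-bound r ρ β h))
  majorant-bound (con c)  ρ β h = ∣fromℤ∣ c
  majorant-bound (var x)  ρ β h = h x
  majorant-bound (p :^ k) ρ β h = subst (_≤ ⟦ majorant p ⟧ β ^ k) (sym (∣^∣ (⟦ p ⟧ ρ) k))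
    (^-mono k (0≤∣p∣ (⟦ p ⟧ ρ)) (majorant-bound p ρ β h))
  majorant-bound (:- p)   ρ β h = subst (_≤ ⟦ majorant p ⟧ β) (sym (∣-p∣≡∣p∣ (⟦ p ⟧ ρ)))
    (majorant-bound p ρ β h)

  -- The damped Leibniz series.

  Σ< : ℕ → (ℕ → ℚ) → ℚ
  Σ< zero    f = 0ℚ
  Σ< (suc n) f = Σ< n f + f n

  odd*odd⁻¹ : ∀ k → (1ℚ + (fromℕ k + fromℕ k)) * odd⁻¹ k ≡ 1ℚ
  odd*odd⁻¹ k = trans (cong (_* odd⁻¹ k) (sym (begin
    fromℕ (suc (2 ℕ.* k))           ≡⟨ fromℕ-suc (2 ℕ.* k) ⟩
    1ℚ + fromℕ (k ℕ.+ (k ℕ.+ 0))    ≡⟨ cong (λ j → 1ℚ + fromℕ (k ℕ.+ j)) (ℕₚ.+-identityʳ k) ⟩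
    1ℚ + fromℕ (k ℕ.+ k)            ≡⟨ cong (λ x → 1ℚ + x) (fromℕ-+ k k) ⟩
    1ℚ + (fromℕ k + fromℕ k)        ∎))) (fromℕ*inv (2 ℕ.* k))
    where open ≡-Reasoning

  -- w n k = n! (n+1)! / ((n-k)! (n+1+k)!), the ratio C(2n+1,n-k) / C(2n+1,n) of Fourier
  -- coefficients of cos^(2n+1).
  w : ℕ → ℕ → ℚ
  w n zero    = 1ℚ
  w n (suc k) = w n k * (fromℕ n - fromℕ k) * inv (suc (n ℕ.+ k))

  2+n+k : ∀ n k → fromℕ (suc (suc (n ℕ.+ k))) ≡ fromℤ (+ 2) + fromℕ n + fromℕ k
  2+n+k n k = trans (fromℕ-+ 2 (n ℕ.+ k)) (trans (cong (λ x → fromℕ 2 + x) (fromℕ-+ n k))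
    (sym (+-assoc (fromℕ 2) (fromℕ n) (fromℕ k))))

  2+n+k-inverse : ∀ n k → (fromℤ (+ 2) + fromℕ n + fromℕ k) * inv (suc (n ℕ.+ k)) ≡ 1ℚ
  2+n+k-inverse n k = trans (cong (_* inv (suc (n ℕ.+ k))) (sym (2+n+k n k))) (fromℕ*inv (suc (n ℕ.+ k)))

  0<2+n+k : ∀ n k → 0ℚ < fromℤ (+ 2) + fromℕ n + fromℕ k
  0<2+n+k n k = subst (0ℚ <_) (2+n+k n k) (0<frac (suc (n ℕ.+ k)) 0)

  w-step : ∀ n k → w n (suc k) * (fromℤ (+ 2) + fromℕ n + fromℕ k) ≡ w n k * (fromℕ n - fromℕ k)
  w-step n k = using₁ (w n k * (N - K)) (2+n+k-inverse n k)
    (solve 4 (λ w N K i → w :* (N :- K) :* i :* (# 2 :+ N :+ K)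
                := w :* (N :- K) :+ w :* (N :- K) :* ((# 2 :+ N :+ K) :* i :- # 1))
      refl (w n k) N K (inv (suc (n ℕ.+ k))))
    where
    N = fromℕ n
    K = fromℕ k

  -- By the factorial formula the weights of rows n and n+1 have ratio (n+1-k)(n+2+k) /
  -- ((n+1)(n+2)). Without division the relation also holds at k = n+1, where row n has already
  -- ended.
  w-shift : ∀ n k → w n k * ((1ℚ + fromℕ n) * (fromℤ (+ 2) + fromℕ n))
                  ≡ w (suc n) k * ((1ℚ + fromℕ n) - fromℕ k) * (fromℤ (+ 2) + fromℕ n + fromℕ k)
  w-shift n zero    = solve 1 (λ N → # 1 :* ((# 1 :+ N) :* (# 2 :+ N))
                                 := # 1 :* ((# 1 :+ N) :- # 0) :* (# 2 :+ N :+ # 0)) refl (fromℕ n)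
  w-shift n (suc k) = *-cancelˡ (0<2+n+k n k) (begin
    c * (w n (suc k) * ((1ℚ + N) * (fromℤ (+ 2) + N)))
      ≡⟨ solve 4 (λ c w a b → c :* (w :* (a :* b)) := (w :* c) :* (a :* b)) refl c (w n (suc k)) (1ℚ + N) (fromℤ (+ 2) + N) ⟩
    (w n (suc k) * c) * ((1ℚ + N) * (fromℤ (+ 2) + N))
      ≡⟨ cong (_* ((1ℚ + N) * (fromℤ (+ 2) + N))) (w-step n k) ⟩
    (w n k * (N - K)) * ((1ℚ + N) * (fromℤ (+ 2) + N))
      ≡⟨ solve 3 (λ w a b → w :* a :* b := w :* b :* a) refl (w n k) (N - K) ((1ℚ + N) * (fromℤ (+ 2) + N)) ⟩
    w n k * ((1ℚ + N) * (fromℤ (+ 2) + N)) * (N - K)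
      ≡⟨ cong (_* (N - K)) (w-shift n k) ⟩
    w (suc n) k * ((1ℚ + N) - K) * c * (N - K)
      ≡⟨ solve 4 (λ w a c b → w :* a :* c :* b := c :* b :* (w :* a)) refl (w (suc n) k) ((1ℚ + N) - K) c (N - K) ⟩
    c * (N - K) * (w (suc n) k * ((1ℚ + N) - K))
      ≡⟨ cong (λ x → c * (N - K) * (w (suc n) k * (x - K))) (sym (fromℕ-suc n)) ⟩
    c * (N - K) * (w (suc n) k * (fromℕ (suc n) - K))
      ≡⟨ cong (c * (N - K) *_) (sym (w-step (suc n) k)) ⟩
    c * (N - K) * (w (suc n) (suc k) * (fromℤ (+ 2) + fromℕ (suc n) + K))
      ≡⟨ cong (λ x → c * (N - K) * (w (suc n) (suc k) * (fromℤ (+ 2) + x + K))) (fromℕ-suc n) ⟩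
    c * (N - K) * (w (suc n) (suc k) * (fromℤ (+ 2) + (1ℚ + N) + K))
      ≡⟨ solve 4 (λ c w N K → c :* (N :- K) :* (w :* (# 2 :+ (# 1 :+ N) :+ K))
           := c :* (w :* ((# 1 :+ N) :- (# 1 :+ K)) :* (# 2 :+ N :+ (# 1 :+ K))))
           refl c (w (suc n) (suc k)) N K ⟩
    c * (w (suc n) (suc k) * ((1ℚ + N) - (1ℚ + K)) * (fromℤ (+ 2) + N + (1ℚ + K)))
      ≡⟨ cong (λ x → c * (w (suc n) (suc k) * ((1ℚ + N) - x) * (fromℤ (+ 2) + N + x))) (sym (fromℕ-suc k)) ⟩
    c * (w (suc n) (suc k) * ((1ℚ + N) - fromℕ (suc k)) * (fromℤ (+ 2) + N + fromℕ (suc k))) ∎)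
    where
    open ≡-Reasoning
    N = fromℕ n
    K = fromℕ k
    c = fromℤ (+ 2) + N + K

  w-zero : ∀ n → w n (suc n) ≡ 0ℚ
  w-zero n = trans (cong (λ x → w n n * x * inv (suc (n ℕ.+ n))) (+-inverseʳ (fromℕ n)))
    (trans (cong (_* inv (suc (n ℕ.+ n))) (*-zeroʳ (w n n))) (*-zeroˡ (inv (suc (n ℕ.+ n)))))

  w-vanish : ∀ n j → w n (suc n ℕ.+ j) ≡ 0ℚ
  w-vanish n zero    = trans (cong (w n) (ℕₚ.+-identityʳ (suc n))) (w-zero n)
  w-vanish n (suc j) = trans (cong (w n) (ℕₚ.+-suc (suc n) j))
    (trans (cong (λ x → x * (fromℕ n - fromℕ (suc n ℕ.+ j)) * inv (suc (n ℕ.+ (suc n ℕ.+ j)))) (w-vanish n j))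
      (solve 2 (λ a b → # 0 :* a :* b := # 0) refl
        (fromℕ n - fromℕ (suc n ℕ.+ j)) (inv (suc (n ℕ.+ (suc n ℕ.+ j))))))

  -- The factor n - k of the recurrence turns negative only after the weight has become 0 at k =
  -- n+1.
  w-nonNeg : ∀ n k → 0ℚ ≤ w n k
  w-nonNeg n zero    = 0≤1
  w-nonNeg n (suc k) with k ℕₚ.≤? n
  ... | yes k≤n = *-nonNeg (*-nonNeg (w-nonNeg n k) (0≤r-p (fromℕ-mono k≤n))) (0≤inv (suc (n ℕ.+ k)))
  ... | no  k≰n = ≤-reflexive (sym (trans (cong (w n) (sym (ℕₚ.m+[n∸m]≡n (ℕₚ.≤-trans (ℕₚ.≰⇒> k≰n) (ℕₚ.n≤1+n k)))))
                    (w-vanish n (suc k ℕ.∸ suc n))))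

  w-drop : ∀ n k → w n k ≡ w n (suc k) + w n k * (fromℤ (+ 2) * (1ℚ + fromℕ k)) * inv (suc (n ℕ.+ k))
  w-drop n k = using₁ (- w n k) (2+n+k-inverse n k)
    (solve 4 (λ w N K i → w := (w :* (N :- K) :* i :+ w :* (# 2 :* (# 1 :+ K)) :* i)
         :+ :- w :* ((# 2 :+ N :+ K) :* i :- # 1))
      refl (w n k) (fromℕ n) (fromℕ k) (inv (suc (n ℕ.+ k))))

  0≤2[1+k] : ∀ k → 0ℚ ≤ fromℤ (+ 2) * (1ℚ + fromℕ k)
  0≤2[1+k] k = *-nonNeg (0≤fromℕ 2) (+-nonNeg 0≤1 (0≤fromℕ k))

  w-anti : ∀ n k → w n (suc k) ≤ w n k
  w-anti n k = ≤-offset _ (*-nonNeg (*-nonNeg (w-nonNeg n k) (0≤2[1+k] k)) (0≤inv (suc (n ℕ.+ k)))) (w-drop n k)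

  w≤1 : ∀ n k → w n k ≤ 1ℚ
  w≤1 n zero    = ≤-refl
  w≤1 n (suc k) = ≤-trans (w-anti n k) (w≤1 n k)

  -- The drops in `w-drop` are at most 2(j+1)/(n+1), and their sum over j < k is k(k+1)/(n+1).
  w-near-1 : ∀ n k → 1ℚ - w n k ≤ fromℕ k * (1ℚ + fromℕ k) * inv n
  w-near-1 n zero    = ≤-reflexive (solve 1 (λ i → # 1 :- # 1 := # 0 :* (# 1 :+ # 0) :* i) refl (inv n))
  w-near-1 n (suc k) = begin
    1ℚ - w n (suc k)
      ≡⟨ using₁ 1ℚ (w-drop n k) (solve 3 (λ w w′ d → # 1 :- w′ := (# 1 :- w :+ d) :+ # 1 :* (w :- (w′ :+ d)))
           refl (w n k) (w n (suc k)) d) ⟩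
    1ℚ - w n k + d
      ≤⟨ +-mono-≤ (w-near-1 n k) (*-mono-≤₀ (0≤2[1+k] k) (0≤inv (suc (n ℕ.+ k)))
           (subst (w n k * (fromℤ (+ 2) * (1ℚ + K)) ≤_) (*-identityˡ _) (*-monoʳ (0≤2[1+k] k) (w≤1 n k)))
           (unit-anti (ℕₚ.≤-trans (ℕₚ.m≤m+n n k) (ℕₚ.n≤1+n (n ℕ.+ k))))) ⟩
    K * (1ℚ + K) * inv n + fromℤ (+ 2) * (1ℚ + K) * inv n
      ≡⟨ solve 2 (λ K i → K :* (# 1 :+ K) :* i :+ # 2 :* (# 1 :+ K) :* i := (# 1 :+ K) :* (# 1 :+ (# 1 :+ K)) :* i)
           refl K (inv n) ⟩
    (1ℚ + K) * (1ℚ + (1ℚ + K)) * inv n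
      ≡⟨ cong (λ x → x * (1ℚ + x) * inv n) (sym (fromℕ-suc k)) ⟩
    fromℕ (suc k) * (1ℚ + fromℕ (suc k)) * inv n ∎
    where
    open ≤-Reasoning
    K = fromℕ k
    d = w n k * (fromℤ (+ 2) * (1ℚ + K)) * inv (suc (n ℕ.+ k))

  wsum : ℕ → ℕ → ℚ
  wsum n M = Σ< M (λ k → sign k * (w n k * odd⁻¹ k))

  -- Up to the factor 4ⁿ / C(2n+1,n) this is the integral of cos^(2n+1) over [0, π/2], integrated
  -- term by term in its Fourier expansion: the signs are sin((2k+1)π/2), and the sum ends at k = n
  -- because the weights do.
  v : ℕ → ℚ
  v n = wsum n (suc n)

  -- Since (2n+1)² w n k - 4n(n+1) w (n-1) k = (2k+1)² w n k, the difference telescopes.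
  wsum-shift : ∀ n M → let N = fromℕ n ; K = fromℕ M in
    (1ℚ + N) * ((fromℤ (+ 3) + (N + N)) ^ 2 * wsum (suc n) M - fromℤ (+ 4) * ((1ℚ + N) * (fromℤ (+ 2) + N)) * wsum n M)
    ≡ - (sign M * (K * (fromℤ (+ 2) + N + K) * w (suc n) M))
  wsum-shift n zero    = solve 1 (λ N → (# 1 :+ N) :* ((# 3 :+ (N :+ N)) :^ 2 :* # 0 :- # 4 :* ((# 1 :+ N) :* (# 2 :+ N)) :* # 0)
    := :- (# 1 :* (# 0 :* (# 2 :+ N :+ # 0) :* # 1))) refl (fromℕ n)
  wsum-shift n (suc M) = begin
    (1ℚ + N) * ((fromℤ (+ 3) + (N + N)) ^ 2 * (A + s * (w′ * o)) - fromℤ (+ 4) * ((1ℚ + N) * (fromℤ (+ 2) + N)) * (B + s * (u * o)))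
      ≡⟨ solve 7 (λ N A B s w′ u o →
           (# 1 :+ N) :* ((# 3 :+ (N :+ N)) :^ 2 :* (A :+ s :* (w′ :* o)) :- # 4 :* ((# 1 :+ N) :* (# 2 :+ N)) :* (B :+ s :* (u :* o)))
           := (# 1 :+ N) :* ((# 3 :+ (N :+ N)) :^ 2 :* A :- # 4 :* ((# 1 :+ N) :* (# 2 :+ N)) :* B)
              :+ (# 1 :+ N) :* s :* o :* ((# 3 :+ (N :+ N)) :^ 2 :* w′ :- # 4 :* (u :* ((# 1 :+ N) :* (# 2 :+ N)))))
           refl N A B s w′ u o ⟩
    _ ≡⟨ cong₂ (λ x y → x + (1ℚ + N) * s * o * ((fromℤ (+ 3) + (N + N)) ^ 2 * w′ - fromℤ (+ 4) * y))
           (wsum-shift n M) (w-shift n M) ⟩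
    - (s * (K * (fromℤ (+ 2) + N + K) * w′)) +
      (1ℚ + N) * s * o * ((fromℤ (+ 3) + (N + N)) ^ 2 * w′ - fromℤ (+ 4) * (w′ * ((1ℚ + N) - K) * (fromℤ (+ 2) + N + K)))
      ≡⟨ using₁ ((1ℚ + N) * s * w′ * (1ℚ + (K + K))) (odd*odd⁻¹ M)
         (solve 5 (λ N K s w′ o → :- (s :* (K :* (# 2 :+ N :+ K) :* w′)) :+
            (# 1 :+ N) :* s :* o :* ((# 3 :+ (N :+ N)) :^ 2 :* w′ :- # 4 :* (w′ :* ((# 1 :+ N) :- K) :* (# 2 :+ N :+ K)))
            := s :* (# 1 :+ K) :* (w′ :* ((# 1 :+ N) :- K))
              :+ (# 1 :+ N) :* s :* w′ :* (# 1 :+ (K :+ K)) :* ((# 1 :+ (K :+ K)) :* o :- # 1))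
            refl N K s w′ o) ⟩
    s * (1ℚ + K) * (w′ * ((1ℚ + N) - K))
      ≡⟨ cong (s * (1ℚ + K) *_) (sym (trans (cong (λ x → w (suc n) (suc M) * (fromℤ (+ 2) + x + K)) (sym (fromℕ-suc n)))
           (trans (w-step (suc n) M) (cong (λ x → w′ * (x - K)) (fromℕ-suc n))))) ⟩
    s * (1ℚ + K) * (w (suc n) (suc M) * (fromℤ (+ 2) + (1ℚ + N) + K))
      ≡⟨ solve 4 (λ N K s w → s :* (# 1 :+ K) :* (w :* (# 2 :+ (# 1 :+ N) :+ K))
           := :- (:- s :* ((# 1 :+ K) :* (# 2 :+ N :+ (# 1 :+ K)) :* w))) refl N K s (w (suc n) (suc M)) ⟩
    - (- s * ((1ℚ + K) * (fromℤ (+ 2) + N + (1ℚ + K)) * w (suc n) (suc M)))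
      ≡⟨ cong (λ x → - (- s * (x * (fromℤ (+ 2) + N + x) * w (suc n) (suc M)))) (sym (fromℕ-suc M)) ⟩
    - (- s * (fromℕ (suc M) * (fromℤ (+ 2) + N + fromℕ (suc M)) * w (suc n) (suc M))) ∎
    where
    open ≡-Reasoning
    N = fromℕ n
    K = fromℕ M
    A = wsum (suc n) M
    B = wsum n M
    s = sign M
    w′ = w (suc n) M
    u = w n M
    o = odd⁻¹ M

  0<1+fromℕ : ∀ n → 0ℚ < 1ℚ + fromℕ n
  0<1+fromℕ n = subst (0ℚ <_) (fromℕ-suc n) (0<frac n 0)

  -- Wallis's recurrence. `wsum-shift` is taken at M = n+2: there the boundary term contains w (n+1)
  -- (n+2) = 0, and the extra term of row n is 0 as well.
  v-step : ∀ n → let N = fromℕ n in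
    (fromℤ (+ 3) + (N + N)) ^ 2 * v (suc n) ≡ fromℤ (+ 4) * ((1ℚ + N) * (fromℤ (+ 2) + N)) * v n
  v-step n = using₁ 1ℚ zero-difference
    (solve 2 (λ a b → a := b :+ # 1 :* ((a :- b) :- # 0)) refl
      ((fromℤ (+ 3) + (N + N)) ^ 2 * v (suc n)) (fromℤ (+ 4) * ((1ℚ + N) * (fromℤ (+ 2) + N)) * v n))
    where
    open ≡-Reasoning
    N = fromℕ n
    last-term : wsum n (suc (suc n)) ≡ v n
    last-term = trans (cong (λ x → v n + sign (suc n) * (x * odd⁻¹ (suc n))) (w-zero n))
      (solve 3 (λ a s o → a :+ s :* (# 0 :* o) := a) refl (v n) (sign (suc n)) (odd⁻¹ (suc n)))
    zero-difference : (fromℤ (+ 3) + (N + N)) ^ 2 * v (suc n) - fromℤ (+ 4) * ((1ℚ + N) * (fromℤ (+ 2) + N)) * v n ≡ 0ℚ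
    zero-difference = *-cancelˡ (0<1+fromℕ n) (begin
      (1ℚ + N) * ((fromℤ (+ 3) + (N + N)) ^ 2 * v (suc n) - fromℤ (+ 4) * ((1ℚ + N) * (fromℤ (+ 2) + N)) * v n)
        ≡⟨ cong (λ x → (1ℚ + N) * ((fromℤ (+ 3) + (N + N)) ^ 2 * v (suc n) - fromℤ (+ 4) * ((1ℚ + N) * (fromℤ (+ 2) + N)) * x)) (sym last-term) ⟩
      _ ≡⟨ wsum-shift n (suc (suc n)) ⟩
      - (sign (suc (suc n)) * (K * (fromℤ (+ 2) + N + K) * w (suc n) (suc (suc n))))
        ≡⟨ cong (λ x → - (sign (suc (suc n)) * (K * (fromℤ (+ 2) + N + K) * x))) (w-zero (suc n)) ⟩
      - (sign (suc (suc n)) * (K * (fromℤ (+ 2) + N + K) * 0ℚ))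
        ≡⟨ solve 3 (λ s a N → :- (s :* (a :* # 0)) := (# 1 :+ N) :* # 0) refl (sign (suc (suc n))) (K * (fromℤ (+ 2) + N + K)) N ⟩
      (1ℚ + N) * 0ℚ ∎)
      where K = fromℕ (suc (suc n))

  -- Comparison of the damped series with the Leibniz series.

  alternating : (ℕ → ℚ) → ℕ → ℕ → ℚ
  alternating c n zero    = 0ℚ
  alternating c n (suc j) = c n - alternating c (suc n) j

  alternating-sum : ∀ c n j → Σ< (j ℕ.+ n) (λ k → sign k * c k) ≡ Σ< n (λ k → sign k * c k) + sign n * alternating c n j
  alternating-sum c n zero    = solve 2 (λ a s → a := a :+ s :* # 0) refl (Σ< n (λ k → sign k * c k)) (sign n)
  alternating-sum c n (suc j) = begin
    Σ< (suc j ℕ.+ n) f                          ≡⟨ cong (λ m → Σ< m f) (sym (ℕₚ.+-suc j n)) ⟩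
    Σ< (j ℕ.+ suc n) f                          ≡⟨ alternating-sum c (suc n) j ⟩
    Σ< n f + sign n * c n + - sign n * alternating c (suc n) j
      ≡⟨ solve 4 (λ a s c t → a :+ s :* c :+ (:- s) :* t := a :+ s :* (c :- t)) refl
           (Σ< n f) (sign n) (c n) (alternating c (suc n) j) ⟩
    Σ< n f + sign n * alternating c n (suc j)   ∎
    where
    open ≡-Reasoning
    f : ℕ → ℚ
    f k = sign k * c k

  -- Leibniz's criterion. The nested form c n - (c (n+1) - ...) of `alternating` reduces it to a
  -- plain induction.
  alternating-bounds : ∀ c → (∀ k → 0ℚ ≤ c k) → (∀ k → c (suc k) ≤ c k) →
                       ∀ n j → 0ℚ ≤ alternating c n j × alternating c n j ≤ c n
  alternating-bounds c 0≤c anti n zero    = ≤-refl , 0≤c n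
  alternating-bounds c 0≤c anti n (suc j) =
    let (lo , hi) = alternating-bounds c 0≤c anti (suc n) j
    in 0≤r-p (≤-trans hi (anti n)) , p-r<p lo

  weighted : ℕ → ℕ → ℚ
  weighted n k = w n k * odd⁻¹ k

  0≤odd⁻¹ : ∀ k → 0ℚ ≤ odd⁻¹ k
  0≤odd⁻¹ k = 0≤inv (2 ℕ.* k)

  weighted-nonNeg : ∀ n k → 0ℚ ≤ weighted n k
  weighted-nonNeg n k = *-nonNeg (w-nonNeg n k) (0≤odd⁻¹ k)

  weighted-anti : ∀ n k → weighted n (suc k) ≤ weighted n k
  weighted-anti n k = *-mono-≤₀ (w-nonNeg n k) (0≤odd⁻¹ (suc k)) (w-anti n k)
    (odd⁻¹-anti (ℕₚ.n≤1+n k))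

  weighted≤inv : ∀ n k → weighted n k ≤ inv k
  weighted≤inv n k = ≤-trans (subst (weighted n k ≤_) (*-identityˡ _) (*-monoʳ (0≤odd⁻¹ k) (w≤1 n k)))
    (unit-anti (ℕₚ.m≤m+n k (k ℕ.+ 0)))

  -- The bound does not depend on the row n; this uniformity is what allows the limits in n and in
  -- the number of terms to be combined.
  wsum-tail : ∀ n K j → ∣ wsum n (j ℕ.+ K) - wsum n K ∣ ≤ inv K
  wsum-tail n K j = begin
    ∣ wsum n (j ℕ.+ K) - wsum n K ∣
      ≡⟨ cong (λ x → ∣ x - wsum n K ∣) (alternating-sum (weighted n) K j) ⟩
    ∣ wsum n K + sign K * t - wsum n K ∣
      ≡⟨ cong ∣_∣ (solve 2 (λ a b → a :+ b :- a := b) refl (wsum n K) (sign K * t)) ⟩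
    ∣ sign K * t ∣     ≡⟨ ∣p*q∣≡∣p∣*∣q∣ (sign K) t ⟩
    ∣ sign K ∣ * ∣ t ∣ ≡⟨ cong₂ _*_ (∣sign∣ K) (0≤p⇒∣p∣≡p (proj₁ bounds)) ⟩
    1ℚ * t             ≡⟨ *-identityˡ t ⟩
    t                  ≤⟨ proj₂ bounds ⟩
    weighted n K       ≤⟨ weighted≤inv n K ⟩
    inv K              ∎
    where
    open ≤-Reasoning
    t = alternating (weighted n) K j
    bounds = alternating-bounds (weighted n) (weighted-nonNeg n) (weighted-anti n) K j

  wsum-leibniz : ∀ n K → ∣ wsum n K - leibniz K ∣ ≤ fromℕ K ^ 3 * inv n
  wsum-leibniz n zero    = ≤-reflexive (solve 1 (λ i → # 0 := # 0 :^ 3 :* i) refl (inv n))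
  wsum-leibniz n (suc k) = begin
    ∣ wsum n k + s * (w n k * o) - (leibniz k + s * o) ∣
      ≡⟨ cong ∣_∣ (solve 5 (λ a b s w o → a :+ s :* (w :* o) :- (b :+ s :* o) := (a :- b) :+ s :* (o :* (w :- # 1)))
           refl (wsum n k) (leibniz k) s (w n k) o) ⟩
    ∣ (wsum n k - leibniz k) + s * (o * (w n k - 1ℚ)) ∣
      ≤⟨ ∣p+q∣≤∣p∣+∣q∣ (wsum n k - leibniz k) (s * (o * (w n k - 1ℚ))) ⟩
    ∣ wsum n k - leibniz k ∣ + ∣ s * (o * (w n k - 1ℚ)) ∣
      ≤⟨ +-mono-≤ (wsum-leibniz n k) term ⟩
    K ^ 3 * inv n + K * (1ℚ + K) * inv n
      ≤⟨ ≤-offset ((1ℚ + K * (fromℤ (+ 2) * K + fromℤ (+ 2))) * inv n)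
           (*-nonNeg (+-nonNeg 0≤1 (*-nonNeg (0≤fromℕ k) (+-nonNeg (*-nonNeg (0≤fromℕ 2) (0≤fromℕ k)) (0≤fromℕ 2)))) (0≤inv n))
           (solve 2 (λ K i → (# 1 :+ K) :^ 3 :* i := K :^ 3 :* i :+ K :* (# 1 :+ K) :* i :+ (# 1 :+ K :* (# 2 :* K :+ # 2)) :* i) refl K (inv n)) ⟩
    (1ℚ + K) ^ 3 * inv n
      ≡⟨ cong (λ x → x ^ 3 * inv n) (sym (fromℕ-suc k)) ⟩
    fromℕ (suc k) ^ 3 * inv n ∎
    where
    open ≤-Reasoning
    s = sign k
    o = odd⁻¹ k
    K = fromℕ k
    o≤1 : o ≤ 1ℚ
    o≤1 = unit-anti {0} {2 ℕ.* k} ℕ.z≤n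
    term : ∣ s * (o * (w n k - 1ℚ)) ∣ ≤ K * (1ℚ + K) * inv n
    term = begin
      ∣ s * (o * (w n k - 1ℚ)) ∣    ≡⟨ trans (∣p*q∣≡∣p∣*∣q∣ s _) (cong (_* ∣ o * (w n k - 1ℚ) ∣) (∣sign∣ k)) ⟩
      1ℚ * ∣ o * (w n k - 1ℚ) ∣     ≡⟨ *-identityˡ _ ⟩
      ∣ o * (w n k - 1ℚ) ∣          ≡⟨ ∣*∣ (0≤odd⁻¹ k) ⟩
      o * ∣ w n k - 1ℚ ∣            ≡⟨ cong (o *_) (trans (∣-∣-comm (w n k) 1ℚ) (0≤p⇒∣p∣≡p (0≤r-p (w≤1 n k)))) ⟩
      o * (1ℚ - w n k)              ≤⟨ *-mono-≤₀ 0≤1 (0≤r-p (w≤1 n k)) o≤1 (w-near-1 n k) ⟩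
      1ℚ * (K * (1ℚ + K) * inv n)   ≡⟨ *-identityˡ _ ⟩
      K * (1ℚ + K) * inv n          ∎

  -- A row so far out that the error K³/(n+1) of `wsum-leibniz` falls below 1/(k+1) for the first k
  -- terms.
  cofinal : ℕ → ℕ
  cofinal k = k ℕ.^ 3 ℕ.* suc k

  k≤cofinal : ∀ k → k ℕ.≤ cofinal k
  k≤cofinal zero    = ℕ.z≤n
  k≤cofinal (suc k) = ℕₚ.≤-trans (ℕₚ.n≤1+n (suc k)) (ℕₚ.m≤n*m (suc (suc k)) (suc k ℕ.^ 3) {{ℕₚ.m^n≢0 (suc k) 3}})

  fromℕ-^ : ∀ k n → fromℕ (k ℕ.^ n) ≡ fromℕ k ^ n
  fromℕ-^ k zero    = refl
  fromℕ-^ k (suc n) = trans (fromℕ-* k (k ℕ.^ n)) (cong (fromℕ k *_) (fromℕ-^ k n))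

  inv-inverse : ∀ n → (1ℚ + fromℕ n) * inv n ≡ 1ℚ
  inv-inverse n = trans (cong (_* inv n) (sym (fromℕ-suc n))) (fromℕ*inv n)

  cofinal-small : ∀ k → fromℕ k ^ 3 * inv (cofinal k) ≤ inv k
  cofinal-small k = *-cancelˡ-≤ (0<1+fromℕ k) (begin
    (1ℚ + fromℕ k) * (fromℕ k ^ 3 * inv m)
      ≡⟨ solve 3 (λ a b c → a :* (b :* c) := b :* a :* c) refl (1ℚ + fromℕ k) (fromℕ k ^ 3) (inv m) ⟩
    fromℕ k ^ 3 * (1ℚ + fromℕ k) * inv m
      ≡⟨ cong₂ (λ x y → x * y * inv m) (sym (fromℕ-^ k 3)) (sym (fromℕ-suc k)) ⟩
    fromℕ (k ℕ.^ 3) * fromℕ (suc k) * inv m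
      ≡⟨ cong (_* inv m) (sym (fromℕ-* (k ℕ.^ 3) (suc k))) ⟩
    fromℕ m * inv m
      ≤⟨ ≤-offset (inv m) (0≤inv m) (using₁ (- 1ℚ) (inv-inverse m)
           (solve 2 (λ m i → # 1 := m :* i :+ i :+ :- # 1 :* ((# 1 :+ m) :* i :- # 1)) refl (fromℕ m) (inv m))) ⟩
    1ℚ
      ≡⟨ sym (inv-inverse k) ⟩
    (1ℚ + fromℕ k) * inv k ∎)
    where
    open ≤-Reasoning
    m = cofinal k

  v-leibniz : ∀ k → ∣ v (cofinal k) - leibniz k ∣ ≤ fromℤ (+ 2) * inv k
  v-leibniz k = begin
    ∣ v m - leibniz k ∣
      ≤⟨ ∣-∣-triangle (v m) (wsum m k) (leibniz k) ⟩
    ∣ v m - wsum m k ∣ + ∣ wsum m k - leibniz k ∣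
      -- The m+1 terms of `v m` are split as (m+1-k) + k: the tail is small uniformly in the row,
      -- and the first k terms are close to those of Leibniz.
      ≡⟨ cong (λ j → ∣ wsum m j - wsum m k ∣ + ∣ wsum m k - leibniz k ∣)
           (sym (ℕₚ.m∸n+n≡m (ℕₚ.≤-trans (k≤cofinal k) (ℕₚ.n≤1+n m)))) ⟩
    ∣ wsum m (suc m ℕ.∸ k ℕ.+ k) - wsum m k ∣ + ∣ wsum m k - leibniz k ∣
      ≤⟨ +-mono-≤ (wsum-tail m k (suc m ℕ.∸ k)) (≤-trans (wsum-leibniz m k) (cofinal-small k)) ⟩
    inv k + inv k
      ≡⟨ solve 1 (λ i → i :+ i := # 2 :* i) refl (inv k) ⟩
    fromℤ (+ 2) * inv k ∎
    where
    open ≤-Reasoning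
    m = cofinal k

  v-bounds : ∀ n → inv 1 ≤ v n × v n ≤ 1ℚ
  v-bounds n = subst (λ x → inv 1 ≤ x × x ≤ 1ℚ) (sym v-alternating) (lower , proj₂ (bounds 0 (suc n)))
    where
    c = weighted n
    bounds = alternating-bounds c (weighted-nonNeg n) (weighted-anti n)
    v-alternating : v n ≡ alternating c 0 (suc n)
    v-alternating = trans (cong (wsum n) (sym (ℕₚ.+-identityʳ (suc n))))
      (trans (alternating-sum c 0 (suc n)) (solve 1 (λ a → # 0 :+ # 1 :* a := a) refl (alternating c 0 (suc n))))
    lower : inv 1 ≤ c 0 - alternating c 1 n
    lower = +-monoʳ-≤ 1ℚ (neg-antimono-≤ (≤-trans (proj₂ (bounds 1 n)) (weighted≤inv n 1)))

  -- Normalised central binomial coefficients and Wallis's limit.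

  a : ℕ → ℚ
  a zero    = 1ℚ
  a (suc n) = a n * (1ℚ - ½ * inv n)

  ½*2 : ½ * fromℤ (+ 2) ≡ 1ℚ
  ½*2 = refl

  a-step : ∀ n → a (suc n) * (fromℤ (+ 2) * (1ℚ + fromℕ n)) ≡ a n * (1ℚ + fromℤ (+ 2) * fromℕ n)
  a-step n = using₂ (- (a n * (½ * fromℤ (+ 2)))) (inv-inverse n) (- a n) ½*2
    (solve 4 (λ a h i N → a :* (# 1 :- h :* i) :* (# 2 :* (# 1 :+ N))
       := a :* (# 1 :+ # 2 :* N) :+ :- (a :* (h :* # 2)) :* ((# 1 :+ N) :* i :- # 1) :+ :- a :* (h :* # 2 :- # 1))
     refl (a n) ½ (inv n) (fromℕ n))

  inv≤1 : ∀ n → inv n ≤ 1ℚ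
  inv≤1 n = unit-anti {0} {n} ℕ.z≤n

  a-factor : ∀ n → 0ℚ < 1ℚ - ½ * inv n × 1ℚ - ½ * inv n ≤ 1ℚ
  a-factor n = <-≤-trans 0<½ (+-monoʳ-≤ 1ℚ (neg-antimono-≤ (*-monoˡ {s = ½} (<⇒≤ 0<½) (inv≤1 n))))
             , p-r<p (*-nonNeg {½} (<⇒≤ 0<½) (0≤inv n))

  0<a : ∀ n → 0ℚ < a n
  0<a zero    = positive⁻¹ 1ℚ
  0<a (suc n) = *-pos (0<a n) (proj₁ (a-factor n))

  a-anti : ∀ n → a (suc n) ≤ a n
  a-anti n = subst (a (suc n) ≤_) (*-identityʳ (a n)) (*-monoˡ (<⇒≤ (0<a n)) (proj₂ (a-factor n)))

  a≤1 : ∀ n → a n ≤ 1ℚ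
  a≤1 zero    = ≤-refl
  a≤1 (suc n) = ≤-trans (a-anti n) (a≤1 n)

  -- The recurrence `v-step` is reciprocal to the square of `a-step`, so the product is known from
  -- its value at 0.
  a²v : ∀ n → let N = fromℕ n in a n ^ 2 * ((1ℚ + fromℤ (+ 2) * N) ^ 2 * v n) ≡ 1ℚ + N
  a²v zero    = refl
  a²v (suc n) = *-cancelˡ (0<1+fromℕ n) (begin
    (1ℚ + N) * (a′ ^ 2 * ((1ℚ + fromℤ (+ 2) * fromℕ (suc n)) ^ 2 * v (suc n)))
      ≡⟨ cong (λ x → (1ℚ + N) * (a′ ^ 2 * ((1ℚ + fromℤ (+ 2) * x) ^ 2 * v (suc n)))) (fromℕ-suc n) ⟩
    (1ℚ + N) * (a′ ^ 2 * ((1ℚ + fromℤ (+ 2) * (1ℚ + N)) ^ 2 * v (suc n)))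
      ≡⟨ solve 3 (λ N a′ v′ → (# 1 :+ N) :* (a′ :^ 2 :* ((# 1 :+ # 2 :* (# 1 :+ N)) :^ 2 :* v′))
           := (# 1 :+ N) :* a′ :^ 2 :* ((# 3 :+ (N :+ N)) :^ 2 :* v′)) refl N a′ (v (suc n)) ⟩
    (1ℚ + N) * a′ ^ 2 * ((fromℤ (+ 3) + (N + N)) ^ 2 * v (suc n))
      ≡⟨ cong ((1ℚ + N) * a′ ^ 2 *_) (v-step n) ⟩
    (1ℚ + N) * a′ ^ 2 * (fromℤ (+ 4) * ((1ℚ + N) * (fromℤ (+ 2) + N)) * v n)
      ≡⟨ solve 3 (λ N a′ v → (# 1 :+ N) :* a′ :^ 2 :* (# 4 :* ((# 1 :+ N) :* (# 2 :+ N)) :* v)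
           := (a′ :* (# 2 :* (# 1 :+ N))) :^ 2 :* (# 2 :+ N) :* v) refl N a′ (v n) ⟩
    (a′ * (fromℤ (+ 2) * (1ℚ + N))) ^ 2 * (fromℤ (+ 2) + N) * v n
      ≡⟨ cong (λ x → x ^ 2 * (fromℤ (+ 2) + N) * v n) (a-step n) ⟩
    (a n * (1ℚ + fromℤ (+ 2) * N)) ^ 2 * (fromℤ (+ 2) + N) * v n
      ≡⟨ using₁ (fromℤ (+ 2) + N) (a²v n) (solve 3 (λ N a v → (a :* (# 1 :+ # 2 :* N)) :^ 2 :* (# 2 :+ N) :* v
           := (# 1 :+ N) :* (# 1 :+ (# 1 :+ N)) :+ (# 2 :+ N) :* (a :^ 2 :* ((# 1 :+ # 2 :* N) :^ 2 :* v) :- (# 1 :+ N)))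
           refl N (a n) (v n)) ⟩
    (1ℚ + N) * (1ℚ + (1ℚ + N))
      ≡⟨ cong (λ x → (1ℚ + N) * (1ℚ + x)) (sym (fromℕ-suc n)) ⟩
    (1ℚ + N) * (1ℚ + fromℕ (suc n)) ∎)
    where
    open ≡-Reasoning
    N = fromℕ n
    a′ = a (suc n)

  b : ℕ → ℚ
  b m = (1ℚ + fromℕ m) * a (suc m) ^ 2

  -- An exact form of Wallis's limit: with n = m+1, `b m` is n (a n)², and 4 v m tends to π. Row m
  -- of `v` belongs to n = m+1 because `a-step` absorbs the factor 2n-1.
  b*4v : ∀ m → b m * (fromℤ (+ 4) * v m) ≡ 1ℚ
  b*4v m = *-cancelˡ (0<1+fromℕ m) (begin
    (1ℚ + N) * ((1ℚ + N) * a (suc m) ^ 2 * (fromℤ (+ 4) * v m))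
      ≡⟨ solve 3 (λ N a v → (# 1 :+ N) :* ((# 1 :+ N) :* a :^ 2 :* (# 4 :* v)) := (a :* (# 2 :* (# 1 :+ N))) :^ 2 :* v)
           refl N (a (suc m)) (v m) ⟩
    (a (suc m) * (fromℤ (+ 2) * (1ℚ + N))) ^ 2 * v m
      ≡⟨ cong (λ x → x ^ 2 * v m) (a-step m) ⟩
    (a m * (1ℚ + fromℤ (+ 2) * N)) ^ 2 * v m
      ≡⟨ using₁ 1ℚ (a²v m) (solve 3 (λ N a v → (a :* (# 1 :+ # 2 :* N)) :^ 2 :* v
           := (# 1 :+ N) :* # 1 :+ # 1 :* (a :^ 2 :* ((# 1 :+ # 2 :* N) :^ 2 :* v) :- (# 1 :+ N))) refl N (a m) (v m)) ⟩
    (1ℚ + N) * 1ℚ ∎)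
    where
    open ≡-Reasoning
    N = fromℕ m

  0≤b : ∀ m → 0ℚ ≤ b m
  0≤b m = *-nonNeg (<⇒≤ (0<1+fromℕ m)) (^-nonNeg 2 (<⇒≤ (0<a (suc m))))

  b≤1 : ∀ m → b m ≤ 1ℚ
  b≤1 m = subst₂ _≤_ (*-identityʳ (b m)) (b*4v m)
    (*-monoˡ (0≤b m) (≤-trans 1≤4·½ (*-monoˡ (0≤fromℕ 4) (proj₁ (v-bounds m)))))
    where
    1≤4·½ : 1ℚ ≤ fromℤ (+ 4) * inv 1
    1≤4·½ = fromℕ-mono {1} {2} (ℕ.s≤s ℕ.z≤n)

  -- Expansion of √(πn) a n.

  -- The expansion parameter 1/(16n) at n = m + 1, for which all coefficients below are integers.
  τ : ℕ → ℚ
  τ m = inv 15 * inv m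

  inv≡16τ : ∀ m → inv m ≡ fromℤ (+ 16) * τ m
  inv≡16τ m = trans (sym (*-identityˡ (inv m))) (*-assoc (fromℤ (+ 16)) (inv 15) (inv m))

  0≤τ : ∀ m → 0ℚ ≤ τ m
  0≤τ m = *-nonNeg (0≤inv 15) (0≤inv m)

  τ≤inv : ∀ m → τ m ≤ inv m
  τ≤inv m = subst (τ m ≤_) (*-identityˡ (inv m)) (*-monoʳ (0≤inv m) (inv≤1 15))

  τ≤1 : ∀ m → τ m ≤ 1ℚ
  τ≤1 m = ≤-trans (τ≤inv m) (inv≤1 m)

  -- The ratio n/(n+1) at n = m + 1.
  ratio : ℕ → ℚ
  ratio m = (1ℚ + fromℕ m) * inv (suc m)

  0≤ratio : ∀ m → 0ℚ ≤ ratio m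
  0≤ratio m = *-nonNeg (<⇒≤ (0<1+fromℕ m)) (0≤inv (suc m))

  inv-suc-inverse : ∀ m → (1ℚ + (1ℚ + fromℕ m)) * inv (suc m) ≡ 1ℚ
  inv-suc-inverse m = trans (cong (λ x → (1ℚ + x) * inv (suc m)) (sym (fromℕ-suc m))) (inv-inverse (suc m))

  ratio≤1 : ∀ m → ratio m ≤ 1ℚ
  ratio≤1 m = ≤-offset (inv (suc m)) (0≤inv (suc m)) (using₁ (- 1ℚ) (inv-suc-inverse m)
    (solve 2 (λ N i → # 1 := (# 1 :+ N) :* i :+ i :+ :- # 1 :* ((# 1 :+ (# 1 :+ N)) :* i :- # 1)) refl (fromℕ m) (inv (suc m))))

  ratio-inverse : ∀ m → ratio m * (1ℚ + fromℤ (+ 16) * τ m) ≡ 1ℚ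
  ratio-inverse m = trans (cong (λ x → ratio m * (1ℚ + x)) (sym (inv≡16τ m)))
    (using₂ (inv (suc m)) (inv-inverse m) 1ℚ (inv-suc-inverse m)
     (solve 3 (λ N i i′ → (# 1 :+ N) :* i′ :* (# 1 :+ i)
        := # 1 :+ i′ :* ((# 1 :+ N) :* i :- # 1) :+ # 1 :* ((# 1 :+ (# 1 :+ N)) :* i′ :- # 1))
      refl (fromℕ m) (inv m) (inv (suc m))))

  τ-suc : ∀ m → τ (suc m) ≡ ratio m * τ m
  τ-suc m = using₁ (- (inv 15 * inv (suc m))) (inv-inverse m)
    (solve 4 (λ h N i i′ → h :* i′ := (# 1 :+ N) :* i′ :* (h :* i) :+ :- (h :* i′) :* ((# 1 :+ N) :* i :- # 1))
      refl (inv 15) (fromℕ m) (inv m) (inv (suc m)))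

  -- The expansion of √(πn) C(2n,n)/4ⁿ.
  p-coefficients : ∀ {n} → List (Polynomial n)
  p-coefficients = coefficients (+ 1 ∷ ℤ.- + 2 ∷ + 2 ∷ + 20 ∷ ℤ.- + 42 ∷ [])

  P : ℚ → ℚ
  P t = ⟦ horner (var zero) p-coefficients ⟧ (t ∷ [])

  -- (1+16t)⁴ P(t / (1+16t)), where t / (1+16t) is the successor of the parameter t.
  P⁺ : ℚ → ℚ
  P⁺ t = ⟦ homogeneous (# 1 :+ # 16 :* var zero) (var zero) p-coefficients ⟧ (t ∷ [])

  -- In the homogeneous form the constant 1 may be written as ratio m (1 + 16 τ m); then both
  -- arguments carry the factor `ratio m`, whose fourth power comes out.
  P-suc : ∀ m → P (τ (suc m)) ≡ ratio m ^ 4 * P⁺ (τ m)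
  P-suc m = begin
    P (τ (suc m))  ≡⟨ solve 1 (λ t → horner t p-coefficients := homogeneous (# 1) t p-coefficients) refl (τ (suc m)) ⟩
    ⟦ homogeneous (var zero) (var (suc zero)) p-coefficients ⟧ (1ℚ ∷ τ (suc m) ∷ [])
      ≡⟨ cong₂ (λ x y → ⟦ homogeneous (var zero) (var (suc zero)) p-coefficients ⟧ (x ∷ y ∷ []))
           (sym (ratio-inverse m)) (τ-suc m) ⟩
    ⟦ homogeneous (var zero) (var (suc zero)) p-coefficients ⟧ (ratio m * (1ℚ + fromℤ (+ 16) * τ m) ∷ ratio m * τ m ∷ [])
      ≡⟨ solve 2 (λ c t → homogeneous (c :* (# 1 :+ # 16 :* t)) (c :* t) p-coefficients
           := c :^ 4 :* homogeneous (# 1 :+ # 16 :* t) t p-coefficients) refl (ratio m) (τ m) ⟩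
    ratio m ^ 4 * P⁺ (τ m) ∎
    where open ≡-Reasoning

  wallis-remainder : ∀ {n} → Polynomial n → Polynomial n
  wallis-remainder t = horner t (coefficients (
      + 1021440 ∷ + 77411328 ∷ + 2322975744 ∷ + 34088531968
    ∷ + 234135725056 ∷ + 428417466368 ∷ ℤ.- + 1681092509696 ∷ + 358004817920
    ∷ + 8452160094208 ∷ ℤ.- + 38331509374976 ∷ ℤ.- + 32109175504896 ∷ + 121221156962304 ∷ []))

  -- This expresses that P² v is constant along τ up to relative order t⁶, since consecutive values
  -- of v have ratio 4(1+16t)/(2+16t)². The constant and linear terms agree automatically; the
  -- vanishing of the coefficients of t² to t⁵ determines the four nontrivial coefficients of P.
  wallis-identity : ∀ t → P t ^ 2 * (fromℤ (+ 2) + fromℤ (+ 16) * t) ^ 2 * (1ℚ + fromℤ (+ 16) * t) ^ 7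
    ≡ fromℤ (+ 4) * P⁺ t ^ 2 + t ^ 6 * ⟦ wallis-remainder (var zero) ⟧ (t ∷ [])
  wallis-identity = solve 1 (λ t →
    horner t p-coefficients :^ 2 :* (# 2 :+ # 16 :* t) :^ 2 :* (# 1 :+ # 16 :* t) :^ 7
    := # 4 :* homogeneous (# 1 :+ # 16 :* t) t p-coefficients :^ 2 :+ t :^ 6 :* wallis-remainder t) refl

  -- Differences dominated by those of D give an error bound D m that survives j → ∞. It serves both
  -- comparisons: `ρ` with its limit π, and R with its approximant.
  telescope : ∀ (f D : ℕ → ℚ) → (∀ m → ∣ f m - f (suc m) ∣ ≤ D m - D (suc m)) →
              ∀ m j → ∣ f m - f (j ℕ.+ m) ∣ ≤ D m - D (j ℕ.+ m)
  telescope f D step m zero    = ≤-reflexive (trans (cong ∣_∣ (+-inverseʳ (f m))) (sym (+-inverseʳ (D m))))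
  telescope f D step m (suc j) = ≤-trans (∣-∣-triangle (f m) (f (j ℕ.+ m)) (f (suc j ℕ.+ m)))
    (≤-trans (+-mono-≤ (telescope f D step m j) (step (j ℕ.+ m)))
      (≤-reflexive (solve 3 (λ x y z → x :- y :+ (y :- z) := x :- z) refl (D m) (D (j ℕ.+ m)) (D (suc j ℕ.+ m)))))

  -- By `b*4v` this is P²/b. It tends to π as 4v does, but the factor P² accelerates the convergence
  -- to order τ⁵.
  ρ : ℕ → ℚ
  ρ m = fromℤ (+ 4) * (P (τ m) ^ 2 * v m)

  K-wallis : ℚ
  K-wallis = ⟦ majorant (wallis-remainder (var zero)) ⟧ (1ℚ ∷ [])

  wallis-remainder-bound : ∀ m → ∣ ⟦ wallis-remainder (var zero) ⟧ (τ m ∷ []) ∣ ≤ K-wallis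
  wallis-remainder-bound m = majorant-bound (wallis-remainder (var zero)) (τ m ∷ []) (1ℚ ∷ [])
    (λ { zero → ≤-trans (≤-reflexive (0≤p⇒∣p∣≡p (0≤τ m))) (τ≤1 m) })

  v-step-τ : ∀ m → v (suc m) * (fromℤ (+ 2) + fromℤ (+ 16) * τ m) ^ 2 ≡ fromℤ (+ 4) * (1ℚ + fromℤ (+ 16) * τ m) * v m
  v-step-τ m = subst (λ i → v (suc m) * (fromℤ (+ 2) + i) ^ 2 ≡ fromℤ (+ 4) * (1ℚ + i) * v m) (inv≡16τ m) (begin
    v (suc m) * (fromℤ (+ 2) + i) ^ 2
      ≡⟨ cong (λ x → v (suc m) * (fromℤ (+ 2) * x + i) ^ 2) (sym (inv-inverse m)) ⟩
    v (suc m) * (fromℤ (+ 2) * ((1ℚ + N) * i) + i) ^ 2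
      ≡⟨ solve 3 (λ v′ N i → v′ :* (# 2 :* ((# 1 :+ N) :* i) :+ i) :^ 2 := i :^ 2 :* ((# 3 :+ (N :+ N)) :^ 2 :* v′))
           refl (v (suc m)) N i ⟩
    i ^ 2 * ((fromℤ (+ 3) + (N + N)) ^ 2 * v (suc m))
      ≡⟨ cong (i ^ 2 *_) (v-step m) ⟩
    i ^ 2 * (fromℤ (+ 4) * ((1ℚ + N) * (fromℤ (+ 2) + N)) * v m)
      ≡⟨ solve 3 (λ v N i → i :^ 2 :* (# 4 :* ((# 1 :+ N) :* (# 2 :+ N)) :* v)
           := # 4 :* (((# 1 :+ N) :* i) :* ((# 1 :+ N) :* i :+ i)) :* v) refl (v m) N i ⟩
    fromℤ (+ 4) * (((1ℚ + N) * i) * ((1ℚ + N) * i + i)) * v m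
      ≡⟨ cong (λ x → fromℤ (+ 4) * (x * (x + i)) * v m) (inv-inverse m) ⟩
    fromℤ (+ 4) * (1ℚ * (1ℚ + i)) * v m
      ≡⟨ cong (λ x → fromℤ (+ 4) * x * v m) (*-identityˡ (1ℚ + i)) ⟩
    fromℤ (+ 4) * (1ℚ + i) * v m ∎)
    where
    open ≡-Reasoning
    N = fromℕ m
    i = inv m

  ρ-difference : ∀ m → (ρ m - ρ (suc m)) * (fromℤ (+ 2) + fromℤ (+ 16) * τ m) ^ 2
    ≡ fromℤ (+ 4) * v m * ratio m ^ 7 * τ m ^ 6 * ⟦ wallis-remainder (var zero) ⟧ (τ m ∷ [])
  ρ-difference m = begin
    (fromℤ (+ 4) * (P t ^ 2 * v m) - fromℤ (+ 4) * (P (τ (suc m)) ^ 2 * v (suc m))) * B ^ 2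
      ≡⟨ cong (λ x → (fromℤ (+ 4) * (P t ^ 2 * v m) - fromℤ (+ 4) * (x ^ 2 * v (suc m))) * B ^ 2) (P-suc m) ⟩
    (fromℤ (+ 4) * (P t ^ 2 * v m) - fromℤ (+ 4) * ((c ^ 4 * P⁺ t) ^ 2 * v (suc m))) * B ^ 2
      ≡⟨ solve 6 (λ p p′ v v′ c B → (# 4 :* (p :^ 2 :* v) :- # 4 :* ((c :^ 4 :* p′) :^ 2 :* v′)) :* B :^ 2
           := # 4 :* v :* p :^ 2 :* B :^ 2 :* # 1 :- # 4 :* c :^ 8 :* p′ :^ 2 :* (v′ :* B :^ 2))
           refl (P t) (P⁺ t) (v m) (v (suc m)) c B ⟩
    fromℤ (+ 4) * v m * P t ^ 2 * B ^ 2 * 1ℚ - fromℤ (+ 4) * c ^ 8 * P⁺ t ^ 2 * (v (suc m) * B ^ 2)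
      -- The factor 1 becomes (c A)⁷, so that c⁷ can be taken out of both terms and
      -- `wallis-identity` applies.
      ≡⟨ cong₂ (λ x y → fromℤ (+ 4) * v m * P t ^ 2 * B ^ 2 * x - fromℤ (+ 4) * c ^ 8 * P⁺ t ^ 2 * y)
           (sym (trans (cong (_^ 7) (ratio-inverse m)) (1^ 7))) (v-step-τ m) ⟩
    fromℤ (+ 4) * v m * P t ^ 2 * B ^ 2 * (c * A) ^ 7 - fromℤ (+ 4) * c ^ 8 * P⁺ t ^ 2 * (fromℤ (+ 4) * A * v m)
      ≡⟨ solve 6 (λ p p′ v c A B → # 4 :* v :* p :^ 2 :* B :^ 2 :* (c :* A) :^ 7 :- # 4 :* c :^ 8 :* p′ :^ 2 :* (# 4 :* A :* v)
           := # 4 :* v :* c :^ 7 :* (p :^ 2 :* B :^ 2 :* A :^ 7 :- # 4 :* p′ :^ 2 :* (c :* A)))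
           refl (P t) (P⁺ t) (v m) c A B ⟩
    fromℤ (+ 4) * v m * c ^ 7 * (P t ^ 2 * B ^ 2 * A ^ 7 - fromℤ (+ 4) * P⁺ t ^ 2 * (c * A))
      ≡⟨ cong₂ (λ x y → fromℤ (+ 4) * v m * c ^ 7 * (x - fromℤ (+ 4) * P⁺ t ^ 2 * y)) (wallis-identity t) (ratio-inverse m) ⟩
    fromℤ (+ 4) * v m * c ^ 7 * (fromℤ (+ 4) * P⁺ t ^ 2 + t ^ 6 * Q - fromℤ (+ 4) * P⁺ t ^ 2 * 1ℚ)
      ≡⟨ solve 5 (λ v p′ c t Q → # 4 :* v :* c :^ 7 :* (# 4 :* p′ :^ 2 :+ t :^ 6 :* Q :- # 4 :* p′ :^ 2 :* # 1)
           := # 4 :* v :* c :^ 7 :* t :^ 6 :* Q) refl (v m) (P⁺ t) c t Q ⟩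
    fromℤ (+ 4) * v m * c ^ 7 * t ^ 6 * Q ∎
    where
    open ≡-Reasoning
    t = τ m
    c = ratio m
    A = 1ℚ + fromℤ (+ 16) * t
    B = fromℤ (+ 2) + fromℤ (+ 16) * t
    Q = ⟦ wallis-remainder (var zero) ⟧ (t ∷ [])

  0≤v : ∀ m → 0ℚ ≤ v m
  0≤v m = ≤-trans (0≤inv 1) (proj₁ (v-bounds m))

  0≤K-wallis : 0ℚ ≤ K-wallis
  0≤K-wallis = ≤-trans (0≤∣p∣ (⟦ wallis-remainder (var zero) ⟧ (τ 0 ∷ []))) (wallis-remainder-bound 0)

  -- τ⁵ - τ′⁵ ≥ τ⁵ (c⁴ - c⁵) = 16 c⁵ τ⁶ for the next parameter τ′ = c τ.
  τ⁵-drop : ∀ m → fromℤ (+ 4) * ratio m ^ 5 * τ m ^ 6 ≤ τ m ^ 5 - τ (suc m) ^ 5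
  τ⁵-drop m = ≤-offset (t ^ 5 * (1ℚ - c ^ 4) + fromℤ (+ 12) * c ^ 5 * t ^ 6)
    (+-nonNeg (*-nonNeg (^-nonNeg 5 (0≤τ m)) (0≤r-p (^≤1 4 (0≤ratio m) (ratio≤1 m))))
      (*-nonNeg (*-nonNeg (0≤fromℕ 12) (^-nonNeg 5 (0≤ratio m))) (^-nonNeg 6 (0≤τ m))))
    (trans (cong (λ x → t ^ 5 - x ^ 5) (τ-suc m))
      (using₁ (- (t ^ 5 * c ^ 4)) (ratio-inverse m)
        (solve 2 (λ c t → t :^ 5 :- (c :* t) :^ 5 := # 4 :* c :^ 5 :* t :^ 6 :+ (t :^ 5 :* (# 1 :- c :^ 4) :+ # 12 :* c :^ 5 :* t :^ 6)
          :+ :- (t :^ 5 :* c :^ 4) :* (c :* (# 1 :+ # 16 :* t) :- # 1)) refl c t)))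
    where
    t = τ m
    c = ratio m

  ρ-step : ∀ m → ∣ ρ m - ρ (suc m) ∣ ≤ K-wallis * τ m ^ 5 - K-wallis * τ (suc m) ^ 5
  ρ-step m = begin
    -- The denominator (2+16t)² of the exact difference is at least 1, so multiplying by it only
    -- enlarges the left side.
    d     ≤⟨ ≤-offset (d * (fromℤ (+ 3) + fromℤ (+ 64) * t + fromℤ (+ 256) * t ^ 2))
               (*-nonNeg (0≤∣p∣ (ρ m - ρ (suc m))) (+-nonNeg (+-nonNeg (0≤fromℕ 3) (*-nonNeg (0≤fromℕ 64) (0≤τ m)))
                 (*-nonNeg (0≤fromℕ 256) (^-nonNeg 2 (0≤τ m)))))
               (solve 2 (λ d t → (# 2 :+ # 16 :* t) :^ 2 :* d := d :+ d :* (# 3 :+ # 64 :* t :+ # 256 :* t :^ 2)) refl d t) ⟩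
    B ^ 2 * d
          ≡⟨ sym (∣*∣ {ρ m - ρ (suc m)} (^-nonNeg 2 (+-nonNeg (0≤fromℕ 2) (*-nonNeg (0≤fromℕ 16) (0≤τ m))))) ⟩
    ∣ B ^ 2 * (ρ m - ρ (suc m)) ∣
          ≡⟨ cong ∣_∣ (trans (*-comm (B ^ 2) (ρ m - ρ (suc m))) (ρ-difference m)) ⟩
    ∣ fromℤ (+ 4) * v m * c ^ 7 * t ^ 6 * Q ∣
          ≡⟨ ∣*∣ {Q} 0≤s ⟩
    fromℤ (+ 4) * v m * c ^ 7 * t ^ 6 * ∣ Q ∣
          ≤⟨ *-monoˡ 0≤s (wallis-remainder-bound m) ⟩
    fromℤ (+ 4) * v m * c ^ 7 * t ^ 6 * K-wallis
          ≡⟨ solve 4 (λ v c t K → # 4 :* v :* c :^ 7 :* t :^ 6 :* K := v :* c :^ 2 :* (K :* (# 4 :* c :^ 5 :* t :^ 6)))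
               refl (v m) c t K-wallis ⟩
    v m * c ^ 2 * (K-wallis * (fromℤ (+ 4) * c ^ 5 * t ^ 6))
          ≤⟨ *-monoʳ (*-nonNeg 0≤K-wallis (*-nonNeg (*-nonNeg (0≤fromℕ 4) (^-nonNeg 5 (0≤ratio m))) (^-nonNeg 6 (0≤τ m))))
               (*-mono-≤₀ 0≤1 (^-nonNeg 2 (0≤ratio m)) (proj₂ (v-bounds m)) (^≤1 2 (0≤ratio m) (ratio≤1 m))) ⟩
    1ℚ * (K-wallis * (fromℤ (+ 4) * c ^ 5 * t ^ 6))
          ≡⟨ *-identityˡ _ ⟩
    K-wallis * (fromℤ (+ 4) * c ^ 5 * t ^ 6)
          ≤⟨ *-monoˡ 0≤K-wallis (τ⁵-drop m) ⟩
    K-wallis * (t ^ 5 - τ (suc m) ^ 5)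
          ≡⟨ solve 3 (λ K x y → K :* (x :- y) := K :* x :- K :* y) refl K-wallis (t ^ 5) (τ (suc m) ^ 5) ⟩
    K-wallis * t ^ 5 - K-wallis * τ (suc m) ^ 5 ∎
    where
    open ≤-Reasoning
    t = τ m
    c = ratio m
    d = ∣ ρ m - ρ (suc m) ∣
    B = fromℤ (+ 2) + fromℤ (+ 16) * t
    Q = ⟦ wallis-remainder (var zero) ⟧ (t ∷ [])
    0≤s : 0ℚ ≤ fromℤ (+ 4) * v m * c ^ 7 * t ^ 6
    0≤s = *-nonNeg (*-nonNeg (*-nonNeg (0≤fromℕ 4) (0≤v m)) (^-nonNeg 7 (0≤ratio m))) (^-nonNeg 6 (0≤τ m))

  square-remainder : ∀ {n} → Polynomial n → Polynomial n
  square-remainder t = horner t (coefficients (ℤ.- + 4 ∷ + 8 ∷ + 32 ∷ ℤ.- + 160 ∷ + 248 ∷ + 232 ∷ ℤ.- + 1680 ∷ + 1764 ∷ []))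

  K-square : ℚ
  K-square = ⟦ majorant (square-remainder (var zero)) ⟧ (1ℚ ∷ [])

  0≤K-square : 0ℚ ≤ K-square
  0≤K-square = ≤-trans (0≤∣p∣ (⟦ square-remainder (var zero) ⟧ (τ 0 ∷ [])))
    (majorant-bound (square-remainder (var zero)) (τ 0 ∷ []) (1ℚ ∷ [])
      (λ { zero → ≤-trans (≤-reflexive (0≤p⇒∣p∣≡p (0≤τ 0))) (τ≤1 0) }))

  P²-near-1 : ∀ m → ∣ P (τ m) ^ 2 - 1ℚ ∣ ≤ K-square * inv m
  P²-near-1 m = begin
    ∣ P t ^ 2 - 1ℚ ∣
      ≡⟨ cong ∣_∣ (solve 1 (λ t → horner t p-coefficients :^ 2 :- # 1 := t :* square-remainder t) refl t) ⟩
    ∣ t * Q ∣       ≡⟨ ∣*∣ {Q} (0≤τ m) ⟩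
    t * ∣ Q ∣       ≤⟨ *-mono-≤₀ (0≤inv m) (0≤∣p∣ Q) (τ≤inv m) (majorant-bound (square-remainder (var zero)) (t ∷ []) (1ℚ ∷ [])
                        (λ { zero → ≤-trans (≤-reflexive (0≤p⇒∣p∣≡p (0≤τ m))) (τ≤1 m) })) ⟩
    inv m * K-square ≡⟨ *-comm (inv m) K-square ⟩
    K-square * inv m ∎
    where
    open ≤-Reasoning
    t = τ m
    Q = ⟦ square-remainder (var zero) ⟧ (t ∷ [])

  4leibniz : ℕ → ℚ
  4leibniz k = fromℤ (+ 4) * leibniz k

  K-limit : ℚ
  K-limit = fromℤ (+ 4) * (K-square + fromℤ (+ 2))

  -- This identifies the limit of `ρ` as π. A first-order estimate of P² - 1 is enough, as the rate
  -- comes from `ρ-step`.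
  ρ-leibniz : ∀ k → ∣ ρ (cofinal k) - 4leibniz k ∣ ≤ K-limit * inv k
  ρ-leibniz k = begin
    ∣ fromℤ (+ 4) * (P (τ n) ^ 2 * v n) - fromℤ (+ 4) * leibniz k ∣
      ≡⟨ cong ∣_∣ (solve 3 (λ p v l → # 4 :* (p :* v) :- # 4 :* l := # 4 :* (v :* (p :- # 1) :+ (v :- l)))
           refl (P (τ n) ^ 2) (v n) (leibniz k)) ⟩
    ∣ fromℤ (+ 4) * (v n * (P (τ n) ^ 2 - 1ℚ) + (v n - leibniz k)) ∣
      ≡⟨ ∣*∣ {v n * (P (τ n) ^ 2 - 1ℚ) + (v n - leibniz k)} (0≤fromℕ 4) ⟩
    fromℤ (+ 4) * ∣ v n * (P (τ n) ^ 2 - 1ℚ) + (v n - leibniz k) ∣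
      ≤⟨ *-monoˡ (0≤fromℕ 4) (∣p+q∣≤∣p∣+∣q∣ (v n * (P (τ n) ^ 2 - 1ℚ)) (v n - leibniz k)) ⟩
    fromℤ (+ 4) * (∣ v n * (P (τ n) ^ 2 - 1ℚ) ∣ + ∣ v n - leibniz k ∣)
      ≤⟨ *-monoˡ (0≤fromℕ 4) (+-mono-≤ first (v-leibniz k)) ⟩
    fromℤ (+ 4) * (K-square * inv k + fromℤ (+ 2) * inv k)
      ≡⟨ solve 2 (λ K i → # 4 :* (K :* i :+ # 2 :* i) := # 4 :* (K :+ # 2) :* i) refl K-square (inv k) ⟩
    K-limit * inv k ∎
    where
    open ≤-Reasoning
    n = cofinal k
    first : ∣ v n * (P (τ n) ^ 2 - 1ℚ) ∣ ≤ K-square * inv k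
    first = begin
      ∣ v n * (P (τ n) ^ 2 - 1ℚ) ∣  ≡⟨ ∣*∣ {P (τ n) ^ 2 - 1ℚ} (0≤v n) ⟩
      v n * ∣ P (τ n) ^ 2 - 1ℚ ∣    ≤⟨ *-mono-≤₀ 0≤1 (0≤∣p∣ (P (τ n) ^ 2 - 1ℚ)) (proj₂ (v-bounds n)) (P²-near-1 n) ⟩
      1ℚ * (K-square * inv n)       ≡⟨ *-identityˡ _ ⟩
      K-square * inv n              ≤⟨ *-monoˡ 0≤K-square (unit-anti (k≤cofinal k)) ⟩
      K-square * inv k              ∎

  -- Telescoping from m up to row `cofinal k` costs K τ⁵ whatever k is; passing from that row to the
  -- Leibniz sum costs a term that vanishes with k.
  ρ-near : ∀ m k → m ℕ.≤ k → ∣ ρ m - 4leibniz k ∣ ≤ K-wallis * τ m ^ 5 + K-limit * inv k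
  ρ-near m k m≤k = ≤-trans (∣-∣-triangle (ρ m) (ρ (cofinal k)) (4leibniz k)) (+-mono-≤ first (ρ-leibniz k))
    where
    first : ∣ ρ m - ρ (cofinal k) ∣ ≤ K-wallis * τ m ^ 5
    first = subst (λ j → ∣ ρ m - ρ j ∣ ≤ K-wallis * τ m ^ 5) (ℕₚ.m∸n+n≡m (ℕₚ.≤-trans m≤k (k≤cofinal k)))
      (≤-trans (telescope ρ (λ n → K-wallis * τ n ^ 5) ρ-step m (cofinal k ℕ.∸ m))
        (p-r<p (*-nonNeg 0≤K-wallis (^-nonNeg 5 (0≤τ (cofinal k ℕ.∸ m ℕ.+ m))))))

  b-near : ∀ m k → m ℕ.≤ k → ∣ P (τ m) ^ 2 - b m * 4leibniz k ∣ ≤ K-wallis * τ m ^ 5 + K-limit * inv k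
  b-near m k m≤k = begin
    ∣ P (τ m) ^ 2 - b m * 4leibniz k ∣
      ≡⟨ cong ∣_∣ (using₁ (- P (τ m) ^ 2) (b*4v m) (solve 4 (λ p b v l → p :- b :* l
           := b :* (# 4 :* (p :* v) :- l) :+ :- p :* (b :* (# 4 :* v) :- # 1)) refl (P (τ m) ^ 2) (b m) (v m) (4leibniz k))) ⟩
    ∣ b m * (ρ m - 4leibniz k) ∣   ≡⟨ ∣*∣ {ρ m - 4leibniz k} (0≤b m) ⟩
    b m * ∣ ρ m - 4leibniz k ∣     ≤⟨ *-mono-≤₀ 0≤1 (0≤∣p∣ (ρ m - 4leibniz k)) (b≤1 m) (ρ-near m k m≤k) ⟩
    1ℚ * (K-wallis * τ m ^ 5 + K-limit * inv k) ≡⟨ *-identityˡ _ ⟩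
    K-wallis * τ m ^ 5 + K-limit * inv k ∎
    where open ≤-Reasoning

  -- Negative binomial sums and the recurrence for R.

  Σ<-cong : ∀ n {f g : ℕ → ℚ} → (∀ k → f k ≡ g k) → Σ< n f ≡ Σ< n g
  Σ<-cong zero    eq = refl
  Σ<-cong (suc n) eq = cong₂ _+_ (Σ<-cong n eq) (eq n)

  Σ<-scale : ∀ n s (f : ℕ → ℚ) → s * Σ< n f ≡ Σ< n (λ k → s * f k)
  Σ<-scale zero    s f = *-zeroʳ s
  Σ<-scale (suc n) s f = trans (*-distribˡ-+ s (Σ< n f) (f n)) (cong (_+ s * f n) (Σ<-scale n s f))

  Σ<-nonNeg : ∀ n {f : ℕ → ℚ} → (∀ k → 0ℚ ≤ f k) → 0ℚ ≤ Σ< n f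
  Σ<-nonNeg zero    0≤f = ≤-refl
  Σ<-nonNeg (suc n) 0≤f = +-nonNeg (Σ<-nonNeg n 0≤f) (0≤f n)

  Σ<-mono : ∀ n {f g : ℕ → ℚ} → (∀ k → k ℕ.< n → f k ≤ g k) → Σ< n f ≤ Σ< n g
  Σ<-mono zero    f≤g = ≤-refl
  Σ<-mono (suc n) f≤g = +-mono-≤ (Σ<-mono n (λ k k<n → f≤g k (ℕₚ.m<n⇒m<1+n k<n))) (f≤g n ℕₚ.≤-refl)

  -- The coefficient of x^j in (1-x)^(-(m+1)); with n = m+1 it is the C(n+j-1, j) of the theorem
  -- without a truncated subtraction.
  binomial : ℕ → ℕ → ℚ
  binomial m j = fromℕ ((m ℕ.+ j) choose j)

  binomial-0 : ∀ m → binomial m 0 ≡ 1ℚ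
  binomial-0 m = cong fromℕ (trans (nCk≡nC[n∸k] {0} {m ℕ.+ 0} ℕ.z≤n) (nCn≡1 (m ℕ.+ 0)))

  binomial-pascal : ∀ m j → binomial (suc m) (suc j) ≡ binomial (suc m) j + binomial m (suc j)
  binomial-pascal m j = begin
    fromℕ ((suc m ℕ.+ suc j) choose suc j)
      ≡⟨ cong fromℕ (sym (nCk+nC[k+1]≡[n+1]C[k+1] (m ℕ.+ suc j) j)) ⟩
    fromℕ ((m ℕ.+ suc j) choose j ℕ.+ (m ℕ.+ suc j) choose suc j)
      ≡⟨ fromℕ-+ ((m ℕ.+ suc j) choose j) ((m ℕ.+ suc j) choose suc j) ⟩
    fromℕ ((m ℕ.+ suc j) choose j) + binomial m (suc j)
      ≡⟨ cong (λ i → fromℕ (i choose j) + binomial m (suc j)) (ℕₚ.+-suc m j) ⟩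
    binomial (suc m) j + binomial m (suc j) ∎
    where open ≡-Reasoning

  binomial-sym : ∀ m j → binomial m j ≡ binomial j m
  binomial-sym m j = cong fromℕ (begin
    (m ℕ.+ j) choose j                ≡⟨ nCk≡nC[n∸k] (ℕₚ.m≤n+m j m) ⟩
    (m ℕ.+ j) choose (m ℕ.+ j ℕ.∸ j)  ≡⟨ cong ((m ℕ.+ j) choose_) (ℕₚ.m+n∸n≡m m j) ⟩
    (m ℕ.+ j) choose m                ≡⟨ cong (_choose m) (ℕₚ.+-comm m j) ⟩
    (j ℕ.+ m) choose m                ∎)
    where open ≡-Reasoning

  binomial-absorb : ∀ m j → (1ℚ + fromℕ j) * binomial m (suc j) ≡ (1ℚ + fromℕ m + fromℕ j) * binomial m j
  binomial-absorb zero    j = begin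
    (1ℚ + fromℕ j) * binomial 0 (suc j)  ≡⟨ cong ((1ℚ + fromℕ j) *_) (cong fromℕ (nCn≡1 (suc j))) ⟩
    (1ℚ + fromℕ j) * 1ℚ                  ≡⟨ solve 1 (λ j → (# 1 :+ j) :* # 1 := (# 1 :+ # 0 :+ j) :* # 1) refl (fromℕ j) ⟩
    (1ℚ + 0ℚ + fromℕ j) * 1ℚ             ≡⟨ cong ((1ℚ + 0ℚ + fromℕ j) *_) (sym (cong fromℕ (nCn≡1 j))) ⟩
    (1ℚ + 0ℚ + fromℕ j) * binomial 0 j   ∎
    where open ≡-Reasoning
  binomial-absorb (suc m) zero    = begin
    (1ℚ + 0ℚ) * binomial (suc m) 1
      ≡⟨ cong ((1ℚ + 0ℚ) *_) (binomial-pascal m 0) ⟩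
    (1ℚ + 0ℚ) * (binomial (suc m) 0 + binomial m 1)
      ≡⟨ cong (λ x → (1ℚ + 0ℚ) * (x + binomial m 1)) (trans (binomial-0 (suc m)) (sym (binomial-0 m))) ⟩
    (1ℚ + 0ℚ) * (binomial m 0 + binomial m 1)
      ≡⟨ using₁ 1ℚ (binomial-absorb m 0) (solve 3 (λ x y m → (# 1 :+ # 0) :* (x :+ y)
           := (# 1 :+ (# 1 :+ m) :+ # 0) :* x :+ # 1 :* ((# 1 :+ # 0) :* y :- (# 1 :+ m :+ # 0) :* x)) refl (binomial m 0) (binomial m 1) (fromℕ m)) ⟩
    (1ℚ + (1ℚ + fromℕ m) + 0ℚ) * binomial m 0
      ≡⟨ cong₂ (λ x y → (1ℚ + x + 0ℚ) * y) (sym (fromℕ-suc m)) (trans (binomial-0 m) (sym (binomial-0 (suc m)))) ⟩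
    (1ℚ + fromℕ (suc m) + 0ℚ) * binomial (suc m) 0 ∎
    where open ≡-Reasoning
  binomial-absorb (suc m) (suc j) = begin
    (1ℚ + fromℕ (suc j)) * binomial (suc m) (suc (suc j))
      ≡⟨ cong₂ _*_ (cong (λ x → 1ℚ + x) (fromℕ-suc j)) (binomial-pascal m (suc j)) ⟩
    (1ℚ + (1ℚ + J)) * (X + Y)
      ≡⟨ using₂ 1ℚ absorb₁ 1ℚ absorb₂
         (solve 6 (λ J M X Y Z W → (# 1 :+ (# 1 :+ J)) :* (X :+ Y)
           := X :+ ((# 1 :+ (# 1 :+ M) :+ J) :* Z :+ (# 1 :+ M :+ (# 1 :+ J)) :* W)
              :+ # 1 :* ((# 1 :+ J) :* X :- (# 1 :+ (# 1 :+ M) :+ J) :* Z)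
              :+ # 1 :* ((# 1 :+ (# 1 :+ J)) :* Y :- (# 1 :+ M :+ (# 1 :+ J)) :* W))
           refl J M X Y (binomial (suc m) j) (binomial m (suc j))) ⟩
    X + ((1ℚ + (1ℚ + M) + J) * binomial (suc m) j + (1ℚ + M + (1ℚ + J)) * binomial m (suc j))
      ≡⟨ using₁ (- (fromℤ (+ 2) + M + J)) (binomial-pascal m j)
         (solve 5 (λ J M X Z W → X :+ ((# 1 :+ (# 1 :+ M) :+ J) :* Z :+ (# 1 :+ M :+ (# 1 :+ J)) :* W)
           := (# 1 :+ (# 1 :+ M) :+ (# 1 :+ J)) :* X :+ :- (# 2 :+ M :+ J) :* (X :- (Z :+ W)))
           refl J M X (binomial (suc m) j) (binomial m (suc j))) ⟩
    (1ℚ + (1ℚ + M) + (1ℚ + J)) * X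
      ≡⟨ cong₂ (λ x y → (1ℚ + x + y) * X) (sym (fromℕ-suc m)) (sym (fromℕ-suc j)) ⟩
    (1ℚ + fromℕ (suc m) + fromℕ (suc j)) * X ∎
    where
    open ≡-Reasoning
    J = fromℕ j
    M = fromℕ m
    X = binomial (suc m) (suc j)
    Y = binomial m (suc (suc j))
    absorb₁ : (1ℚ + J) * X ≡ (1ℚ + (1ℚ + M) + J) * binomial (suc m) j
    absorb₁ = trans (binomial-absorb (suc m) j) (cong (λ x → (1ℚ + x + J) * binomial (suc m) j) (fromℕ-suc m))
    absorb₂ : (1ℚ + (1ℚ + J)) * Y ≡ (1ℚ + M + (1ℚ + J)) * binomial m (suc j)
    absorb₂ = subst (λ x → (1ℚ + x) * Y ≡ (1ℚ + M + x) * binomial m (suc j)) (fromℕ-suc j) (binomial-absorb m (suc j))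

  central-double : ∀ m → binomial (suc m) (suc m) ≡ fromℤ (+ 2) * binomial m (suc m)
  central-double m = trans (binomial-pascal m m) (trans (cong (_+ binomial m (suc m)) (binomial-sym (suc m) m))
    (solve 1 (λ x → x :+ x := # 2 :* x) refl (binomial m (suc m))))

  -- This connects `a`, defined as a product so that positivity and monotonicity are immediate, with
  -- the central binomial coefficients.
  central : ∀ n → binomial n n ≡ fromℤ (+ 4) ^ n * a n
  central zero    = refl
  central (suc n) = *-cancelˡ (0<1+fromℕ n) (begin
    (1ℚ + N) * binomial (suc n) (suc n)
      ≡⟨ cong ((1ℚ + N) *_) (central-double n) ⟩
    (1ℚ + N) * (fromℤ (+ 2) * binomial n (suc n))
      ≡⟨ using₁ (fromℤ (+ 2)) (binomial-absorb n n) (solve 3 (λ N x y → (# 1 :+ N) :* (# 2 :* x)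
           := # 2 :* (# 1 :+ N :+ N) :* y :+ # 2 :* ((# 1 :+ N) :* x :- (# 1 :+ N :+ N) :* y)) refl N (binomial n (suc n)) (binomial n n)) ⟩
    fromℤ (+ 2) * (1ℚ + N + N) * binomial n n
      ≡⟨ cong (fromℤ (+ 2) * (1ℚ + N + N) *_) (central n) ⟩
    fromℤ (+ 2) * (1ℚ + N + N) * (fromℤ (+ 4) ^ n * a n)
      ≡⟨ using₁ (- (fromℤ (+ 2) * fromℤ (+ 4) ^ n)) (a-step n) (solve 4 (λ N x a a′ → # 2 :* (# 1 :+ N :+ N) :* (x :* a)
           := (# 1 :+ N) :* (# 4 :* x :* a′) :+ :- (# 2 :* x) :* (a′ :* (# 2 :* (# 1 :+ N)) :- a :* (# 1 :+ # 2 :* N)))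
           refl N (fromℤ (+ 4) ^ n) (a n) (a (suc n))) ⟩
    (1ℚ + N) * (fromℤ (+ 4) ^ suc n * a (suc n)) ∎)
    where
    open ≡-Reasoning
    N = fromℕ n

  -- Indexed by m = n - 1, as are Rℚ, τ, b and ρ.
  Φ : ℕ → ℚ → ℚ → ℚ
  Φ m p q = p ^ suc m * Σ< (suc m) (λ j → binomial m j * q ^ j)

  negative-binomial-sum : ∀ m M q → (1ℚ - q) * Σ< (suc M) (λ j → binomial (suc m) j * q ^ j) + binomial (suc m) M * q ^ suc M
                            ≡ Σ< (suc M) (λ j → binomial m j * q ^ j)
  negative-binomial-sum m zero    q = begin
    (1ℚ - q) * (0ℚ + binomial (suc m) 0 * 1ℚ) + binomial (suc m) 0 * (q * 1ℚ)
      ≡⟨ solve 2 (λ q x → (# 1 :- q) :* (# 0 :+ x :* # 1) :+ x :* (q :* # 1) := # 0 :+ x :* # 1) refl q (binomial (suc m) 0) ⟩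
    0ℚ + binomial (suc m) 0 * 1ℚ
      ≡⟨ cong (λ x → 0ℚ + x * 1ℚ) (trans (binomial-0 (suc m)) (sym (binomial-0 m))) ⟩
    0ℚ + binomial m 0 * 1ℚ ∎
    where open ≡-Reasoning
  negative-binomial-sum m (suc M) q = using₂ 1ℚ (negative-binomial-sum m M q) (q ^ suc M) (binomial-pascal m M)
    (solve 7 (λ q S T X Y Z x → (# 1 :- q) :* (S :+ X :* x) :+ X :* (q :* x)
       := (T :+ Y :* x) :+ # 1 :* ((# 1 :- q) :* S :+ Z :* x :- T) :+ x :* (X :- (Z :+ Y)))
     refl q (Σ< (suc M) (λ j → binomial (suc m) j * q ^ j)) (Σ< (suc M) (λ j → binomial m j * q ^ j))
     (binomial (suc m) (suc M)) (binomial m (suc M)) (binomial (suc m) M) (q ^ suc M))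

  -- Lengthening the sum adds Y q^(m+1), and the truncation in `negative-binomial-sum` removes X
  -- q^(m+2). Since X = 2Y, together they give ½ X q^(m+1) (1-2q), with X the central binomial
  -- coefficient.
  Φ-step : ∀ m p q → p + q ≡ 1ℚ →
    Φ (suc m) p q ≡ Φ m p q + ½ * (fromℤ (+ 4) * (p * q)) ^ suc m * a (suc m) * (p - q)
  Φ-step m p q p+q = begin
    p * P′ * S′
      ≡⟨ using₁ (P′ * S′) p+q (solve 4 (λ p q P S → p :* P :* S := P :* ((# 1 :- q) :* S) :+ P :* S :* (p :+ q :- # 1)) refl p q P′ S′) ⟩
    P′ * ((1ℚ - q) * S′)
      ≡⟨ using₁ P′ (negative-binomial-sum m (suc m) q) (solve 6 (λ P q S T X x → P :* ((# 1 :- q) :* S)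
           := P :* (T :- X :* (q :* x)) :+ P :* ((# 1 :- q) :* S :+ X :* (q :* x) :- T)) refl P′ q S′ T X (q ^ suc m)) ⟩
    P′ * (S + Y * q ^ suc m - X * (q * q ^ suc m))
      ≡⟨ using₂ (- (½ * P′ * q ^ suc m)) (central-double m) (P′ * q ^ suc m * (q * X - Y)) ½*2
           (solve 7 (λ P S Y x X q h → P :* (S :+ Y :* x :- X :* (q :* x))
             := P :* S :+ h :* P :* x :* X :* (# 1 :- q :- q)
                :+ :- (h :* P :* x) :* (X :- # 2 :* Y) :+ P :* x :* (q :* X :- Y) :* (h :* # 2 :- # 1))
             refl P′ S Y (q ^ suc m) X q ½) ⟩
    P′ * S + ½ * P′ * q ^ suc m * X * (1ℚ - q - q)
      ≡⟨ cong₂ (λ x y → P′ * S + ½ * P′ * q ^ suc m * x * (y - q - q)) (central (suc m)) (sym p+q) ⟩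
    P′ * S + ½ * P′ * q ^ suc m * (F * a (suc m)) * (p + q - q - q)
      ≡⟨ solve 8 (λ P S h x F a p q → P :* S :+ h :* P :* x :* (F :* a) :* (p :+ q :- q :- q)
           := P :* S :+ h :* (F :* (P :* x)) :* a :* (p :- q)) refl P′ S ½ (q ^ suc m) F (a (suc m)) p q ⟩
    P′ * S + ½ * (F * (P′ * q ^ suc m)) * a (suc m) * (p - q)
      ≡⟨ cong (λ x → P′ * S + ½ * x * a (suc m) * (p - q))
           (sym (trans (^-distrib (fromℤ (+ 4)) (p * q) (suc m)) (cong (F *_) (^-distrib p q (suc m))))) ⟩
    Φ m p q + ½ * (fromℤ (+ 4) * (p * q)) ^ suc m * a (suc m) * (p - q) ∎
    where
    open ≡-Reasoning
    P′ = p ^ suc m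
    F  = fromℤ (+ 4) ^ suc m
    S′ = Σ< (suc (suc m)) (λ j → binomial (suc m) j * q ^ j)
    S  = Σ< (suc m) (λ j → binomial m j * q ^ j)
    T  = Σ< (suc (suc m)) (λ j → binomial m j * q ^ j)
    X  = binomial (suc m) (suc m)
    Y  = binomial m (suc m)

  z : ℚ → ℚ → ℚ
  z p q = fromℤ (+ 4) * (p * q)

  -- The increments in `Φ-step` are antisymmetric in p and q and cancel. In probabilistic terms, one
  -- of two outcomes of independent trials is the first to occur m+1 times.
  Φ-total : ∀ m p q → p + q ≡ 1ℚ → Φ m p q + Φ m q p ≡ 1ℚ
  Φ-total zero    p q p+q = trans
    (solve 2 (λ p q → p :* # 1 :* (# 0 :+ # 1 :* # 1) :+ q :* # 1 :* (# 0 :+ # 1 :* # 1) := p :+ q) refl p q) p+q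
  Φ-total (suc m) p q p+q = begin
    Φ (suc m) p q + Φ (suc m) q p
      ≡⟨ cong₂ _+_ (Φ-step m p q p+q) (Φ-step m q p (trans (+-comm q p) p+q)) ⟩
    Φ m p q + ½ * z p q ^ suc m * a (suc m) * (p - q) + (Φ m q p + ½ * z q p ^ suc m * a (suc m) * (q - p))
      ≡⟨ cong (λ x → Φ m p q + ½ * z p q ^ suc m * a (suc m) * (p - q) + (Φ m q p + ½ * (fromℤ (+ 4) * x) ^ suc m * a (suc m) * (q - p))) (*-comm q p) ⟩
    Φ m p q + ½ * z p q ^ suc m * a (suc m) * (p - q) + (Φ m q p + ½ * z p q ^ suc m * a (suc m) * (q - p))
      ≡⟨ solve 5 (λ x y c p q → x :+ c :* (p :- q) :+ (y :+ c :* (q :- p)) := x :+ y) refl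
           (Φ m p q) (Φ m q p) (½ * z p q ^ suc m * a (suc m)) p q ⟩
    Φ m p q + Φ m q p
      ≡⟨ Φ-total m p q p+q ⟩
    1ℚ ∎
    where open ≡-Reasoning

  Rℚ : ℕ → ℚ → ℚ → ℚ
  Rℚ m p q = 1ℚ - Φ m p q + Φ m q p

  -- R becomes twice the probability that the outcome of probability q wins the race to m+1. Unlike
  -- the defining difference this form is visibly nonnegative and easy to bound.
  Rℚ-double : ∀ m p q → p + q ≡ 1ℚ → Rℚ m p q ≡ fromℤ (+ 2) * Φ m q p
  Rℚ-double m p q p+q = using₁ (- 1ℚ) (Φ-total m p q p+q)
    (solve 2 (λ x y → # 1 :- x :+ y := # 2 :* y :+ :- # 1 :* (x :+ y :- # 1)) refl (Φ m p q) (Φ m q p))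

  Rℚ-step : ∀ m p q → p + q ≡ 1ℚ → Rℚ m p q - Rℚ (suc m) p q ≡ z p q ^ suc m * a (suc m) * (p - q)
  Rℚ-step m p q p+q = begin
    Rℚ m p q - Rℚ (suc m) p q
      ≡⟨ cong₂ _-_ (Rℚ-double m p q p+q) (Rℚ-double (suc m) p q p+q) ⟩
    fromℤ (+ 2) * Φ m q p - fromℤ (+ 2) * Φ (suc m) q p
      ≡⟨ cong (λ x → fromℤ (+ 2) * Φ m q p - fromℤ (+ 2) * x) (Φ-step m q p (trans (+-comm q p) p+q)) ⟩
    fromℤ (+ 2) * Φ m q p - fromℤ (+ 2) * (Φ m q p + ½ * z q p ^ suc m * a (suc m) * (q - p))
      ≡⟨ cong (λ x → fromℤ (+ 2) * Φ m q p - fromℤ (+ 2) * (Φ m q p + ½ * (fromℤ (+ 4) * x) ^ suc m * a (suc m) * (q - p))) (*-comm q p) ⟩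
    fromℤ (+ 2) * Φ m q p - fromℤ (+ 2) * (Φ m q p + ½ * z p q ^ suc m * a (suc m) * (q - p))
      ≡⟨ using₁ (z p q ^ suc m * a (suc m) * (p - q)) ½*2
           (solve 6 (λ x h y a p q → # 2 :* x :- # 2 :* (x :+ h :* y :* a :* (q :- p))
             := y :* a :* (p :- q) :+ y :* a :* (p :- q) :* (h :* # 2 :- # 1)) refl (Φ m q p) ½ (z p q ^ suc m) (a (suc m)) p q) ⟩
    z p q ^ suc m * a (suc m) * (p - q) ∎
    where open ≡-Reasoning

  -- Decay of R and limits of inequalities.

  ^-mono-exponent : ∀ {x} j n → 1ℚ ≤ x → j ℕ.≤ n → x ^ j ≤ x ^ n
  ^-mono-exponent {x} zero n 1≤x j≤n = subst (_≤ x ^ n) (1^ n) (^-mono n 0≤1 1≤x)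
  ^-mono-exponent (suc j) (suc n) 1≤x (ℕ.s≤s j≤n) =
    *-monoˡ (≤-trans 0≤1 1≤x) (^-mono-exponent j n 1≤x j≤n)

  Φ-nonNeg : ∀ m {p q} → 0ℚ ≤ p → 0ℚ ≤ q → 0ℚ ≤ Φ m p q
  Φ-nonNeg m 0≤p 0≤q = *-nonNeg (^-nonNeg (suc m) 0≤p)
    (Σ<-nonNeg (suc m) (λ j → *-nonNeg (0≤fromℕ ((m ℕ.+ j) choose j)) (^-nonNeg j 0≤q)))

  -- Termwise comparison with p = q = ½, where the value is ½ by symmetry.
  Φ≤ : ∀ m {p q} → 0ℚ ≤ q → 1ℚ ≤ fromℤ (+ 2) * p → Φ m q p ≤ z p q ^ suc m * Φ m ½ ½
  Φ≤ m {p} {q} 0≤q 1≤2p = begin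
    q ^ n * Σ< n (λ j → binomial m j * p ^ j)
      ≤⟨ *-monoˡ (^-nonNeg n 0≤q) (Σ<-mono n term) ⟩
    q ^ n * Σ< n (λ j → x ^ n * (binomial m j * ½ ^ j))
      ≡⟨ cong (q ^ n *_) (sym (Σ<-scale n (x ^ n) (λ j → binomial m j * ½ ^ j))) ⟩
    q ^ n * (x ^ n * S)
      ≡⟨ sym (*-assoc (q ^ n) (x ^ n) S) ⟩
    q ^ n * x ^ n * S
      ≡⟨ cong (_* S) (sym (^-distrib q x n)) ⟩
    (q * x) ^ n * S
      ≡⟨ cong (λ t → t ^ n * S) qx≡z½ ⟩
    (z p q * ½) ^ n * S
      ≡⟨ cong (_* S) (^-distrib (z p q) ½ n) ⟩
    z p q ^ n * ½ ^ n * S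
      ≡⟨ *-assoc (z p q ^ n) (½ ^ n) S ⟩
    z p q ^ n * Φ m ½ ½ ∎
    where
    open ≤-Reasoning
    n = suc m
    x = fromℤ (+ 2) * p
    S = Σ< n (λ j → binomial m j * ½ ^ j)
    0≤½^ : ∀ j → 0ℚ ≤ ½ ^ j
    0≤½^ j = ^-nonNeg j (<⇒≤ 0<½)
    qx≡z½ : q * x ≡ z p q * ½
    qx≡z½ = using₁ (- (fromℤ (+ 2) * p * q)) ½*2
      (solve 3 (λ p q h → q :* (# 2 :* p) := # 4 :* (p :* q) :* h :+ :- (# 2 :* p :* q) :* (h :* # 2 :- # 1)) refl p q ½)
    p≡x½ : p ≡ x * ½
    p≡x½ = using₁ (- p) ½*2 (solve 2 (λ p h → p := # 2 :* p :* h :+ :- p :* (h :* # 2 :- # 1)) refl p ½)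
    term : ∀ j → j ℕ.< n → binomial m j * p ^ j ≤ x ^ n * (binomial m j * ½ ^ j)
    term j j<n = begin
      binomial m j * p ^ j            ≡⟨ cong (λ t → binomial m j * t) (trans (cong (_^ j) p≡x½) (^-distrib x ½ j)) ⟩
      binomial m j * (x ^ j * ½ ^ j)  ≡⟨ solve 3 (λ b x h → b :* (x :* h) := x :* (b :* h)) refl (binomial m j) (x ^ j) (½ ^ j) ⟩
      x ^ j * (binomial m j * ½ ^ j)  ≤⟨ *-monoʳ (*-nonNeg (0≤fromℕ ((m ℕ.+ j) choose j)) (0≤½^ j))
                                           (^-mono-exponent j n 1≤2p (ℕₚ.<⇒≤ j<n)) ⟩
      x ^ n * (binomial m j * ½ ^ j)  ∎

  -- The bound xⁿ ≤ 1/(1+ns) without division. The induction step rests on (1-s)(1+(n+1)s) = 1 + ns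
  -- - (n+1)s².
  bernoulli : ∀ {x s} n → 0ℚ ≤ x → x + s ≡ 1ℚ → x ^ n * (1ℚ + fromℕ n * s) ≤ 1ℚ
  bernoulli {x} {s} zero    0≤x x+s = ≤-reflexive (solve 1 (λ s → # 1 :* (# 1 :+ # 0 :* s) := # 1) refl s)
  bernoulli {x} {s} (suc n) 0≤x x+s = ≤-trans
    (≤-offset (x ^ n * ((1ℚ + fromℕ n) * (s * s))) (*-nonNeg (^-nonNeg n 0≤x) (*-nonNeg (<⇒≤ (0<1+fromℕ n)) (0≤square s)))
      (trans (using₁ (- (x ^ n * (1ℚ + fromℕ n * s + s))) x+s
        (solve 4 (λ X x N s → X :* (# 1 :+ N :* s) := x :* X :* (# 1 :+ (# 1 :+ N) :* s) :+ X :* ((# 1 :+ N) :* (s :* s))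
          :+ :- (X :* (# 1 :+ N :* s :+ s)) :* (x :+ s :- # 1)) refl (x ^ n) x (fromℕ n) s))
        (cong (λ N → x * x ^ n * (1ℚ + N * s) + x ^ n * ((1ℚ + fromℕ n) * (s * s))) (sym (fromℕ-suc n)))))
    (bernoulli n 0≤x x+s)

  scaled-small : ∀ C {ε} → 0ℚ < ε → ∃[ N ] ∀ k → N ℕ.≤ k → C * inv k < ε
  scaled-small C {ε} 0<ε =
    let 0<c = +-mono-≤-< (0≤∣p∣ C) (positive⁻¹ 1ℚ)
        (δ , 0<δ , eq) = divide 0<ε 0<c
        (N , small) = archimedean 0<δ
        open ≤-Reasoning
    in N , λ k N≤k → begin-strict
      C * inv k             ≤⟨ *-monoʳ (0≤inv k) (≤-trans (p≤∣p∣ C) (≤-offset {∣ C ∣} 1ℚ 0≤1 refl)) ⟩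
      (∣ C ∣ + 1ℚ) * inv k  <⟨ *-monoʳ-<-pos (∣ C ∣ + 1ℚ) {{positive 0<c}} (small k N≤k) ⟩
      (∣ C ∣ + 1ℚ) * δ      ≡⟨ eq ⟩
      ε                     ∎

  limit-≤ : ∀ {x y} C → (∀ k → x ≤ y + C * inv k) → x ≤ y
  limit-≤ {x} {y} C h = ≮⇒≥ λ y<x →
    let (N , small) = scaled-small C (subst (_< x - y) (+-inverseʳ y) (+-monoˡ-< (- y) y<x))
        open ≤-Reasoning
    in <-irrefl refl (begin-strict
      x                ≤⟨ h N ⟩
      y + C * inv N    <⟨ +-monoʳ-< y (small N ℕₚ.≤-refl) ⟩
      y + (x - y)      ≡⟨ solve 2 (λ x y → y :+ (x :- y) := x) refl x y ⟩
      x                ∎)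

  -- Expansion of the tail of the series.

  -- Coefficients of S/P, where S is the bracket of the theorem in terms of τ and y = 1/(1-2q)².
  g-coefficients : ∀ {n} → Polynomial n → List (Polynomial n)
  g-coefficients y = List.map (λ cs → horner y (coefficients cs)) (
      (+ 1 ∷ [])
    ∷ (+ 8 ∷ ℤ.- + 8 ∷ [])
    ∷ (+ 64 ∷ ℤ.- + 256 ∷ + 192 ∷ [])
    ∷ (+ 512 ∷ ℤ.- + 6656 ∷ + 13824 ∷ ℤ.- + 7680 ∷ [])
    ∷ (+ 4096 ∷ ℤ.- + 163840 ∷ + 712704 ∷ ℤ.- + 983040 ∷ + 430080 ∷ [])
    ∷ [])

  G : ℚ → ℚ → ℚ
  G t y = ⟦ horner (var zero) (g-coefficients (var (suc zero))) ⟧ (t ∷ y ∷ [])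

  G⁺ : ℚ → ℚ → ℚ
  G⁺ t y = ⟦ homogeneous (# 1 :+ # 16 :* var zero) (var zero) (g-coefficients (var (suc zero))) ⟧ (t ∷ y ∷ [])

  G-suc : ∀ m y → G (τ (suc m)) y ≡ ratio m ^ 4 * G⁺ (τ m) y
  G-suc m y = begin
    G (τ (suc m)) y
      ≡⟨ solve 2 (λ t y → horner t (g-coefficients y) := homogeneous (# 1) t (g-coefficients y)) refl (τ (suc m)) y ⟩
    ⟦ homogeneous (var zero) (var (suc zero)) (g-coefficients (var (suc (suc zero)))) ⟧ (1ℚ ∷ τ (suc m) ∷ y ∷ [])
      ≡⟨ cong₂ (λ u t → ⟦ homogeneous (var zero) (var (suc zero)) (g-coefficients (var (suc (suc zero)))) ⟧ (u ∷ t ∷ y ∷ []))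
           (sym (ratio-inverse m)) (τ-suc m) ⟩
    ⟦ homogeneous (var zero) (var (suc zero)) (g-coefficients (var (suc (suc zero)))) ⟧
      (ratio m * (1ℚ + fromℤ (+ 16) * τ m) ∷ ratio m * τ m ∷ y ∷ [])
      ≡⟨ solve 3 (λ c t y → homogeneous (c :* (# 1 :+ # 16 :* t)) (c :* t) (g-coefficients y)
           := c :^ 4 :* homogeneous (# 1 :+ # 16 :* t) t (g-coefficients y)) refl (ratio m) (τ m) y ⟩
    ratio m ^ 4 * G⁺ (τ m) y ∎
    where open ≡-Reasoning

  tail-remainder : ∀ {n} → Polynomial n → Polynomial n → Polynomial n
  tail-remainder t y = horner t (List.map (λ cs → horner y (coefficients cs)) (
      (ℤ.- + 32768 ∷ + 3964928 ∷ ℤ.- + 32440320 ∷ + 83558400 ∷ ℤ.- + 86016000 ∷ + 30965760 ∷ [])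
    ∷ (+ 0 ∷ + 60817408 ∷ ℤ.- + 784334848 ∷ + 2453667840 ∷ ℤ.- + 2831155200 ∷ + 1101004800 ∷ [])
    ∷ (+ 0 ∷ + 402653184 ∷ ℤ.- + 9160359936 ∷ + 33923530752 ∷ ℤ.- + 42781900800 ∷ + 17616076800 ∷ [])
    ∷ (+ 0 ∷ + 1879048192 ∷ ℤ.- + 60666413056 ∷ + 248034361344 ∷ ℤ.- + 330175610880 ∷ + 140928614400 ∷ [])
    ∷ (+ 0 ∷ + 4294967296 ∷ ℤ.- + 171798691840 ∷ + 747324309504 ∷ ℤ.- + 1030792151040 ∷ + 450971566080 ∷ [])
    ∷ []))

  -- Divided by (1+16t)⁵ this is the matching condition y G(t) - (y-1) (1+8t)/(1+16t) G(t/(1+16t)) =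
  -- 1 + O(t⁵). At order tⁱ the unknown coefficient enters with factor y - (y-1) = 1, so the
  -- coefficients of G are integer polynomials in y.
  tail-identity : ∀ t y → let A = 1ℚ + fromℤ (+ 16) * t in
    y * G t y * A ^ 5 ≡ (y - 1ℚ) * (1ℚ + fromℤ (+ 8) * t) * G⁺ t y + A ^ 5
                        + t ^ 5 * ⟦ tail-remainder (var zero) (var (suc zero)) ⟧ (t ∷ y ∷ [])
  tail-identity = solve 2 (λ t y → let A = # 1 :+ # 16 :* t in
    y :* horner t (g-coefficients y) :* A :^ 5
    := (y :- # 1) :* (# 1 :+ # 8 :* t) :* homogeneous A t (g-coefficients y) :+ A :^ 5
       :+ t :^ 5 :* tail-remainder t y) refl

  majorant₂ : Polynomial 2 → ℚ → ℚ
  majorant₂ f Y = ⟦ majorant f ⟧ (1ℚ ∷ Y ∷ [])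

  majorant₂-bound : ∀ f m {y Y} → 0ℚ ≤ y → y ≤ Y → ∣ ⟦ f ⟧ (τ m ∷ y ∷ []) ∣ ≤ majorant₂ f Y
  majorant₂-bound f m {y} {Y} 0≤y y≤Y = majorant-bound f (τ m ∷ y ∷ []) (1ℚ ∷ Y ∷ [])
    (λ { zero       → ≤-trans (≤-reflexive (0≤p⇒∣p∣≡p (0≤τ m))) (τ≤1 m)
       ; (suc zero) → ≤-trans (≤-reflexive (0≤p⇒∣p∣≡p 0≤y)) y≤Y })

  tail-poly g-poly : Polynomial 2
  tail-poly = tail-remainder (var zero) (var (suc zero))
  g-poly    = horner (var zero) (g-coefficients (var (suc zero)))

  -- The equation `ye²` replaces the division by (p-q)². `K` and `L` depend on the bound `Y` alone
  -- and so stay the same for all terms of the sequence of q.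
  module Expansion (p q y Y : ℚ) (p+q : p + q ≡ 1ℚ) (0≤q : 0ℚ ≤ q) (0<e : 0ℚ < p - q)
                   (ye² : y * (p - q) ^ 2 ≡ 1ℚ) (0≤y : 0ℚ ≤ y) (y≤Y : y ≤ Y) where

    e ζ K : ℚ
    e = p - q
    ζ = z p q
    K = majorant₂ tail-poly Y

    0≤p : 0ℚ ≤ p
    0≤p = ≤-trans 0≤q (≤-offset e (<⇒≤ 0<e) (solve 2 (λ p q → p := q :+ (p :- q)) refl p q))

    1≤2p : 1ℚ ≤ fromℤ (+ 2) * p
    1≤2p = ≤-offset e (<⇒≤ 0<e) (using₁ 1ℚ p+q
      (solve 2 (λ p q → # 2 :* p := # 1 :+ (p :- q) :+ # 1 :* (p :+ q :- # 1)) refl p q))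

    0≤ζ : 0ℚ ≤ ζ
    0≤ζ = *-nonNeg (0≤fromℕ 4) (*-nonNeg 0≤p 0≤q)

    ζ+e² : ζ + e ^ 2 ≡ 1ℚ
    ζ+e² = using₁ (p + q + 1ℚ) p+q
      (solve 2 (λ p q → # 4 :* (p :* q) :+ (p :- q) :^ 2 := # 1 :+ (p :+ q :+ # 1) :* (p :+ q :- # 1)) refl p q)

    yζ : y * ζ ≡ y - 1ℚ
    yζ = using₂ y ζ+e² (- 1ℚ) ye²
      (solve 3 (λ y ζ E → y :* ζ := y :- # 1 :+ y :* (ζ :+ E :- # 1) :+ :- # 1 :* (y :* E :- # 1)) refl y ζ (e ^ 2))

    0≤K : 0ℚ ≤ K
    0≤K = ≤-trans (0≤∣p∣ (⟦ tail-poly ⟧ (τ 0 ∷ y ∷ []))) (majorant₂-bound tail-poly 0 0≤y y≤Y)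

    Φ½ : ∀ m → fromℤ (+ 2) * Φ m ½ ½ ≡ 1ℚ
    Φ½ m = trans (solve 1 (λ x → # 2 :* x := x :+ x) refl (Φ m ½ ½)) (Φ-total m ½ ½ refl)

    R-bounds : ∀ m → 0ℚ ≤ Rℚ m p q × Rℚ m p q ≤ ζ ^ suc m
    R-bounds m = subst (λ x → 0ℚ ≤ x × x ≤ ζ ^ suc m) (sym (Rℚ-double m p q p+q))
      ( *-nonNeg (0≤fromℕ 2) (Φ-nonNeg m 0≤q 0≤p)
      , ≤-trans (*-monoˡ (0≤fromℕ 2) (Φ≤ m 0≤q 1≤2p)) (≤-reflexive (using₁ (ζ ^ suc m) (Φ½ m)
          (solve 2 (λ Z f → # 2 :* (Z :* f) := Z :+ Z :* (# 2 :* f :- # 1)) refl (ζ ^ suc m) (Φ m ½ ½)))))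

    -- Bernoulli with s = e² = 1/y. This weak form of the geometric decay suffices, as it only
    -- serves to show that the error `E` tends to 0.
    ζ^-small : ∀ m → ζ ^ suc m ≤ y * inv m
    ζ^-small m = begin
      ζ ^ suc m
        ≡⟨ using₂ (- (ζ ^ suc m * (y * e ^ 2))) (inv-inverse m) (- ζ ^ suc m) ye²
           (solve 5 (λ Z y E N i → Z := y :* i :* (Z :* ((# 1 :+ N) :* E)) :+ :- (Z :* (y :* E)) :* ((# 1 :+ N) :* i :- # 1)
             :+ (:- Z) :* (y :* E :- # 1)) refl (ζ ^ suc m) y (e ^ 2) (fromℕ m) (inv m)) ⟩
      y * inv m * (ζ ^ suc m * ((1ℚ + fromℕ m) * e ^ 2))
        ≤⟨ *-monoˡ (*-nonNeg 0≤y (0≤inv m)) (≤-trans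
             (≤-offset (ζ ^ suc m) (^-nonNeg (suc m) 0≤ζ) (trans
               (cong (λ N → ζ ^ suc m * (1ℚ + N * e ^ 2)) (fromℕ-suc m))
               (solve 3 (λ Z N E → Z :* (# 1 :+ (# 1 :+ N) :* E) := Z :* ((# 1 :+ N) :* E) :+ Z) refl (ζ ^ suc m) (fromℕ m) (e ^ 2))))
             (bernoulli (suc m) 0≤ζ ζ+e²)) ⟩
      y * inv m * 1ℚ
        ≡⟨ *-identityʳ _ ⟩
      y * inv m ∎
      where open ≤-Reasoning

    -- `κ m` is the series term R m - R (m+1), `W` the approximant, `E` its error, and `D` the
    -- sequence whose differences dominate those of `E`.
    κ W E D : ℕ → ℚ
    κ m = e * a (suc m) * ζ ^ suc m
    W m = κ m * (y * G (τ m) y)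
    E m = Rℚ m p q - W m
    D m = K * (y * κ m * τ m ^ 5)

    0≤κ : ∀ m → 0ℚ ≤ κ m
    0≤κ m = *-nonNeg (*-nonNeg (<⇒≤ 0<e) (<⇒≤ (0<a (suc m)))) (^-nonNeg (suc m) 0≤ζ)

    0≤D : ∀ m → 0ℚ ≤ D m
    0≤D m = *-nonNeg 0≤K (*-nonNeg (*-nonNeg 0≤y (0≤κ m)) (^-nonNeg 5 (0≤τ m)))

    drop-τ : ∀ m → 1ℚ - ½ * inv (suc m) ≡ ratio m * (1ℚ + fromℤ (+ 8) * τ m)
    drop-τ m = trans (cong (λ i → 1ℚ - ½ * i) (trans (inv≡16τ (suc m)) (cong (fromℤ (+ 16) *_) (τ-suc m))))
      (using₂ (- 1ℚ) (ratio-inverse m) (- (fromℤ (+ 8) * (ratio m * τ m))) ½*2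
        (solve 3 (λ c t h → # 1 :- h :* (# 16 :* (c :* t)) := c :* (# 1 :+ # 8 :* t)
          :+ (:- # 1) :* (c :* (# 1 :+ # 16 :* t) :- # 1) :+ :- (# 8 :* (c :* t)) :* (h :* # 2 :- # 1)) refl (ratio m) (τ m) ½))

    E-difference : ∀ m → E m - E (suc m) ≡ - (κ m * ratio m ^ 5 * τ m ^ 5 * ⟦ tail-poly ⟧ (τ m ∷ y ∷ []))
    E-difference m = begin
      r - κ m * (y * g) - (r′ - e * (a₁ * (1ℚ - ½ * inv (suc m))) * (ζ * Z) * (y * G (τ (suc m)) y))
        ≡⟨ cong₂ (λ i g′ → r - κ m * (y * g) - (r′ - e * (a₁ * i) * (ζ * Z) * (y * g′))) (drop-τ m) (G-suc m y) ⟩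
      r - κ m * (y * g) - (r′ - e * (a₁ * (c * (1ℚ + fromℤ (+ 8) * t))) * (ζ * Z) * (y * (c ^ 4 * g⁺)))
        ≡⟨ using₂ 1ℚ (Rℚ-step m p q p+q) (e * a₁ * Z * c ^ 5 * (1ℚ + fromℤ (+ 8) * t) * g⁺) yζ
           (solve 11 (λ r r′ g g⁺ e a Z ζ y c t →
               r :- e :* a :* Z :* (y :* g) :- (r′ :- e :* (a :* (c :* (# 1 :+ # 8 :* t))) :* (ζ :* Z) :* (y :* (c :^ 4 :* g⁺)))
               := e :* a :* Z :* (# 1 :* (# 1 :- y :* g) :+ c :^ 5 :* ((y :- # 1) :* (# 1 :+ # 8 :* t) :* g⁺))
                  :+ # 1 :* (r :- r′ :- Z :* a :* e)
                  :+ e :* a :* Z :* c :^ 5 :* (# 1 :+ # 8 :* t) :* g⁺ :* (y :* ζ :- (y :- # 1)))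
              refl r r′ g g⁺ e a₁ Z ζ y c t) ⟩
      κ m * (1ℚ * (1ℚ - y * g) + c ^ 5 * ((y - 1ℚ) * (1ℚ + fromℤ (+ 8) * t) * g⁺))
        -- The factor 1 is written as (c A)⁵ so that c⁵ is common and `tail-identity` applies.
        ≡⟨ cong (λ x → κ m * (x * (1ℚ - y * g) + c ^ 5 * ((y - 1ℚ) * (1ℚ + fromℤ (+ 8) * t) * g⁺)))
             (sym (trans (cong (_^ 5) (ratio-inverse m)) (1^ 5))) ⟩
      κ m * ((c * A) ^ 5 * (1ℚ - y * g) + c ^ 5 * ((y - 1ℚ) * (1ℚ + fromℤ (+ 8) * t) * g⁺))
        ≡⟨ using₁ (- (κ m * c ^ 5)) (tail-identity t y)
           (solve 8 (λ k c A g y B T Q → k :* ((c :* A) :^ 5 :* (# 1 :- y :* g) :+ c :^ 5 :* B)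
             := :- (k :* c :^ 5 :* T :* Q) :+ :- (k :* c :^ 5) :* (y :* g :* A :^ 5 :- (B :+ A :^ 5 :+ T :* Q)))
             refl (κ m) c A g y ((y - 1ℚ) * (1ℚ + fromℤ (+ 8) * t) * g⁺) (t ^ 5) (⟦ tail-poly ⟧ (t ∷ y ∷ []))) ⟩
      - (κ m * c ^ 5 * t ^ 5 * ⟦ tail-poly ⟧ (t ∷ y ∷ [])) ∎
      where
      open ≡-Reasoning
      t = τ m
      c = ratio m
      A = 1ℚ + fromℤ (+ 16) * t
      a₁ = a (suc m)
      Z = ζ ^ suc m
      r = Rℚ m p q
      r′ = Rℚ (suc m) p q
      g = G t y
      g⁺ = G⁺ t y

    -- Since y - yζ = 1, the factor y in `D` pays exactly for the sum of the geometric tail. The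
    -- decrease of `a` and of τ only increases the right side.
    D-drop : ∀ m → K * (κ m * τ m ^ 5) ≤ D m - D (suc m)
    D-drop m = begin
      K * (κ m * t ^ 5)
        ≤⟨ ≤-offset (K * ((y - 1ℚ) * κ m * (t ^ 5 - f * τ (suc m) ^ 5)))
             (*-nonNeg 0≤K (*-nonNeg (*-nonNeg 0≤y-1 (0≤κ m)) (0≤r-p ft′≤t)))
             (using₁ (- (K * e * a (suc m) * ζ ^ suc m * f * τ (suc m) ^ 5)) yζ
               (solve 9 (λ K y e a Z ζ T T′ f → K :* (y :* (e :* a :* Z) :* T) :- K :* (y :* (e :* (a :* f) :* (ζ :* Z)) :* T′)
                 := K :* (e :* a :* Z :* T) :+ K :* ((y :- # 1) :* (e :* a :* Z) :* (T :- f :* T′))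
                    :+ :- (K :* e :* a :* Z :* f :* T′) :* (y :* ζ :- (y :- # 1)))
                 refl K y e (a (suc m)) (ζ ^ suc m) ζ (t ^ 5) (τ (suc m) ^ 5) f)) ⟩
      D m - D (suc m) ∎
      where
      open ≤-Reasoning
      t = τ m
      f = 1ℚ - ½ * inv (suc m)
      0≤y-1 : 0ℚ ≤ y - 1ℚ
      0≤y-1 = subst (0ℚ ≤_) yζ (*-nonNeg 0≤y 0≤ζ)
      t′≤t : τ (suc m) ≤ t
      t′≤t = *-monoˡ (0≤inv 15) (unit-anti (ℕₚ.n≤1+n m))
      ft′≤t : f * τ (suc m) ^ 5 ≤ t ^ 5
      ft′≤t = subst (f * τ (suc m) ^ 5 ≤_) (*-identityˡ (t ^ 5))
        (*-mono-≤₀ 0≤1 (^-nonNeg 5 (0≤τ (suc m))) (proj₂ (a-factor (suc m))) (^-mono 5 (0≤τ (suc m)) t′≤t))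

    E-step : ∀ m → ∣ E m - E (suc m) ∣ ≤ D m - D (suc m)
    E-step m = begin
      ∣ E m - E (suc m) ∣          ≡⟨ cong ∣_∣ (E-difference m) ⟩
      ∣ - (κ m * c ^ 5 * t ^ 5 * Q) ∣ ≡⟨ ∣-p∣≡∣p∣ (κ m * c ^ 5 * t ^ 5 * Q) ⟩
      ∣ κ m * c ^ 5 * t ^ 5 * Q ∣  ≡⟨ ∣*∣ {Q} (*-nonNeg (*-nonNeg (0≤κ m) (^-nonNeg 5 (0≤ratio m))) (^-nonNeg 5 (0≤τ m))) ⟩
      κ m * c ^ 5 * t ^ 5 * ∣ Q ∣  ≤⟨ *-mono-≤₀ (*-nonNeg (0≤κ m) (^-nonNeg 5 (0≤τ m))) (0≤∣p∣ Q)
                                        (*-monoʳ (^-nonNeg 5 (0≤τ m)) (subst (κ m * c ^ 5 ≤_) (*-identityʳ (κ m))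
                                          (*-monoˡ (0≤κ m) (^≤1 5 (0≤ratio m) (ratio≤1 m)))))
                                        (majorant₂-bound tail-poly m 0≤y y≤Y) ⟩
      κ m * t ^ 5 * K              ≡⟨ *-comm _ K ⟩
      K * (κ m * t ^ 5)            ≤⟨ D-drop m ⟩
      D m - D (suc m)              ∎
      where
      open ≤-Reasoning
      t = τ m
      c = ratio m
      Q = ⟦ tail-poly ⟧ (t ∷ y ∷ [])

    L B : ℚ
    L = majorant₂ g-poly Y
    B = 1ℚ + e * (y * L)

    0≤L : 0ℚ ≤ L
    0≤L = ≤-trans (0≤∣p∣ (G (τ 0) y)) (majorant₂-bound g-poly 0 0≤y y≤Y)

    0≤B : 0ℚ ≤ B
    0≤B = +-nonNeg 0≤1 (*-nonNeg (<⇒≤ 0<e) (*-nonNeg 0≤y 0≤L))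

    E-small : ∀ m → ∣ E m ∣ ≤ B * (y * inv m)
    E-small m = begin
      ∣ Rℚ m p q - W m ∣             ≤⟨ ∣p-q∣≤∣p∣+∣q∣ (Rℚ m p q) (W m) ⟩
      ∣ Rℚ m p q ∣ + ∣ W m ∣         ≤⟨ +-mono-≤ R≤ W≤ ⟩
      Z + Z * (e * (y * L))          ≡⟨ solve 2 (λ Z x → Z :+ Z :* x := (# 1 :+ x) :* Z) refl Z (e * (y * L)) ⟩
      B * Z                          ≤⟨ *-monoˡ 0≤B (ζ^-small m) ⟩
      B * (y * inv m)                ∎
      where
      open ≤-Reasoning
      Z = ζ ^ suc m
      g = G (τ m) y
      R≤ : ∣ Rℚ m p q ∣ ≤ Z
      R≤ = subst (_≤ Z) (sym (0≤p⇒∣p∣≡p (proj₁ (R-bounds m)))) (proj₂ (R-bounds m))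
      W≤ : ∣ W m ∣ ≤ Z * (e * (y * L))
      W≤ = begin
        ∣ κ m * (y * g) ∣             ≡⟨ ∣*∣ {y * g} (0≤κ m) ⟩
        κ m * ∣ y * g ∣               ≡⟨ cong (κ m *_) (∣*∣ {g} 0≤y) ⟩
        κ m * (y * ∣ g ∣)             ≤⟨ *-monoˡ (0≤κ m) (*-monoˡ 0≤y (majorant₂-bound g-poly m 0≤y y≤Y)) ⟩
        e * a (suc m) * Z * (y * L)   ≡⟨ solve 4 (λ e a Z x → e :* a :* Z :* x := a :* (Z :* (e :* x))) refl e (a (suc m)) Z (y * L) ⟩
        a (suc m) * (Z * (e * (y * L))) ≤⟨ *-monoʳ (*-nonNeg (^-nonNeg (suc m) 0≤ζ) (*-nonNeg (<⇒≤ 0<e) (*-nonNeg 0≤y 0≤L))) (a≤1 (suc m)) ⟩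
        1ℚ * (Z * (e * (y * L)))      ≡⟨ *-identityˡ _ ⟩
        Z * (e * (y * L))             ∎

    -- `E` vanishes at infinity by `E-small`, so telescoping over all later indices bounds `E m`
    -- itself.
    E-bound : ∀ m → ∣ E m ∣ ≤ D m
    E-bound m = limit-≤ (B * y) λ k → begin
      ∣ E m ∣
        ≡⟨ cong ∣_∣ (solve 2 (λ x y → x := x :- y :+ y) refl (E m) (E (k ℕ.+ m))) ⟩
      ∣ E m - E (k ℕ.+ m) + E (k ℕ.+ m) ∣
        ≤⟨ ∣p+q∣≤∣p∣+∣q∣ (E m - E (k ℕ.+ m)) (E (k ℕ.+ m)) ⟩
      ∣ E m - E (k ℕ.+ m) ∣ + ∣ E (k ℕ.+ m) ∣
        ≤⟨ +-mono-≤ (≤-trans (telescope E D E-step m k) (p-r<p {D m} (0≤D (k ℕ.+ m)))) (E-small (k ℕ.+ m)) ⟩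
      D m + B * (y * inv (k ℕ.+ m))
        ≤⟨ +-monoʳ-≤ (D m) (*-monoˡ 0≤B (*-monoˡ 0≤y (unit-anti (ℕₚ.m≤m+n k m)))) ⟩
      D m + B * (y * inv k)
        ≡⟨ cong (λ x → D m + x) (sym (*-assoc B y (inv k))) ⟩
      D m + B * y * inv k ∎
      where open ≤-Reasoning

  -- Combination of the two expansions.

  p-poly : Polynomial 1
  p-poly = horner (var zero) p-coefficients

  K-P : ℚ
  K-P = ⟦ majorant p-poly ⟧ (1ℚ ∷ [])

  P≤ : ∀ m → P (τ m) ≤ K-P
  P≤ m = ≤-trans (p≤∣p∣ (P (τ m))) (majorant-bound p-poly (τ m ∷ []) (1ℚ ∷ [])
    (λ { zero → ≤-trans (≤-reflexive (0≤p⇒∣p∣≡p (0≤τ m))) (τ≤1 m) }))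

  ½≤P : ∀ m → ½ ≤ P (τ m)
  -- As 16t = i ≤ 1, the terms -2t and -42t⁴ are absorbed by ½(1 - 16t) and 20t³(1 - 16t); the
  -- positive rest is 6t + 2t² + 278t⁴.
  ½≤P m = ≤-offset (½ * (1ℚ - i) + (fromℤ (+ 6) * t + fromℤ (+ 2) * t ^ 2 + fromℤ (+ 20) * t ^ 3 * (1ℚ - i) + fromℤ (+ 278) * t ^ 4))
    (+-nonNeg (*-nonNeg (<⇒≤ 0<½) 0≤1-i) (+-nonNeg (+-nonNeg (+-nonNeg (*-nonNeg (0≤fromℕ 6) (0≤τ m))
      (*-nonNeg (0≤fromℕ 2) (^-nonNeg 2 (0≤τ m)))) (*-nonNeg (*-nonNeg (0≤fromℕ 20) (^-nonNeg 3 (0≤τ m))) 0≤1-i))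
      (*-nonNeg (0≤fromℕ 278) (^-nonNeg 4 (0≤τ m)))))
    (using₂ (- (1ℚ - fromℤ (+ 8) * t)) ½*2 (½ + fromℤ (+ 20) * t ^ 3) (inv≡16τ m)
      (solve 3 (λ t h i → horner t p-coefficients
        := h :+ (h :* (# 1 :- i) :+ (# 6 :* t :+ # 2 :* t :^ 2 :+ # 20 :* t :^ 3 :* (# 1 :- i) :+ # 278 :* t :^ 4))
           :+ :- (# 1 :- # 8 :* t) :* (h :* # 2 :- # 1) :+ (h :+ # 20 :* t :^ 3) :* (i :- # 16 :* t))
        refl t ½ i))
    where
    t = τ m
    i = inv m
    0≤1-i : 0ℚ ≤ 1ℚ - i
    0≤1-i = 0≤r-p (inv≤1 m)

  s-coefficients : ∀ {n} → Polynomial n → List (Polynomial n)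
  s-coefficients y = List.map (λ cs → horner y (coefficients cs)) (
      (+ 1 ∷ [])
    ∷ (+ 6 ∷ ℤ.- + 8 ∷ [])
    ∷ (+ 50 ∷ ℤ.- + 240 ∷ + 192 ∷ [])
    ∷ (+ 420 ∷ ℤ.- + 6160 ∷ + 13440 ∷ ℤ.- + 7680 ∷ [])
    ∷ (+ 3318 ∷ ℤ.- + 151200 ∷ + 685440 ∷ ℤ.- + 967680 ∷ + 430080 ∷ [])
    ∷ [])

  S : ℚ → ℚ → ℚ
  S t y = ⟦ horner (var zero) (s-coefficients (var (suc zero))) ⟧ (t ∷ y ∷ [])

  product-remainder : ∀ {n} → Polynomial n → Polynomial n → Polynomial n
  product-remainder t y = horner t (List.map (λ cs → horner y (coefficients cs)) (
      (ℤ.- + 6224 ∷ + 309584 ∷ ℤ.- + 1393920 ∷ + 1950720 ∷ ℤ.- + 860160 ∷ [])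
    ∷ (+ 15744 ∷ ℤ.- + 450048 ∷ + 1693824 ∷ ℤ.- + 2119680 ∷ + 860160 ∷ [])
    ∷ (+ 60416 ∷ ℤ.- + 2997248 ∷ + 13673472 ∷ ℤ.- + 19338240 ∷ + 8601600 ∷ [])
    ∷ (ℤ.- + 172032 ∷ + 6881280 ∷ ℤ.- + 29933568 ∷ + 41287680 ∷ ℤ.- + 18063360 ∷ [])
    ∷ []))

  product-poly : Polynomial 2
  product-poly = product-remainder (var zero) (var (suc zero))

  -- The bracket S of the theorem is the product of the two expansions cut off after t⁴.
  product-identity : ∀ t y → P t * G t y ≡ S t y + t ^ 5 * ⟦ product-poly ⟧ (t ∷ y ∷ [])
  product-identity = solve 2 (λ t y → horner t p-coefficients :* horner t (g-coefficients y)
    := horner t (s-coefficients y) :+ t :^ 5 :* product-remainder t y) refl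

  inverse-nonNeg : ∀ {x i} → 0ℚ ≤ x → x * i ≡ 1ℚ → 0ℚ ≤ i
  inverse-nonNeg {x} {i} 0≤x xi = subst (0ℚ ≤_)
    (using₁ i xi (solve 2 (λ x i → x :* (i :* i) := i :+ i :* (x :* i :- # 1)) refl x i))
    (*-nonNeg 0≤x (0≤square i))

  K-remainder K-error : ℚ → ℚ
  K-remainder Y = majorant₂ tail-poly Y * K-P + majorant₂ product-poly Y
  K-error     Y = majorant₂ tail-poly Y + majorant₂ g-poly Y

  module Remainder (p q y Y : ℚ) (p+q : p + q ≡ 1ℚ) (0≤q : 0ℚ ≤ q) (0<e : 0ℚ < p - q)
                   (ye² : y * (p - q) ^ 2 ≡ 1ℚ) (0≤y : 0ℚ ≤ y) (y≤Y : y ≤ Y) where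

    open Expansion p q y Y p+q 0≤q 0<e ye² 0≤y y≤Y

    -- Here u, s and i stand for √π, √n and ζ^(-n). The difference splits into (u e s i) E, the
    -- error of the tail; G (a u s - P), the error of the prefactor; and P G - S, the truncation.
    remainder-bound : ∀ m {u s i δ} → ζ ^ suc m * i ≡ 1ℚ → 0ℚ ≤ u → 0ℚ ≤ s →
      ∣ a (suc m) * (u * s) - P (τ m) ∣ ≤ δ →
      ∣ Rℚ m p q * (u * e) * s * i - S (τ m) y ∣ ≤ K-remainder Y * τ m ^ 5 + K-error Y * δ
    remainder-bound m {u} {s} {i} {δ} Zi 0≤u 0≤s x-P = begin
      ∣ r * (u * e) * s * i - S t y ∣
        ≡⟨ cong ∣_∣ (using₁ 1ℚ (product-identity t y) (using₂ (x * g) ye² (x * g * (y * e ^ 2)) Zi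
             (solve 12 (λ r u e s i S a Z y g P T → r :* (u :* e) :* s :* i :- S
                := (u :* e :* s :* i) :* (r :- e :* a :* Z :* (y :* g)) :+ g :* (a :* (u :* s) :- P) :+ T
                   :+ # 1 :* (P :* g :- (S :+ T)) :+ a :* (u :* s) :* g :* (y :* e :^ 2 :- # 1)
                   :+ a :* (u :* s) :* g :* (y :* e :^ 2) :* (Z :* i :- # 1))
                refl r u e s i (S t y) (a (suc m)) Z y g (P t) (t ^ 5 * Q)))) ⟩
      ∣ w′ * E m + g * (x - P t) + t ^ 5 * Q ∣
        ≤⟨ ∣p+q∣≤∣p∣+∣q∣ (w′ * E m + g * (x - P t)) (t ^ 5 * Q) ⟩
      ∣ w′ * E m + g * (x - P t) ∣ + ∣ t ^ 5 * Q ∣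
        ≤⟨ +-mono-≤ (≤-trans (∣p+q∣≤∣p∣+∣q∣ (w′ * E m) (g * (x - P t))) (+-mono-≤ first second)) third ⟩
      K * (K-P * t ^ 5 + δ) + L * δ + t ^ 5 * majorant₂ product-poly Y
        ≡⟨ solve 6 (λ K L M p T δ → K :* (p :* T :+ δ) :+ L :* δ :+ T :* M := (K :* p :+ M) :* T :+ (K :+ L) :* δ) refl
             K L (majorant₂ product-poly Y) K-P (t ^ 5) δ ⟩
      K-remainder Y * t ^ 5 + K-error Y * δ ∎
      where
      open ≤-Reasoning
      t = τ m
      Z = ζ ^ suc m
      r = Rℚ m p q
      g = G t y
      x = a (suc m) * (u * s)
      Q = ⟦ product-poly ⟧ (t ∷ y ∷ [])
      w′ = u * e * s * i
      0≤T : 0ℚ ≤ t ^ 5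
      0≤T = ^-nonNeg 5 (0≤τ m)
      0≤w′ : 0ℚ ≤ w′
      0≤w′ = *-nonNeg (*-nonNeg (*-nonNeg 0≤u (<⇒≤ 0<e)) 0≤s) (inverse-nonNeg (^-nonNeg (suc m) 0≤ζ) Zi)
      0≤δ : 0ℚ ≤ δ
      0≤δ = ≤-trans (0≤∣p∣ (x - P t)) x-P
      x≤ : x * t ^ 5 ≤ K-P * t ^ 5 + δ
      x≤ = begin
        x * t ^ 5                   ≤⟨ *-monoʳ 0≤T (≤-trans (p≤r+∣p-r∣ x (P t)) (+-mono-≤ (P≤ m) x-P)) ⟩
        (K-P + δ) * t ^ 5           ≡⟨ *-distribʳ-+ (t ^ 5) K-P δ ⟩
        K-P * t ^ 5 + δ * t ^ 5     ≤⟨ +-monoʳ-≤ (K-P * t ^ 5) (subst (δ * t ^ 5 ≤_) (*-identityʳ δ)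
                                         (*-monoˡ 0≤δ (^≤1 5 (0≤τ m) (τ≤1 m)))) ⟩
        K-P * t ^ 5 + δ             ∎
      first : ∣ w′ * E m ∣ ≤ K * (K-P * t ^ 5 + δ)
      first = begin
        ∣ w′ * E m ∣                ≡⟨ ∣*∣ {E m} 0≤w′ ⟩
        w′ * ∣ E m ∣                ≤⟨ *-monoˡ 0≤w′ (E-bound m) ⟩
        w′ * D m
          ≡⟨ using₂ (K * x * t ^ 5) ye² (K * x * t ^ 5 * (y * e ^ 2)) Zi
               (solve 9 (λ K u e s i a Z y T → u :* e :* s :* i :* (K :* (y :* (e :* a :* Z) :* T))
                 := K :* (a :* (u :* s) :* T) :+ K :* (a :* (u :* s)) :* T :* (y :* e :^ 2 :- # 1)
                    :+ K :* (a :* (u :* s)) :* T :* (y :* e :^ 2) :* (Z :* i :- # 1))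
                 refl K u e s i (a (suc m)) Z y (t ^ 5)) ⟩
        K * (x * t ^ 5)             ≤⟨ *-monoˡ 0≤K x≤ ⟩
        K * (K-P * t ^ 5 + δ)       ∎
      second : ∣ g * (x - P t) ∣ ≤ L * δ
      second = subst (_≤ L * δ) (sym (∣p*q∣≡∣p∣*∣q∣ g (x - P t)))
        (*-mono-≤₀ 0≤L (0≤∣p∣ (x - P t)) (majorant₂-bound g-poly m 0≤y y≤Y) x-P)
      third : ∣ t ^ 5 * Q ∣ ≤ t ^ 5 * majorant₂ product-poly Y
      third = subst (_≤ t ^ 5 * majorant₂ product-poly Y) (sym (∣*∣ {Q} 0≤T))
        (*-monoˡ 0≤T (majorant₂-bound product-poly m 0≤y y≤Y))

  -- Square roots with precision 1/(k+1).

  lower-square : ∀ {u x} → 0ℚ ≤ x → u ≡ 0ℚ ⊎ u * u ≤ x → u * u ≤ x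
  lower-square {u} 0≤x (inj₁ u≡0)  = ≤-trans (≤-reflexive (trans (cong (_* u) u≡0) (*-zeroˡ u))) 0≤x
  lower-square     0≤x (inj₂ u²≤x) = u²≤x

  K-sqrt : ℚ → ℚ
  K-sqrt X = fromℤ (+ 3) + fromℤ (+ 2) * X

  square-error : ∀ {u h x X} → 0ℚ ≤ u → 0ℚ ≤ h → h ≤ 1ℚ → 0ℚ ≤ x → x ≤ X →
                 u * u ≤ x → x < (u + h) * (u + h) → ∣ u * u - x ∣ ≤ K-sqrt X * h
  square-error {u} {h} {x} {X} 0≤u 0≤h h≤1 0≤x x≤X lower upper = ∣∣≤
    (≤-trans (subst (u * u - x ≤_) (+-inverseʳ x) (+-monoˡ-≤ (- x) lower))
      (*-nonNeg (+-nonNeg (0≤fromℕ 3) (*-nonNeg (0≤fromℕ 2) (≤-trans 0≤x x≤X))) 0≤h))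
    (begin
      - (u * u - x)                 ≡⟨ solve 2 (λ u x → :- (u :* u :- x) := x :- u :* u) refl u x ⟩
      x - u * u                     ≤⟨ +-monoˡ-≤ (- (u * u)) (<⇒≤ upper) ⟩
      -- The root is bounded linearly by u ≤ 1 + u² ≤ 1 + X, which needs no root of X and gives the
      -- constant 3 + 2X.
      (u + h) * (u + h) - u * u     ≤⟨ ≤-offset (h * (1ℚ - h + fromℤ (+ 2) * (X - x + (x - u * u) + ((1ℚ - u) * (1ℚ - u) + u))))
                                         (*-nonNeg 0≤h (+-nonNeg (0≤r-p h≤1) (*-nonNeg (0≤fromℕ 2)
                                           (+-nonNeg (+-nonNeg (0≤r-p x≤X) (0≤r-p lower)) (+-nonNeg (0≤square (1ℚ - u)) 0≤u)))))
                                         (solve 4 (λ u h x X → (# 3 :+ # 2 :* X) :* h := ((u :+ h) :* (u :+ h) :- u :* u)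
                                           :+ h :* (# 1 :- h :+ # 2 :* (X :- x :+ (x :- u :* u) :+ ((# 1 :- u) :* (# 1 :- u) :+ u)))) refl u h x X) ⟩
      K-sqrt X * h                  ∎)
    where open ≤-Reasoning

  leibniz-bounds : ∀ k → 0ℚ ≤ leibniz k × leibniz k ≤ 1ℚ
  leibniz-bounds k = subst (λ x → 0ℚ ≤ x × x ≤ 1ℚ)
    (sym (trans (cong leibniz (sym (ℕₚ.+-identityʳ k))) (trans (leibniz-tail 0 k)
      (solve 1 (λ x → # 0 :+ # 1 :* x := x) refl (tail 0 k))))) (tail-bounds 0 k)

  4leibniz-bounds : ∀ k → 0ℚ ≤ 4leibniz k × 4leibniz k ≤ fromℤ (+ 4)
  4leibniz-bounds k = *-nonNeg (0≤fromℕ 4) (proj₁ (leibniz-bounds k))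
    , *-monoˡ {r = 1ℚ} (0≤fromℕ 4) (proj₂ (leibniz-bounds k))

  -- Wallis's limit only controls squares; as x + r ≥ ½, the factor x + r can be removed at the cost
  -- of a factor 2.
  ∣-∣-by-square : ∀ {x r δ} → 0ℚ ≤ x → ½ ≤ r → ∣ x ^ 2 - r ^ 2 ∣ ≤ δ → ∣ x - r ∣ ≤ fromℤ (+ 2) * δ
  ∣-∣-by-square {x} {r} {δ} 0≤x ½≤r h = begin
    ∣ x - r ∣
      ≤⟨ ≤-offset (fromℤ (+ 2) * (x + (r - ½)) * ∣ x - r ∣)
           (*-nonNeg (*-nonNeg (0≤fromℕ 2) (+-nonNeg 0≤x (0≤r-p ½≤r))) (0≤∣p∣ (x - r)))
           (using₁ ∣ x - r ∣ ½*2 (solve 4 (λ x r h d → # 2 :* ((x :+ r) :* d) := d :+ # 2 :* (x :+ (r :- h)) :* d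
             :+ d :* (h :* # 2 :- # 1)) refl x r ½ ∣ x - r ∣)) ⟩
    fromℤ (+ 2) * ((x + r) * ∣ x - r ∣)
      ≡⟨ cong (fromℤ (+ 2) *_) (sym (∣*∣ {x - r} (+-nonNeg 0≤x (≤-trans (<⇒≤ 0<½) ½≤r)))) ⟩
    fromℤ (+ 2) * ∣ (x + r) * (x - r) ∣
      ≡⟨ cong (λ d → fromℤ (+ 2) * ∣ d ∣) (solve 2 (λ x r → (x :+ r) :* (x :- r) := x :^ 2 :- r :^ 2) refl x r) ⟩
    fromℤ (+ 2) * ∣ x ^ 2 - r ^ 2 ∣
      ≤⟨ *-monoˡ (0≤fromℕ 2) h ⟩
    fromℤ (+ 2) * δ ∎
    where open ≤-Reasoning

  -- All that the estimates need to know about the grid search: u is a root from below, and one more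
  -- grid step overshoots.
  record ApproximateSqrt (k : ℕ) (x u : ℚ) : Set where
    field
      0≤root : 0ℚ ≤ u
      root²≤ : u * u ≤ x
      root²> : x < (u + inv k) * (u + inv k)

    error : ∀ {X} → 0ℚ ≤ x → x ≤ X → ∣ u * u - x ∣ ≤ K-sqrt X * inv k
    error 0≤x x≤X = square-error 0≤root (0≤inv k) (inv≤1 k) 0≤x x≤X root²≤ root²>

  open ApproximateSqrt

  sqrtℚ-approximate : ∀ k {x} → 0ℚ ≤ x → ApproximateSqrt k x (sqrtℚ k x)
  sqrtℚ-approximate k {x} 0≤x = record
    { 0≤root = 0≤sqrtℚ k x ; root²≤ = lower-square 0≤x (sqrtℚ-lower k x) ; root²> = sqrtℚ-upper k x }

  -- This constant grows with m, which is harmless: it multiplies only 1/(k+1), and k tends to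
  -- infinity with m fixed.
  K-prefactor : ℕ → ℚ
  K-prefactor m = K-limit + (K-sqrt (fromℤ (+ 4)) * N + fromℤ (+ 4) * K-sqrt N)
    where N = fromℕ (suc m)

  -- The square of a u s is `b m` times `4leibniz k` up to the two root errors, and `b-near`
  -- compares that product with P².
  prefactor-near : ∀ {m k u s} → m ℕ.≤ k →
    ApproximateSqrt k (4leibniz k) u → ApproximateSqrt k (fromℕ (suc m)) s →
    ∣ a (suc m) * (u * s) - P (τ m) ∣ ≤ fromℤ (+ 2) * (K-wallis * τ m ^ 5 + K-prefactor m * inv k)
  prefactor-near {m} {k} {u} {s} m≤k √π √n =
    ∣-∣-by-square (*-nonNeg (<⇒≤ (0<a (suc m))) (*-nonNeg (0≤root √π) (0≤root √n))) (½≤P m) (begin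
      ∣ (α * (u * s)) ^ 2 - p ^ 2 ∣
        ≡⟨ cong ∣_∣ (using₁ (α ^ 2 * ϖ) (fromℕ-suc m)
             (solve 7 (λ α u s p ϖ N M → (α :* (u :* s)) :^ 2 :- p :^ 2
               := α :^ 2 :* (s :* s :* (u :* u :- ϖ) :+ ϖ :* (s :* s :- N)) :+ :- (p :^ 2 :- (# 1 :+ M) :* α :^ 2 :* ϖ)
                  :+ α :^ 2 :* ϖ :* (N :- (# 1 :+ M)))
               refl α u s p ϖ N (fromℕ m))) ⟩
      ∣ α ^ 2 * (s * s * (u * u - ϖ) + ϖ * (s * s - N)) + - (p ^ 2 - b m * ϖ) ∣
        ≤⟨ ∣p+q∣≤∣p∣+∣q∣ (α ^ 2 * (s * s * (u * u - ϖ) + ϖ * (s * s - N))) (- (p ^ 2 - b m * ϖ)) ⟩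
      ∣ α ^ 2 * (s * s * (u * u - ϖ) + ϖ * (s * s - N)) ∣ + ∣ - (p ^ 2 - b m * ϖ) ∣
        ≤⟨ +-mono-≤ first (≤-trans (≤-reflexive (∣-p∣≡∣p∣ (p ^ 2 - b m * ϖ))) (b-near m k m≤k)) ⟩
      N * (K-sqrt (fromℤ (+ 4)) * h) + fromℤ (+ 4) * (K-sqrt N * h) + (K-wallis * τ m ^ 5 + K-limit * h)
        ≡⟨ solve 7 (λ N A B h W T L → N :* (A :* h) :+ # 4 :* (B :* h) :+ (W :* T :+ L :* h)
             := W :* T :+ (L :+ (A :* N :+ # 4 :* B)) :* h) refl N (K-sqrt (fromℤ (+ 4))) (K-sqrt N) h K-wallis (τ m ^ 5) K-limit ⟩
      K-wallis * τ m ^ 5 + K-prefactor m * h ∎)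
    where
    open ≤-Reasoning
    α = a (suc m)
    p = P (τ m)
    ϖ = 4leibniz k
    N = fromℕ (suc m)
    h = inv k
    0≤ϖ : 0ℚ ≤ ϖ
    0≤ϖ = proj₁ (4leibniz-bounds k)
    0≤N : 0ℚ ≤ N
    0≤N = 0≤fromℕ (suc m)
    u-error : ∣ u * u - ϖ ∣ ≤ K-sqrt (fromℤ (+ 4)) * h
    u-error = error √π 0≤ϖ (proj₂ (4leibniz-bounds k))
    s-error : ∣ s * s - N ∣ ≤ K-sqrt N * h
    s-error = error √n 0≤N ≤-refl
    inner : ∣ s * s * (u * u - ϖ) + ϖ * (s * s - N) ∣ ≤ N * (K-sqrt (fromℤ (+ 4)) * h) + fromℤ (+ 4) * (K-sqrt N * h)
    inner = ≤-trans (∣p+q∣≤∣p∣+∣q∣ (s * s * (u * u - ϖ)) (ϖ * (s * s - N))) (+-mono-≤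
      (≤-trans (≤-reflexive (∣*∣ {u * u - ϖ} (*-nonNeg (0≤root √n) (0≤root √n)))) (*-mono-≤₀ 0≤N (0≤∣p∣ (u * u - ϖ)) (root²≤ √n) u-error))
      (≤-trans (≤-reflexive (∣*∣ {s * s - N} 0≤ϖ)) (*-mono-≤₀ (0≤fromℕ 4) (0≤∣p∣ (s * s - N)) (proj₂ (4leibniz-bounds k)) s-error)))
    first : ∣ α ^ 2 * (s * s * (u * u - ϖ) + ϖ * (s * s - N)) ∣ ≤ N * (K-sqrt (fromℤ (+ 4)) * h) + fromℤ (+ 4) * (K-sqrt N * h)
    first = begin
      ∣ α ^ 2 * d ∣   ≡⟨ ∣*∣ {d} (^-nonNeg 2 (<⇒≤ (0<a (suc m)))) ⟩
      α ^ 2 * ∣ d ∣   ≤⟨ *-mono-≤₀ 0≤1 (0≤∣p∣ d) (^≤1 2 (<⇒≤ (0<a (suc m))) (a≤1 (suc m))) inner ⟩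
      1ℚ * (N * (K-sqrt (fromℤ (+ 4)) * h) + fromℤ (+ 4) * (K-sqrt N * h)) ≡⟨ *-identityˡ _ ⟩
      N * (K-sqrt (fromℤ (+ 4)) * h) + fromℤ (+ 4) * (K-sqrt N * h) ∎
      where d = s * s * (u * u - ϖ) + ϖ * (s * s - N)

  -- The coefficients c₁ to c₄ in terms of y.

  1ℚ≢0 : 1ℚ ≢ 0ℚ
  1ℚ≢0 ()

  recip-unique : ∀ x i → x * i ≡ 1ℚ → recip x ≡ i
  recip-unique x i xi = using₂ (recip x) (sym xi) i (*-recip x≢0)
    (solve 3 (λ x i r → r := i :+ r :* (# 1 :- x :* i) :+ i :* (x :* r :- # 1)) refl x i (recip x))
    where
    x≢0 : x ≢ 0ℚ
    x≢0 refl = 1ℚ≢0 (trans (sym xi) (*-zeroˡ i))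

  ^-inverse : ∀ x i n → x * i ≡ 1ℚ → x ^ n * i ^ n ≡ 1ℚ
  ^-inverse x i n xi = trans (sym (^-distrib x i n)) (trans (cong (_^ n) xi) (1^ n))

  -- The numerators are invariant under q ↦ 1 - q and hence polynomials in d² = (2q-1)². Multiplied
  -- by yⁱ they are homogeneous in y d² and y, and y d² = 1 leaves a polynomial in y. The powers of
  -- 16 from 1/n = 16τ cancel the denominators of the rational prefactors.
  module Coefficient (q y : ℚ) (yd² : y * (fromℤ (+ 2) * q - 1ℚ) ^ 2 ≡ 1ℚ) (m : ℕ) where

    private
      d t : ℚ
      d = fromℤ (+ 2) * q - 1ℚ
      t = τ m

      H : List ℤ → ℚ → ℚ
      H cs x = ⟦ homogeneous (var zero) (var (suc zero)) (coefficients cs) ⟧ (x ∷ y ∷ [])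

      C : List ℤ → ℚ
      C cs = ⟦ horner (var zero) (coefficients cs) ⟧ (y ∷ [])

      recip-n^ : ∀ i → recip (fromℕ (suc m) ^ i) ≡ (fromℤ (+ 16) * t) ^ i
      recip-n^ i = trans (recip-unique (fromℕ (suc m) ^ i) (inv m ^ i) (^-inverse (fromℕ (suc m)) (inv m) i (fromℕ*inv m)))
        (cong (_^ i) (inv≡16τ m))

      recip-d^ : ∀ D i → D ≡ (d ^ 2) ^ i → recip D ≡ y ^ i
      recip-d^ D i eq = recip-unique D (y ^ i)
        (trans (cong (_* y ^ i) eq) (^-inverse (d ^ 2) y i (trans (*-comm (d ^ 2) y) yd²)))

    coefficient₁ : (fromℤ (+ 12) * q ^ 2 - fromℤ (+ 12) * q - 1ℚ) * recip (fromℤ (+ 8) * d ^ 2) * recip (fromℕ (suc m) ^ 1)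
                   ≡ t * C (+ 6 ∷ ℤ.- + 8 ∷ [])
    coefficient₁ = begin
      num * recip (fromℤ (+ 8) * d ^ 2) * recip (fromℕ (suc m) ^ 1)
        ≡⟨ cong₂ (λ x r → num * x * r) (recip-unique (fromℤ (+ 8) * d ^ 2) (h * y) (trans
             (solve 4 (λ e D h y → e :* D :* (h :* y) := e :* h :* (y :* D)) refl (fromℤ (+ 8)) (d ^ 2) h y)
             (cong₂ _*_ 8h yd²))) (recip-n^ 1) ⟩
      num * (h * y) * (fromℤ (+ 16) * t) ^ 1
        ≡⟨ using₂ (fromℤ (+ 2) * num * y * t) 8h (fromℤ (+ 6) * t) yd²
             (solve 4 (λ q y h t → (# 12 :* q :^ 2 :- # 12 :* q :- # 1) :* (h :* y) :* (# 16 :* t) :^ 1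
               := t :* horner y (coefficients (+ 6 ∷ ℤ.- + 8 ∷ []))
                  :+ # 2 :* (# 12 :* q :^ 2 :- # 12 :* q :- # 1) :* y :* t :* (# 8 :* h :- # 1)
                  :+ # 6 :* t :* (y :* (# 2 :* q :- # 1) :^ 2 :- # 1))
               refl q y h t) ⟩
      t * C (+ 6 ∷ ℤ.- + 8 ∷ []) ∎
      where
      open ≡-Reasoning
      h = inv 7
      8h : fromℤ (+ 8) * h ≡ 1ℚ
      8h = refl
      num = fromℤ (+ 12) * q ^ 2 - fromℤ (+ 12) * q - 1ℚ

    coefficient₂ : + 1 / 128 * ((fromℤ (+ 400) * q ^ 4 - fromℤ (+ 800) * q ^ 3 + fromℤ (+ 120) * q ^ 2 + fromℤ (+ 280) * q + 1ℚ)
                     * recip (d ^ 4)) * recip (fromℕ (suc m) ^ 2)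
                   ≡ t ^ 2 * C (+ 50 ∷ ℤ.- + 240 ∷ + 192 ∷ [])
    coefficient₂ = begin
      h * (num * recip (d ^ 4)) * recip (fromℕ (suc m) ^ 2)
        ≡⟨ cong₂ (λ x r → h * (num * x) * r)
             (recip-d^ (d ^ 4) 2 (solve 1 (λ d → d :^ 4 := (d :^ 2) :^ 2) refl d)) (recip-n^ 2) ⟩
      h * (num * y ^ 2) * (fromℤ (+ 16) * t) ^ 2
        ≡⟨ cong (λ x → h * x * (fromℤ (+ 16) * t) ^ 2) (trans
             (solve 2 (λ q y → (# 400 :* q :^ 4 :- # 800 :* q :^ 3 :+ # 120 :* q :^ 2 :+ # 280 :* q :+ # 1) :* y :^ 2
                := homogeneous (y :* (# 2 :* q :- # 1) :^ 2) y (coefficients (+ 25 ∷ ℤ.- + 120 ∷ + 96 ∷ []))) refl q y)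
             (cong (H (+ 25 ∷ ℤ.- + 120 ∷ + 96 ∷ [])) yd²)) ⟩
      h * H (+ 25 ∷ ℤ.- + 120 ∷ + 96 ∷ []) 1ℚ * (fromℤ (+ 16) * t) ^ 2
        ≡⟨ using₁ (fromℤ (+ 2) * t ^ 2 * H (+ 25 ∷ ℤ.- + 120 ∷ + 96 ∷ []) 1ℚ) h-value
             (solve 3 (λ y h t → h :* homogeneous (# 1) y (coefficients (+ 25 ∷ ℤ.- + 120 ∷ + 96 ∷ [])) :* (# 16 :* t) :^ 2
               := t :^ 2 :* horner y (coefficients (+ 50 ∷ ℤ.- + 240 ∷ + 192 ∷ []))
                  :+ # 2 :* t :^ 2 :* homogeneous (# 1) y (coefficients (+ 25 ∷ ℤ.- + 120 ∷ + 96 ∷ [])) :* (# 128 :* h :- # 1)) refl y h t) ⟩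
      t ^ 2 * C (+ 50 ∷ ℤ.- + 240 ∷ + 192 ∷ []) ∎
      where
      open ≡-Reasoning
      h = + 1 / 128
      h-value : fromℤ (+ 128) * h ≡ fromℤ (+ 1)
      h-value = refl
      num = fromℤ (+ 400) * q ^ 4 - fromℤ (+ 800) * q ^ 3 + fromℤ (+ 120) * q ^ 2 + fromℤ (+ 280) * q + 1ℚ

    coefficient₃ : + 5 / 1024 * ((fromℤ (+ 1344) * q ^ 6 - fromℤ (+ 4032) * q ^ 5 + fromℤ (+ 112) * q ^ 4 + fromℤ (+ 6496) * q ^ 3 - fromℤ (+ 3444) * q ^ 2 - fromℤ (+ 476) * q + 1ℚ)
                     * recip (d ^ 6)) * recip (fromℕ (suc m) ^ 3)
                   ≡ t ^ 3 * C (+ 420 ∷ ℤ.- + 6160 ∷ + 13440 ∷ ℤ.- + 7680 ∷ [])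
    coefficient₃ = begin
      h * (num * recip (d ^ 6)) * recip (fromℕ (suc m) ^ 3)
        ≡⟨ cong₂ (λ x r → h * (num * x) * r)
             (recip-d^ (d ^ 6) 3 (solve 1 (λ d → d :^ 6 := (d :^ 2) :^ 3) refl d)) (recip-n^ 3) ⟩
      h * (num * y ^ 3) * (fromℤ (+ 16) * t) ^ 3
        ≡⟨ cong (λ x → h * x * (fromℤ (+ 16) * t) ^ 3) (trans
             (solve 2 (λ q y → (# 1344 :* q :^ 6 :- # 4032 :* q :^ 5 :+ # 112 :* q :^ 4 :+ # 6496 :* q :^ 3 :- # 3444 :* q :^ 2 :- # 476 :* q :+ # 1) :* y :^ 3
                := homogeneous (y :* (# 2 :* q :- # 1) :^ 2) y (coefficients (+ 21 ∷ ℤ.- + 308 ∷ + 672 ∷ ℤ.- + 384 ∷ []))) refl q y)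
             (cong (H (+ 21 ∷ ℤ.- + 308 ∷ + 672 ∷ ℤ.- + 384 ∷ [])) yd²)) ⟩
      h * H (+ 21 ∷ ℤ.- + 308 ∷ + 672 ∷ ℤ.- + 384 ∷ []) 1ℚ * (fromℤ (+ 16) * t) ^ 3
        ≡⟨ using₁ (fromℤ (+ 4) * t ^ 3 * H (+ 21 ∷ ℤ.- + 308 ∷ + 672 ∷ ℤ.- + 384 ∷ []) 1ℚ) h-value
             (solve 3 (λ y h t → h :* homogeneous (# 1) y (coefficients (+ 21 ∷ ℤ.- + 308 ∷ + 672 ∷ ℤ.- + 384 ∷ [])) :* (# 16 :* t) :^ 3
               := t :^ 3 :* horner y (coefficients (+ 420 ∷ ℤ.- + 6160 ∷ + 13440 ∷ ℤ.- + 7680 ∷ []))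
                  :+ # 4 :* t :^ 3 :* homogeneous (# 1) y (coefficients (+ 21 ∷ ℤ.- + 308 ∷ + 672 ∷ ℤ.- + 384 ∷ [])) :* (# 1024 :* h :- # 5)) refl y h t) ⟩
      t ^ 3 * C (+ 420 ∷ ℤ.- + 6160 ∷ + 13440 ∷ ℤ.- + 7680 ∷ []) ∎
      where
      open ≡-Reasoning
      h = + 5 / 1024
      h-value : fromℤ (+ 1024) * h ≡ fromℤ (+ 5)
      h-value = refl
      num = fromℤ (+ 1344) * q ^ 6 - fromℤ (+ 4032) * q ^ 5 + fromℤ (+ 112) * q ^ 4 + fromℤ (+ 6496) * q ^ 3 - fromℤ (+ 3444) * q ^ 2 - fromℤ (+ 476) * q + 1ℚ

    coefficient₄ : + 21 / 32768 * ((fromℤ (+ 20224) * q ^ 8 - fromℤ (+ 80896) * q ^ 7 - fromℤ (+ 88832) * q ^ 6 + fromℤ (+ 549632) * q ^ 5 - fromℤ (+ 514400) * q ^ 4 + fromℤ (+ 18368) * q ^ 3 + fromℤ (+ 92368) * q ^ 2 + fromℤ (+ 3536) * q - 1ℚ)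
                     * recip (d ^ 8)) * recip (fromℕ (suc m) ^ 4)
                   ≡ t ^ 4 * C (+ 3318 ∷ ℤ.- + 151200 ∷ + 685440 ∷ ℤ.- + 967680 ∷ + 430080 ∷ [])
    coefficient₄ = begin
      h * (num * recip (d ^ 8)) * recip (fromℕ (suc m) ^ 4)
        ≡⟨ cong₂ (λ x r → h * (num * x) * r)
             (recip-d^ (d ^ 8) 4 (solve 1 (λ d → d :^ 8 := (d :^ 2) :^ 4) refl d)) (recip-n^ 4) ⟩
      h * (num * y ^ 4) * (fromℤ (+ 16) * t) ^ 4
        ≡⟨ cong (λ x → h * x * (fromℤ (+ 16) * t) ^ 4) (trans
             (solve 2 (λ q y → (# 20224 :* q :^ 8 :- # 80896 :* q :^ 7 :- # 88832 :* q :^ 6 :+ # 549632 :* q :^ 5 :- # 514400 :* q :^ 4 :+ # 18368 :* q :^ 3 :+ # 92368 :* q :^ 2 :+ # 3536 :* q :- # 1) :* y :^ 4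
                := homogeneous (y :* (# 2 :* q :- # 1) :^ 2) y (coefficients (+ 79 ∷ ℤ.- + 3600 ∷ + 16320 ∷ ℤ.- + 23040 ∷ + 10240 ∷ []))) refl q y)
             (cong (H (+ 79 ∷ ℤ.- + 3600 ∷ + 16320 ∷ ℤ.- + 23040 ∷ + 10240 ∷ [])) yd²)) ⟩
      h * H (+ 79 ∷ ℤ.- + 3600 ∷ + 16320 ∷ ℤ.- + 23040 ∷ + 10240 ∷ []) 1ℚ * (fromℤ (+ 16) * t) ^ 4
        ≡⟨ using₁ (fromℤ (+ 2) * t ^ 4 * H (+ 79 ∷ ℤ.- + 3600 ∷ + 16320 ∷ ℤ.- + 23040 ∷ + 10240 ∷ []) 1ℚ) h-value
             (solve 3 (λ y h t → h :* homogeneous (# 1) y (coefficients (+ 79 ∷ ℤ.- + 3600 ∷ + 16320 ∷ ℤ.- + 23040 ∷ + 10240 ∷ [])) :* (# 16 :* t) :^ 4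
               := t :^ 4 :* horner y (coefficients (+ 3318 ∷ ℤ.- + 151200 ∷ + 685440 ∷ ℤ.- + 967680 ∷ + 430080 ∷ []))
                  :+ # 2 :* t :^ 4 :* homogeneous (# 1) y (coefficients (+ 79 ∷ ℤ.- + 3600 ∷ + 16320 ∷ ℤ.- + 23040 ∷ + 10240 ∷ [])) :* (# 32768 :* h :- # 21)) refl y h t) ⟩
      t ^ 4 * C (+ 3318 ∷ ℤ.- + 151200 ∷ + 685440 ∷ ℤ.- + 967680 ∷ + 430080 ∷ []) ∎
      where
      open ≡-Reasoning
      h = + 21 / 32768
      h-value : fromℤ (+ 32768) * h ≡ fromℤ (+ 21)
      h-value = refl
      num = fromℤ (+ 20224) * q ^ 8 - fromℤ (+ 80896) * q ^ 7 - fromℤ (+ 88832) * q ^ 6 + fromℤ (+ 549632) * q ^ 5 - fromℤ (+ 514400) * q ^ 4 + fromℤ (+ 18368) * q ^ 3 + fromℤ (+ 92368) * q ^ 2 + fromℤ (+ 3536) * q - 1ℚ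

    S-coefficients : S t y ≡ 1ℚ + t * C (+ 6 ∷ ℤ.- + 8 ∷ []) + t ^ 2 * C (+ 50 ∷ ℤ.- + 240 ∷ + 192 ∷ [])
      + t ^ 3 * C (+ 420 ∷ ℤ.- + 6160 ∷ + 13440 ∷ ℤ.- + 7680 ∷ [])
      + t ^ 4 * C (+ 3318 ∷ ℤ.- + 151200 ∷ + 685440 ∷ ℤ.- + 967680 ∷ + 430080 ∷ [])
    S-coefficients = solve 2 (λ t y → horner t (s-coefficients y)
      := # 1 :+ t :* horner y (coefficients (+ 6 ∷ ℤ.- + 8 ∷ []))
         :+ t :^ 2 :* horner y (coefficients (+ 50 ∷ ℤ.- + 240 ∷ + 192 ∷ []))
         :+ t :^ 3 :* horner y (coefficients (+ 420 ∷ ℤ.- + 6160 ∷ + 13440 ∷ ℤ.- + 7680 ∷ []))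
         :+ t :^ 4 :* horner y (coefficients (+ 3318 ∷ ℤ.- + 151200 ∷ + 685440 ∷ ℤ.- + 967680 ∷ + 430080 ∷ []))) refl t y

  -- The complete estimate on rational terms.

  K-total : ℚ → ℚ
  K-total Y = K-remainder Y + K-error Y * (fromℤ (+ 2) * K-wallis)

  K-rate : ℕ → ℚ → ℚ
  K-rate m Y = K-error Y * (fromℤ (+ 2) * K-prefactor m)

  total-bound : ∀ {p q y Y m k u s i} → p + q ≡ 1ℚ → 0ℚ ≤ q → 0ℚ < p - q →
    y * (p - q) ^ 2 ≡ 1ℚ → 0ℚ ≤ y → y ≤ Y → z p q ^ suc m * i ≡ 1ℚ → m ℕ.≤ k →
    ApproximateSqrt k (4leibniz k) u → ApproximateSqrt k (fromℕ (suc m)) s →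
    ∣ Rℚ m p q * (u * (p - q)) * s * i - S (τ m) y ∣ ≤ K-total Y * τ m ^ 5 + K-rate m Y * inv k
  total-bound {p} {q} {y} {Y} {m} {k} {u} {s} {i} p+q 0≤q 0<e ye² 0≤y y≤Y Zi m≤k √π √n = begin
    ∣ Rℚ m p q * (u * (p - q)) * s * i - S (τ m) y ∣
      ≤⟨ Remainder.remainder-bound p q y Y p+q 0≤q 0<e ye² 0≤y y≤Y m Zi (0≤root √π) (0≤root √n)
           (prefactor-near m≤k √π √n) ⟩
    K-remainder Y * τ m ^ 5 + K-error Y * (fromℤ (+ 2) * (K-wallis * τ m ^ 5 + K-prefactor m * inv k))
      ≡⟨ solve 6 (λ A B W T C h → A :* T :+ B :* (# 2 :* (W :* T :+ C :* h))
           := (A :+ B :* (# 2 :* W)) :* T :+ B :* (# 2 :* C) :* h) refl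
           (K-remainder Y) (K-error Y) K-wallis (τ m ^ 5) (K-prefactor m) (inv k) ⟩
    K-total Y * τ m ^ 5 + K-rate m Y * inv k ∎
    where open ≤-Reasoning

  bracket : ∀ {q y} m → y * (fromℤ (+ 2) * q - 1ℚ) ^ 2 ≡ 1ℚ → let d = fromℤ (+ 2) * q - 1ℚ in
    1ℚ + (fromℤ (+ 12) * q ^ 2 - fromℤ (+ 12) * q - 1ℚ) * recip (fromℤ (+ 8) * d ^ 2) * recip (fromℕ (suc m) ^ 1)
       + + 1 / 128 * ((fromℤ (+ 400) * q ^ 4 - fromℤ (+ 800) * q ^ 3 + fromℤ (+ 120) * q ^ 2 + fromℤ (+ 280) * q + 1ℚ)
           * recip (d ^ 4)) * recip (fromℕ (suc m) ^ 2)
       + + 5 / 1024 * ((fromℤ (+ 1344) * q ^ 6 - fromℤ (+ 4032) * q ^ 5 + fromℤ (+ 112) * q ^ 4 + fromℤ (+ 6496) * q ^ 3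
           - fromℤ (+ 3444) * q ^ 2 - fromℤ (+ 476) * q + 1ℚ) * recip (d ^ 6)) * recip (fromℕ (suc m) ^ 3)
       + + 21 / 32768 * ((fromℤ (+ 20224) * q ^ 8 - fromℤ (+ 80896) * q ^ 7 - fromℤ (+ 88832) * q ^ 6 + fromℤ (+ 549632) * q ^ 5
           - fromℤ (+ 514400) * q ^ 4 + fromℤ (+ 18368) * q ^ 3 + fromℤ (+ 92368) * q ^ 2 + fromℤ (+ 3536) * q - 1ℚ)
           * recip (d ^ 8)) * recip (fromℕ (suc m) ^ 4)
    ≡ S (τ m) y
  bracket {q} {y} m yd² = trans
    (cong₂ _+_ (cong₂ _+_ (cong₂ _+_ (cong (λ x → 1ℚ + x) coefficient₁) coefficient₂) coefficient₃) coefficient₄)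
    (sym S-coefficients)
    where open Coefficient q y yd² m

  Σ<-head : ∀ n (f : ℕ → ℚ) → Σ< (suc n) f ≡ f 0 + Σ< n (λ k → f (suc k))
  Σ<-head zero    f = +-comm 0ℚ (f 0)
  Σ<-head (suc n) f = trans (cong (_+ f (suc n)) (Σ<-head n f))
    (+-assoc (f 0) (Σ< n (λ k → f (suc k))) (f (suc n)))

  inverse-anti : ∀ {η e y Y} → 0ℚ < η → η ≤ e → 0ℚ ≤ y → e ^ 2 * y ≡ 1ℚ → η ^ 2 * Y ≡ 1ℚ → y ≤ Y
  inverse-anti {η} {e} {y} {Y} 0<η η≤e 0≤y ey ηY = *-cancelˡ-≤ (^-pos 2 0<η) (begin
    η ^ 2 * y   ≤⟨ *-monoʳ 0≤y (^-mono 2 (<⇒≤ 0<η) η≤e) ⟩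
    e ^ 2 * y   ≡⟨ trans ey (sym ηY) ⟩
    η ^ 2 * Y   ∎)
    where open ≤-Reasoning

  τ⁵≤inv⁵ : ∀ m → τ m ^ 5 ≤ recip (fromℕ (suc m) ^ 5)
  τ⁵≤inv⁵ m = subst (τ m ^ 5 ≤_)
    (sym (recip-unique (fromℕ (suc m) ^ 5) (inv m ^ 5) (^-inverse (fromℕ (suc m)) (inv m) 5 (fromℕ*inv m))))
    (^-mono 5 (0≤τ m) (τ≤inv m))

  prefactor-cancel : ∀ R Z D s b → Z ≢ 0ℚ → D ≢ 0ℚ → s ≢ 0ℚ →
    R ≡ Z * recip D * (1ℚ * recip s) * (b + (R * D * s * (1ℚ * recip Z) - b))
  prefactor-cancel R Z D s b Z≢0 D≢0 s≢0 = using₂ (- (R * (D * recip D) * (s * recip s))) (*-recip Z≢0)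
    (- (R * (s * recip s))) (*-recip D≢0) (using₁ (- R) (*-recip s≢0)
    (solve 8 (λ R Z D s b z d r → R := Z :* d :* (# 1 :* r) :* (b :+ (R :* D :* s :* (# 1 :* z) :- b))
       :+ :- (R :* (D :* d) :* (s :* r)) :* (Z :* z :- # 1) :+ :- (R :* (s :* r)) :* (D :* d :- # 1) :+ (:- R) :* (s :* r :- # 1))
     refl R Z D s b (recip Z) (recip D) (recip s)))

  -- The gap ε between x and ½ gives 1 - 2x > 2ε. Hence y = 1/(1-2x)² exists and is at most Y =
  -- 1/(2ε)², which does not depend on x.
  remainder-at : ∀ {x ε Y i u s} m k → 0ℚ < ε → (ε + ε) ^ 2 * Y ≡ 1ℚ → 0ℚ < x → x + ε < ½ → m ℕ.≤ k →
    z (1ℚ - x) x ^ suc m * i ≡ 1ℚ → ApproximateSqrt k (4leibniz k) u → ApproximateSqrt k (fromℕ (suc m)) s →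
    ∃[ y ] y * (1ℚ - x - x) ^ 2 ≡ 1ℚ ×
    ∣ Rℚ m (1ℚ - x) x * (u * (1ℚ - x - x)) * s * i - S (τ m) y ∣ ≤ K-total Y * τ m ^ 5 + K-rate m Y * inv k
  remainder-at {x} {ε} {Y} {i} {u} {s} m k 0<ε ηY 0<x x+ε<½ m≤k Zi √π √n = y , ye² ,
    total-bound {1ℚ - x} {x} {y} {Y} {m} {k} {u} {s} {i} p+x (<⇒≤ 0<x) 0<e ye² (<⇒≤ 0<y)
      (inverse-anti {η} {e} {y} {Y} 0<η (<⇒≤ η<e) (<⇒≤ 0<y) e²y ηY) Zi m≤k √π √n
    where
    e η : ℚ
    e = 1ℚ - x - x
    η = ε + ε
    0<η : 0ℚ < η
    0<η = +-pos 0<ε 0<ε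
    p+x : 1ℚ - x + x ≡ 1ℚ
    p+x = solve 1 (λ x → # 1 :- x :+ x := # 1) refl x
    η<e : η < e
    η<e = subst₂ _<_
      (solve 2 (λ x ε → x :+ ε :+ (x :+ ε) :- (x :+ x) := ε :+ ε) refl x ε)
      (solve 1 (λ x → # 1 :- (x :+ x) := # 1 :- x :- x) refl x)
      (+-monoˡ-< (- (x + x)) (+-mono-< x+ε<½ x+ε<½))
    0<e : 0ℚ < e
    0<e = <-trans 0<η η<e
    inverse : ∃[ y ] 0ℚ < y × e ^ 2 * y ≡ 1ℚ
    inverse = divide (positive⁻¹ 1ℚ) (^-pos 2 0<e)
    y : ℚ
    y = proj₁ inverse
    0<y : 0ℚ < y
    0<y = proj₁ (proj₂ inverse)
    e²y : e ^ 2 * y ≡ 1ℚ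
    e²y = proj₂ (proj₂ inverse)
    ye² : y * e ^ 2 ≡ 1ℚ
    ye² = trans (*-comm y (e ^ 2)) e²y

  z^≢0 : ∀ {x ε} n → 0ℚ < ε → 0ℚ < x → x + ε < ½ → z (1ℚ - x) x ^ n ≢ 0ℚ
  z^≢0 {x} {ε} n 0<ε 0<x x+ε<½ eq = <-irrefl (sym eq) (^-pos n (*-pos (0<frac 3 0) (*-pos 0<1-x 0<x)))
    where
    x<½ : x < ½
    x<½ = <-trans (subst (_< x + ε) (+-identityʳ x) (+-monoʳ-< x 0<ε)) x+ε<½
    0<1-x : 0ℚ < 1ℚ - x
    0<1-x = <-trans 0<½ (+-monoʳ-< 1ℚ (neg-antimono-< x<½))

-- Passage from rational terms to real numbers.

open import Defs
open import Data.Nat as ℕ using (ℕ; zero; suc)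
open import Data.Rational using (½)
open import Data.Product using (∃-syntax; _×_)
open import Data.Fin using (Fin; zero; suc; toℕ)
open import Data.Nat.Combinatorics using () renaming (_C_ to _choose_)
import Data.Nat.Properties as ℕₚ
open import Data.Product using (_,_; proj₁; proj₂)
open import Data.Rational as ℚ using (ℚ; 0ℚ; 1ℚ)
import Data.Rational.Properties as ℚₚ
open import Relation.Binary.PropositionalEquality
import Algebra.Definitions.RawSemiring ℚ.+-*-rawSemiring as ℚ^
open Estimates using (#_; fromℕ; inv; Σ<; Rℚ; τ; 4leibniz; K-total; K-rate)
open Estimates.Solver using (solve; _:=_; _:*_; _:+_; _:-_; _:^_)
open CauchyOperations using (sqrtℚ; recip; *-recip)
open Rational using (p≤∣p∣; divide; +-pos)

ΣFin : ∀ {n} → (Fin n → ℚ) → ℚ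
ΣFin = ℚ^.sum

seq-^ : ∀ x n k → seq (x ^ n) k ≡ seq x k ℚ^.^ n
seq-^ x zero    k = refl
seq-^ x (suc n) k = cong (seq x k ℚ.*_) (seq-^ x n k)

seq-sum : ∀ {n} (f : Fin n → ℝ) k → seq (sum f) k ≡ ΣFin (λ i → seq (f i) k)
seq-sum {zero}  f k = refl
seq-sum {suc n} f k = cong (λ x → seq (f zero) k ℚ.+ x) (seq-sum (λ i → f (suc i)) k)

ΣFin≡Σ< : ∀ n {f : Fin n → ℚ} {g : ℕ → ℚ} → (∀ i → f i ≡ g (toℕ i)) → ΣFin f ≡ Σ< n g
ΣFin≡Σ< zero    eq = refl
ΣFin≡Σ< (suc n) {f} {g} eq = trans (cong₂ ℚ._+_ (eq zero) (ΣFin≡Σ< n (λ i → eq (suc i))))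
  (sym (Estimates.Σ<-head n g))

partial : (c : ℕ → ℕ) (n : ℕ) (p q : ℚ) → ℚ
partial c n p q = p ℚ^.^ n ℚ.* Σ< n (λ j → fromℕ (c j) ℚ.* q ℚ^.^ j)

Rℚ-with : (c : ℕ → ℕ) (n : ℕ) (p q : ℚ) → ℚ
Rℚ-with c n p q = 1ℚ ℚ.- partial c n p q ℚ.+ partial c n q p

-- The underscores keep conversion checking at ℚ: comparing reals also compares their Cauchy proofs.
seq-R : ∀ q n k → seq (R q n) k ≡ Rℚ-with (λ j → (n ℕ.+ j ℕ.∸ 1) choose j) n (1ℚ ℚ.- seq q k) (seq q k)
seq-R q n k = cong₂ (λ x y → 1ℚ ℚ.- x ℚ.+ y)
  (cong₂ ℚ._*_ (seq-^ _ n k) (trans (seq-sum {n} _ k)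
    (ΣFin≡Σ< n (λ i → cong (fromℕ (c (toℕ i)) ℚ.*_) (seq-^ q (toℕ i) k)))))
  (cong₂ ℚ._*_ (seq-^ _ n k) (trans (seq-sum {n} _ k)
    (ΣFin≡Σ< n (λ i → cong (fromℕ (c (toℕ i)) ℚ.*_) (seq-^ (ι 1 - q) (toℕ i) k)))))
  where
  c : ℕ → ℕ
  c j = (n ℕ.+ j ℕ.∸ 1) choose j

apart⇒≢0 : ∀ {a p} → 0ℚ ℚ.< a → a ℚ.≤ ℚ.∣ p ∣ → p ≢ 0ℚ
apart⇒≢0 0<a a≤∣p∣ refl = ℚₚ.<-irrefl refl (ℚₚ.<-≤-trans 0<a a≤∣p∣)

-- The relative error obtained by solving the asserted expansion for it. The expansion is then an
-- exact equation, and the whole content lies in the bound for this quantity.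
remainder : (X Z D s b : ℝ) → NonZero Z → ℝ
remainder X Z D s b Z≠0 = X * D * s * (ι 1 / Z [ Z≠0 ]) - b

-- The total `recip` is an inverse only where the term is nonzero, so the cancellation is valid from
-- the index on at which all three denominators are apart from 0.
remainder-≈ : ∀ X Z D s b Z≠0 D≠0 s≠0 →
  X ≈ Z / D [ D≠0 ] * (ι 1 / s [ s≠0 ]) * (b + remainder X Z D s b Z≠0)
remainder-≈ X Z D s b (a₁ , 0<a₁ , N₁ , h₁) (a₂ , 0<a₂ , N₂ , h₂) (a₃ , 0<a₃ , N₃ , h₃) ε 0<ε =
  N₁ ℕ.⊔ (N₂ ℕ.⊔ N₃) , λ k N≤k →
    let N₂₃≤k = ℕₚ.m⊔n≤o⇒n≤o N₁ (N₂ ℕ.⊔ N₃) N≤k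
        eq = Estimates.prefactor-cancel (seq X k) (seq Z k) (seq D k) (seq s k) (seq b k)
               (apart⇒≢0 0<a₁ (h₁ k (ℕₚ.m⊔n≤o⇒m≤o N₁ (N₂ ℕ.⊔ N₃) N≤k)))
               (apart⇒≢0 0<a₂ (h₂ k (ℕₚ.m⊔n≤o⇒m≤o N₂ N₃ N₂₃≤k)))
               (apart⇒≢0 0<a₃ (h₃ k (ℕₚ.m⊔n≤o⇒n≤o N₂ N₃ N₂₃≤k)))
    in subst (λ x → ℚ.∣ seq X k ℚ.- x ∣ ℚ.< ε) eq
         (subst (ℚ._< ε) (cong ℚ.∣_∣ (sym (ℚₚ.+-inverseʳ (seq X k)))) 0<ε)

seq-remainder : ∀ X Z D s b Z≠0 k {X′ D′ s′ b′} → seq X k ≡ X′ → seq D k ≡ D′ → seq s k ≡ s′ → seq b k ≡ b′ →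
  seq (remainder X Z D s b Z≠0) k ≡ X′ ℚ.* D′ ℚ.* s′ ℚ.* recip (seq Z k) ℚ.- b′
seq-remainder X Z D s b Z≠0 k refl refl refl refl =
  cong (λ i → seq X k ℚ.* seq D k ℚ.* seq s k ℚ.* i ℚ.- seq b k) (ℚₚ.*-identityˡ (recip (seq Z k)))

seq-* : ∀ x y k → seq (x * y) k ≡ seq x k ℚ.* seq y k
seq-* x y k = refl

seq-sqrt : ∀ x k → seq (sqrt x) k ≡ sqrtℚ k (seq x k)
seq-sqrt x k = refl

≤-from-terms : ∀ (x y : ℝ) K → (∀ ε → 0ℚ ℚ.< ε → Eventually λ k → ℚ.∣ seq x k ∣ ℚ.< K ℚ.* ℚ.∣ seq y k ∣ ℚ.+ ε) →
               ∣ x ∣ ≤ fromℚ K * ∣ y ∣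
≤-from-terms x y K h = h

module Asymptotics (q : ℝ) (0<q : ι 0 < q) (q<½ : q < fromℚ ½) where

  open Coefficients q q<½

  z : ℝ
  z = ι 4 * q * (ι 1 - q)

  0<1-q : ι 0 < ι 1 - q
  0<1-q = let (ε , 0<ε , N , h) = q<½ in ½ , Rational.0<½ , N , λ k N≤k →
    ℚₚ.+-monoʳ-< 1ℚ (ℚₚ.neg-antimono-< (ℚₚ.<-trans (seq<seq+ε (seq q k) 0<ε) (h k N≤k)))
    where
    seq<seq+ε : ∀ x {ε} → 0ℚ ℚ.< ε → x ℚ.< x ℚ.+ ε
    seq<seq+ε x {ε} 0<ε = subst (ℚ._< x ℚ.+ ε) (ℚₚ.+-identityʳ x) (ℚₚ.+-monoʳ-< x 0<ε)

  z^_≠0 : ∀ n → NonZero (z ^ n)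
  z^ n ≠0 = ^-nonZero {z} n (*-nonZero {ι 4 * q} {ι 1 - q}
    (*-nonZero {ι 4} {q} (ι-nonZero 4) (>0⇒nonZero {q} 0<q)) (>0⇒nonZero {ι 1 - q} 0<1-q))

  expansion : (n : ℕ) .{{_ : ℕ.NonZero n}} → ℝ
  expansion n = ι 1 + c₁ /[ n ^ 1 ] + c₂ /[ n ^ 2 ] + c₃ /[ n ^ 3 ] + c₄ /[ n ^ 4 ]

  r : Sequence
  r n = remainder (R q n) (z ^ n) (sqrt π * (ι 1 - ι 2 * q)) (sqrt (ι n)) (expansion n) (z^ n ≠0)

  r-≈ : ∀ n .{{_ : ℕ.NonZero n}} →
        R q n ≈ (ι 4 * q * (ι 1 - q)) ^ n / (sqrt π * (ι 1 - ι 2 * q)) [ √π[1-2q]≠0 ]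
                * (ι 1 / sqrt (ι n) [ √n≠0 n ])
                * (ι 1 + c₁ /[ n ^ 1 ] + c₂ /[ n ^ 2 ] + c₃ /[ n ^ 3 ] + c₄ /[ n ^ 4 ] + r n)
  r-≈ n = remainder-≈ (R q n) (z ^ n) (sqrt π * (ι 1 - ι 2 * q)) (sqrt (ι n)) (expansion n)
            (z^ n ≠0) √π[1-2q]≠0 (√n≠0 n)

  Y-with-property : ∃[ Y ] 0ℚ ℚ.< Y × (proj₁ q<½ ℚ.+ proj₁ q<½) ℚ^.^ 2 ℚ.* Y ≡ 1ℚ
  Y-with-property = divide (ℚₚ.positive⁻¹ 1ℚ) (Estimates.^-pos 2 (+-pos (proj₁ (proj₂ q<½)) (proj₁ (proj₂ q<½))))

  -- An upper bound for 1/(1-2q)² along the whole Cauchy sequence of q.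
  Y : ℚ
  Y = proj₁ Y-with-property

  seq-z^ : ∀ n k → seq (z ^ n) k ≡ Estimates.z (1ℚ ℚ.- seq q k) (seq q k) ℚ^.^ n
  seq-z^ n k = trans (seq-^ z n k) (cong (ℚ^._^ n)
    (solve 1 (λ x → # 4 :* x :* (# 1 :- x) := # 4 :* ((# 1 :- x) :* x)) refl (seq q k)))

  seq-D : ∀ k → seq (sqrt π * (ι 1 - ι 2 * q)) k ≡ sqrtℚ k (4leibniz k) ℚ.* (1ℚ ℚ.- seq q k ℚ.- seq q k)
  seq-D k = trans (seq-* (sqrt π) (ι 1 - ι 2 * q) k) (cong₂ ℚ._*_ (seq-sqrt π k)
    (solve 1 (λ x → # 1 :- # 2 :* x := # 1 :- x :- x) refl (seq q k)))

  seq-r : ∀ m k y → y ℚ.* (1ℚ ℚ.- seq q k ℚ.- seq q k) ℚ^.^ 2 ≡ 1ℚ →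
    seq (r (suc m)) k ≡ Rℚ m (1ℚ ℚ.- seq q k) (seq q k) ℚ.* (sqrtℚ k (4leibniz k) ℚ.* (1ℚ ℚ.- seq q k ℚ.- seq q k))
      ℚ.* sqrtℚ k (fromℕ (suc m)) ℚ.* recip (seq (z ^ suc m) k) ℚ.- Estimates.S (τ m) y
  seq-r m k y ye² = seq-remainder (R q (suc m)) (z ^ suc m) (sqrt π * (ι 1 - ι 2 * q)) (sqrt (ι (suc m))) (expansion (suc m))
    (z^ suc m ≠0) k (seq-R q (suc m) k) (seq-D k) (seq-sqrt (ι (suc m)) k) (Estimates.bracket {seq q k} {y} m (trans
      (solve 2 (λ x y → y :* (# 2 :* x :- # 1) :^ 2 := y :* (# 1 :- x :- x) :^ 2) refl (seq q k) y) ye²))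

  z^-inverse : ∀ n k → 0ℚ ℚ.< seq q k → seq q k ℚ.+ proj₁ q<½ ℚ.< ½ →
    Estimates.z (1ℚ ℚ.- seq q k) (seq q k) ℚ^.^ n ℚ.* recip (seq (z ^ n) k) ≡ 1ℚ
  z^-inverse n k 0<x x+ε<½ = trans
    (cong (λ Z → Estimates.z (1ℚ ℚ.- seq q k) (seq q k) ℚ^.^ n ℚ.* recip Z) (seq-z^ n k))
    (*-recip (Estimates.z^≢0 n (proj₁ (proj₂ q<½)) 0<x x+ε<½))

  r-bound-at : ∀ m k → m ℕ.≤ k → 0ℚ ℚ.< seq q k → seq q k ℚ.+ proj₁ q<½ ℚ.< ½ →
    ℚ.∣ seq (r (suc m)) k ∣ ℚ.≤ K-total Y ℚ.* τ m ℚ^.^ 5 ℚ.+ K-rate m Y ℚ.* inv k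
  r-bound-at m k m≤k 0<x x+ε<½ =
    let (y , ye² , bound) = Estimates.remainder-at {seq q k} {proj₁ q<½} {Y} m k (proj₁ (proj₂ q<½)) (proj₂ (proj₂ Y-with-property)) 0<x x+ε<½ m≤k
          (z^-inverse (suc m) k 0<x x+ε<½)
          (Estimates.sqrtℚ-approximate k (proj₁ (Estimates.4leibniz-bounds k))) (Estimates.sqrtℚ-approximate k (Estimates.0≤fromℕ (suc m)))
    in subst (λ t → ℚ.∣ t ∣ ℚ.≤ K-total Y ℚ.* τ m ℚ^.^ 5 ℚ.+ K-rate m Y ℚ.* inv k)
         (sym (seq-r m k y ye²)) bound

  r-O : r =O (λ n → ι 1 /[ n ^ 5 ])
  -- The bound holds for all n ≥ 1, hence the threshold 0. Only the index k of the rational terms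
  -- must be large: at least m, inside both inequalities for q, and such that the k-dependent error
  -- is below ε.
  r-O = fromℚ ℚ.∣ K-total Y ∣ , 0 , λ { (suc m) _ → ≤-from-terms (r (suc m)) (ι 1 /[ suc m ^ 5 ]) ℚ.∣ K-total Y ∣ λ ε 0<ε →
    let (ε₁ , 0<ε₁ , N₁ , h₁) = 0<q
        (_  , _    , N₂ , h₂) = q<½
        (N₃ , small) = Estimates.scaled-small (K-rate m Y) 0<ε
    in (N₁ ℕ.⊔ N₂) ℕ.⊔ (m ℕ.⊔ N₃) , λ k N≤k →
      let N₁₂≤k = ℕₚ.m⊔n≤o⇒m≤o (N₁ ℕ.⊔ N₂) (m ℕ.⊔ N₃) N≤k
          m⊔N₃≤k = ℕₚ.m⊔n≤o⇒n≤o (N₁ ℕ.⊔ N₂) (m ℕ.⊔ N₃) N≤k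
      in ℚₚ.≤-<-trans
        (r-bound-at m k (ℕₚ.m⊔n≤o⇒m≤o m N₃ m⊔N₃≤k)
          (ℚₚ.<-trans (subst (0ℚ ℚ.<_) (sym (ℚₚ.+-identityˡ ε₁)) 0<ε₁) (h₁ k (ℕₚ.m⊔n≤o⇒m≤o N₁ N₂ N₁₂≤k)))
          (h₂ k (ℕₚ.m⊔n≤o⇒n≤o N₁ N₂ N₁₂≤k)))
        (ℚₚ.+-mono-≤-< (main m k) (small k (ℕₚ.m⊔n≤o⇒n≤o m N₃ m⊔N₃≤k))) }
    where
    main : ∀ m k → K-total Y ℚ.* τ m ℚ^.^ 5 ℚ.≤ ℚ.∣ K-total Y ∣ ℚ.* ℚ.∣ seq (ι 1 /[ suc m ^ 5 ]) k ∣
    main m k = ℚₚ.≤-trans (Estimates.*-monoʳ (Estimates.^-nonNeg 5 (Estimates.0≤τ m)) (p≤∣p∣ (K-total Y)))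
      (Estimates.*-monoˡ (ℚₚ.0≤∣p∣ (K-total Y)) (ℚₚ.≤-trans (Estimates.τ⁵≤inv⁵ m)
        (ℚₚ.≤-trans (ℚₚ.≤-reflexive (sym (ℚₚ.*-identityˡ (recip (fromℕ (suc m) ℚ^.^ 5)))))
          (p≤∣p∣ (1ℚ ℚ.* recip (fromℕ (suc m) ℚ^.^ 5))))))

theorem2 : (q : ℝ) → ι 0 < q → (q<½ : q < fromℚ ½) →
    let open Coefficients q q<½ in
    ∃[ r ] r =O (λ n → ι 1 /[ n ^ 5 ])
    × (∀ n .{{_ : ℕ.NonZero n}} →
    R q n ≈ (ι 4 * q * (ι 1 - q)) ^ n / (sqrt π * (ι 1 - ι 2 * q)) [ √π[1-2q]≠0 ]
    * (ι 1 / sqrt (ι n) [ √n≠0 n ])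
    * (ι 1 + c₁ /[ n ^ 1 ] + c₂ /[ n ^ 2 ]
    + c₃ /[ n ^ 3 ] + c₄ /[ n ^ 4 ] + r n))
theorem2 q 0<q q<½ = r , r-O , λ n → r-≈ n
  where open Asymptotics q 0<q q<½
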